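{- For every $v\equiv 15\pmod{20}$ with $v>15$, there exists a super-simple $2$-$(v,5,1)$DD $\mathcal{D}$ with $f(\mathcal{D})\geq\frac12$.
   Context: A $2$-$(v,5,1)$ directed design ($2$-$(v,5,1)$DD) is a pair $(V,\mathcal{B})$ where $|V|=v$ and $\mathcal{B}$ is a collection of ordered $5$-tuples of distinct elements of $V$ (blocks) such that every ordered pair $(x,y)$ of distinct elements of $V$ occurs in exactly one block as a subsequence. It is super-simple if, after forgetting the order in blocks (giving a $2$-$(v,5,2)$-BIBD), any two blocks intersect in at most two points. A defining set of a $2$-$(v,5,1)$DD $\mathcal{D}=(V,\mathcal{B})$ is a subset $S\subseteq\mathcal{B}$ such that $\mathcal{D}$ is the unique $2$-$(v,5,1)$DD on $V$ whose block collection contains $S$. Define $f(\mathcal{D})$ as the number of blocks in a smallest defining set of $\mathcal{D}$ divided by $|\mathcal{B}|$. -}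

module Defs where

open import Data.Nat using (ℕ; _≤_; _*_)
open import Data.Fin using (Fin; _<_)
open import Data.Fin.Properties using (_≟_)
open import Data.Vec using (Vec; lookup)
open import Data.List using (List; length; filter; allFin; _++_)
open import Data.List.Relation.Binary.Permutation.Propositional using (_↭_)
open import Data.Fin.Properties using (any?)
open import Data.Product using (Σ; ∃; _×_)
open import Relation.Binary.PropositionalEquality using (_≡_)
open import Relation.Nullary using (¬_)

Block : ℕ → Set
Block v = Vec (Fin v) 5

DistinctBlock : ∀ {v} → Block v → Set
DistinctBlock b = ∀ i j → lookup b i ≡ lookup b j → i ≡ j

Occurs : ∀ {v} → Fin v → Fin v → Block v → Set
Occurs x y b = Σ (Fin 5) λ i → Σ (Fin 5) λ j →
  (i < j) × (lookup b i ≡ x) × (lookup b j ≡ y)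

-- A block collection (multiset, represented by a list) is a 2-(v,5,1) directed design:
-- every block has distinct entries, and every ordered pair of distinct points occurs
-- in exactly one block of the collection (counted with multiplicity, i.e. by list position).
IsDD : (v : ℕ) → List (Block v) → Set
IsDD v B =
  (∀ (k : Fin (length B)) → DistinctBlock (Data.List.lookup B k)) ×
  (∀ (x y : Fin v) → ¬ (x ≡ y) →
     Σ (Fin (length B)) λ k →
       Occurs x y (Data.List.lookup B k) ×
       (∀ (k' : Fin (length B)) → Occurs x y (Data.List.lookup B k') → k' ≡ k))

-- number of points common to two blocks (blocks have distinct entries)
common : ∀ {v} → Block v → Block v → ℕ
common b b' = length (filter (λ i → any? (λ j → lookup b i ≟ lookup b' j)) (allFin 5))

SuperSimple : ∀ {v} → List (Block v) → Set
SuperSimple B = ∀ (k k' : Fin (length B)) → ¬ (k ≡ k') →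
  common (Data.List.lookup B k) (Data.List.lookup B k') ≤ 2

SubMultiset : ∀ {v} → List (Block v) → List (Block v) → Set
SubMultiset S B = ∃ λ rest → (S ++ rest) ↭ B

DefiningSet : (v : ℕ) → List (Block v) → List (Block v) → Set
DefiningSet v B S = SubMultiset S B ×
  (∀ (B' : List (Block v)) → IsDD v B' → SubMultiset S B' → B' ↭ B)

-- f(D) ≥ 1/2 : every defining set (in particular a smallest one) has at least |B|/2 blocks
fAtLeastHalf : (v : ℕ) → List (Block v) → Set
fAtLeastHalf v B = ∀ (S : List (Block v)) → DefiningSet v B S → length B ≤ 2 * length S

{-# OPTIONS --safe #-}
-- Two blocks containing x y and y x as adjacent pairs can be exchanged for the blocks with both
-- pairs reversed, so a defining set meets every such pair of blocks. Hence f ≥ 1/2 as soon as there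
-- is an injection σ on the blocks such that every block b is paired with σ b in this way. (A perfect
-- matching is not available, since the number of blocks is odd.) The property is inherited by a
-- design glued from pieces that share no pair of points.
--
-- Wilson's construction is applied to the lines of ℤ/n × ℤ/n, n prime to 60, as a transversal design
-- with eight groups: five groups are full, two are cut down to their first j levels, and the points
-- of the last group get the weights 4 or 10, 10, 10, …; all other points get weight 10. The
-- ingredients are group divisible designs of type 10⁵, …, 10⁸, 10⁵4 and 10⁷4, and a point ∞ is added
-- to each group. The weights 10 produce the orders 10 r + 1; the weight 4 on the line of slope 0
-- then produces the orders 20 t + 15. The finitely many remaining orders and all ingredients come
-- from base blocks found by computer and checked by evaluation.
module Submission where

open import Defs
open import Data.Bool using (Bool; true; false; if_then_else_; _∧_; _∨_; not; T)
open import Data.Nat using (ℕ; zero; suc; _+_; _*_; _∸_; _≤_; _<_; z≤n; s≤s; _<ᵇ_; _≤ᵇ_; _≡ᵇ_; _%_; _/_; NonZero)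
import Data.Nat.Properties as ℕP
open import Data.Nat.DivMod using (m%n<n; m%n%n≡m%n; %-distribˡ-+; %-distribˡ-*; [m+kn]%n≡m%n; m<n⇒m%n≡m; [m+n]%n≡m%n; m≡m%n+[m/n]*n; /-monoˡ-≤)
open import Data.Nat.Coprimality using (Coprime; coprime-Bézout)
open import Data.Nat.GCD using (module Bézout)
open import Data.Nat.Divisibility using (_∣_; _∣?_; ∣-trans; m%n≡0⇔n∣m; ∣⇒≤)
open import Data.Nat.Induction using (<-rec)
open import Data.Nat.Tactic.RingSolver using (solve-∀)
open import Data.Fin as F using (Fin; zero; suc; inject₁; toℕ; fromℕ<; cast; #_)
import Data.Fin.Properties as FP
open import Data.Maybe using (Maybe; just; nothing)
open import Data.Vec as V using (Vec; []; _∷_)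
import Data.Vec.Properties as VP
open import Data.List as L using (List; []; _∷_; length; _++_; allFin; foldr; upTo; map)
import Data.List.Properties as LP
open import Data.List.Membership.Propositional using (_∈_)
import Data.List.Membership.Propositional.Properties as MP
open import Data.List.Relation.Unary.Any as Any using (here; there)
open import Data.List.Relation.Unary.Any.Properties using (lookup-index)
open import Data.List.Relation.Unary.All as All using (All; []; _∷_)
import Data.List.Relation.Unary.All.Properties as AllP
open import Data.List.Relation.Unary.AllPairs as AP using (AllPairs)
import Data.List.Relation.Unary.AllPairs.Properties as APP
open import Data.List.Relation.Binary.Permutation.Propositional using (_↭_)
import Data.List.Relation.Binary.Permutation.Propositional.Properties as PP
open import Data.Product using (Σ; ∃; _×_; _,_; proj₁; proj₂; Σ-syntax)
open import Data.Sum using (_⊎_; inj₁; inj₂)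
import Data.Sum.Properties as SumP
open import Data.Unit using (tt)
open import Data.Empty using (⊥; ⊥-elim)
open import Function using (_∘_; _↔_; mk↔ₛ′; Inverse; Equivalence; id)
open import Function.Construct.Composition using (_↔-∘_)
open import Function.Construct.Symmetry using (↔-sym)
open import Relation.Nullary using (¬_; Dec; yes; no; contradiction)
open import Relation.Nullary.Decidable using (True; toWitness; from-yes; _→-dec_; _×-dec_; _⊎-dec_)
open import Relation.Unary using (Decidable)
open import Relation.Binary.Definitions using (tri<; tri≈; tri>)
open import Relation.Binary.PropositionalEquality

-- Designs with a trade map

-- With all weights 10 every group together with ∞ has order 10 r + 1, so these orders are closed
-- under the construction, and only for them is there an induction. One weight 4 moves the total to
-- 5 modulo 10: the first seven groups still need fillers of order 10 r + 1, and the last one with ∞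
-- has 4 + 10 (c - 1) + 1 points. As n is odd, the total is 15 modulo 20 exactly when c is odd. The
-- value c = 1 is ruled out, since a directed design on five points consists of two blocks on the
-- same points and is not super-simple. The values c = 3, 5, 7 are enough; their fillers have the
-- orders 25, 45, 65, so the recursive step for 20 t + 15 never refers to a smaller order of that
-- form. The number 60 is the least common multiple of 1, ..., 6, the differences of the slopes 0,
-- ..., 6, which must be invertible modulo n. If the two cut-down groups are empty, only the slopes
-- 0, ..., 4 remain, 12 replaces 60, and n = 5 becomes available. Some orders between 251 and 301
-- depend on this exception.

Finite : Set → Set
Finite A = Σ ℕ λ n → A ↔ Fin n

sumF : ∀ n → (Fin n → ℕ) → ℕ
sumF zero    w = 0
sumF (suc n) w = w zero + sumF n (w ∘ suc)

Σ-Fin : ∀ n (w : Fin n → ℕ) → (Σ (Fin n) λ i → Fin (w i)) ↔ Fin (sumF n w)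
Σ-Fin zero    w = mk↔ₛ′ (λ ()) (λ ()) (λ ()) (λ ())
Σ-Fin (suc n) w = ↔-sym FP.+↔⊎ ↔-∘ (mk↔ₛ′ to from to-from from-to)
  where
  open Inverse (Σ-Fin n (w ∘ suc)) renaming (to to t; from to f; strictlyInverseˡ to tf; strictlyInverseʳ to ft)
  to : (Σ (Fin (suc n)) λ i → Fin (w i)) → Fin (w zero) ⊎ Fin (sumF n (w ∘ suc))
  to (zero , a)  = inj₁ a
  to (suc i , a) = inj₂ (t (i , a))
  from : Fin (w zero) ⊎ Fin (sumF n (w ∘ suc)) → Σ (Fin (suc n)) λ i → Fin (w i)
  from (inj₁ a) = zero , a
  from (inj₂ b) = suc (proj₁ (f b)) , proj₂ (f b)
  to-from : ∀ y → to (from y) ≡ y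
  to-from (inj₁ a) = refl
  to-from (inj₂ b) = cong inj₂ (tf b)
  from-to : ∀ x → from (to x) ≡ x
  from-to (zero , a)  = refl
  from-to (suc i , a) = cong (λ z → suc (proj₁ z) , proj₂ z) (ft (i , a))

finite-Σ : {I : Set} {B : I → Set} → Finite I → (∀ i → Finite (B i)) → Finite (Σ I B)
finite-Σ {I} {B} (n , e) b = sumF n w , Σ-Fin n w ↔-∘ mk↔ₛ′ to from to-from from-to
  where
  open Inverse e renaming (to to t; from to f; strictlyInverseˡ to tf; strictlyInverseʳ to ft)
  w : Fin n → ℕ
  w i = proj₁ (b (f i))
  module B i = Inverse (proj₂ (b i))
  to : Σ I B → Σ (Fin n) λ i → Fin (w i)
  to (i , x) = t i , B.to (f (t i)) (subst B (sym (ft i)) x)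
  from : (Σ (Fin n) λ i → Fin (w i)) → Σ I B
  from (i , x) = f i , B.from (f i) x
  pair≡ : ∀ {i j} {x : B i} (p : i ≡ j) {y : B j} → subst B p x ≡ y → (i , x) ≡ (j , y)
  pair≡ refl refl = refl
  from-to : ∀ x → from (to x) ≡ x
  from-to (i , x) = trans (cong (f (t i) ,_) (B.strictlyInverseʳ _ _)) (sym (pair≡ (sym (ft i)) refl))
  lem : ∀ {i j} (p : j ≡ i) (q : f i ≡ f j) (x : Fin (w i)) →
        (j , B.to (f j) (subst B q (B.from (f i) x))) ≡ (i , x)
  lem {i} refl refl x = cong (i ,_) (B.strictlyInverseˡ (f i) x)
  to-from : ∀ y → to (from y) ≡ y
  to-from (i , x) = lem (tf i) _ x

finite-⊎ : {A B : Set} → Finite A → Finite B → Finite (A ⊎ B)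
finite-⊎ {A} {B} (m , e) (n , g) = m + n , ↔-sym FP.+↔⊎ ↔-∘ mk↔ₛ′ to from to-from from-to
  where
  module E = Inverse e
  module G = Inverse g
  to : A ⊎ B → Fin m ⊎ Fin n
  to (inj₁ x) = inj₁ (E.to x)
  to (inj₂ x) = inj₂ (G.to x)
  from : Fin m ⊎ Fin n → A ⊎ B
  from (inj₁ x) = inj₁ (E.from x)
  from (inj₂ x) = inj₂ (G.from x)
  to-from : ∀ y → to (from y) ≡ y
  to-from (inj₁ x) = cong inj₁ (E.strictlyInverseˡ x)
  to-from (inj₂ x) = cong inj₂ (G.strictlyInverseˡ x)
  from-to : ∀ y → from (to y) ≡ y
  from-to (inj₁ x) = cong inj₁ (E.strictlyInverseʳ x)
  from-to (inj₂ x) = cong inj₂ (G.strictlyInverseʳ x)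

finite-Fin : ∀ n → Finite (Fin n)
finite-Fin n = n , mk↔ₛ′ (λ x → x) (λ x → x) (λ _ → refl) (λ _ → refl)

-- `R` is the set of ordered pairs to be covered. Inequality gives a directed design, different
-- groups give a group divisible design, and leaving out the pairs inside a set gives a design with
-- a hole. Super-simplicity appears as `simple`: three common points force two blocks to be equal.
-- `σ` is only injective, not an involution.
record Design (V : Set) (R : V → V → Set) : Set₁ where
  field
    Blk    : Set
    finite : Finite Blk
    pt     : Blk → Fin 5 → V
    sound  : ∀ k {i j} → i ≢ j → R (pt k i) (pt k j)
    cover  : ∀ {x y} → R x y →
             Σ[ k ∈ Blk ] Σ[ i ∈ Fin 5 ] Σ[ j ∈ Fin 5 ] (i F.< j) × (pt k i ≡ x) × (pt k j ≡ y)
    unique : ∀ {k l i j i' j'} → i F.< j → i' F.< j' →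
             pt k i ≡ pt l i' → pt k j ≡ pt l j' → k ≡ l
    simple : ∀ {k l i₁ i₂ i₃ j₁ j₂ j₃} → i₁ F.< i₂ → i₂ F.< i₃ →
             j₁ ≢ j₂ → j₁ ≢ j₃ → j₂ ≢ j₃ →
             pt k i₁ ≡ pt l j₁ → pt k i₂ ≡ pt l j₂ → pt k i₃ ≡ pt l j₃ → k ≡ l
    σ      : Blk → Blk
    σ-inj  : ∀ {k l} → σ k ≡ σ l → k ≡ l
    trade  : ∀ k → Σ[ p ∈ Fin 4 ] Σ[ q ∈ Fin 4 ]
             (pt k (inject₁ p) ≡ pt (σ k) (suc q)) × (pt k (suc p) ≡ pt (σ k) (inject₁ q))

-- Blocks of different pieces share at most one point, since two common points would
-- put the same pair into two pieces.
amalgam : {V I : Set} {R : V → V → Set} {U : I → Set} {Q : ∀ i → U i → U i → Set} →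
          Finite I → (∀ i → Design (U i) (Q i)) →
          (e : ∀ i → U i → V) →
          (∀ i {a b} → e i a ≡ e i b → a ≡ b) →
          (∀ i {a b} → Q i a b → R (e i a) (e i b)) →
          (∀ {x y} → R x y → Σ[ i ∈ I ] Σ[ a ∈ U i ] Σ[ b ∈ U i ] Q i a b × (e i a ≡ x) × (e i b ≡ y)) →
          (∀ {i j a b c d} → Q i a b → Q j c d → e i a ≡ e j c → e i b ≡ e j d → i ≡ j) →
          Design V R
amalgam {V} {I} {R} {U} {Q} fin D e e-inj into cov piece = record
  { Blk    = Σ I (λ i → D.Blk i)
  ; finite = finite-Σ fin (λ i → D.finite i)
  ; pt     = λ { (i , k) p → e i (D.pt i k p) }
  ; sound  = λ { (i , k) ne → into i (D.sound i k ne) }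
  ; cover  = cover'
  ; unique = unique'
  ; simple = simple'
  ; σ      = λ { (i , k) → i , D.σ i k }
  ; σ-inj  = σ-inj'
  ; trade  = λ { (i , k) → let (p , q , u , v) = D.trade i k in p , q , cong (e i) u , cong (e i) v }
  }
  where
  module D i = Design (D i)
  cover' : ∀ {x y} → R x y → _
  cover' r with cov r
  ... | i , a , b , q , refl , refl with D.cover i q
  ... | k , p , p' , lt , refl , refl = (i , k) , p , p' , lt , refl , refl
  σ-inj' : {k l : Σ I (λ i → D.Blk i)} →
           _≡_ {A = Σ I (λ i → D.Blk i)} (proj₁ k , D.σ (proj₁ k) (proj₂ k)) (proj₁ l , D.σ (proj₁ l) (proj₂ l)) → k ≡ l
  σ-inj' {i , k} {j , l} eq = go (cong proj₁ eq) eq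
    where
    go : ∀ {i j k l} → i ≡ j → _≡_ {A = Σ I (λ i → D.Blk i)} (i , D.σ i k) (j , D.σ j l) → (i , k) ≡ (j , l)
    go {i} refl eq = cong (i ,_) (D.σ-inj i (Σ-inj eq))
      where
      Σ-inj : ∀ {i} {x y : D.Blk i} → (i , x) ≡ (i , y) → x ≡ y
      Σ-inj refl = refl
  unique' : {k l : Σ I (λ i → D.Blk i)} {i j i' j' : Fin 5} → i F.< j → i' F.< j' →
            e (proj₁ k) (D.pt (proj₁ k) (proj₂ k) i) ≡ e (proj₁ l) (D.pt (proj₁ l) (proj₂ l) i') →
            e (proj₁ k) (D.pt (proj₁ k) (proj₂ k) j) ≡ e (proj₁ l) (D.pt (proj₁ l) (proj₂ l) j') → k ≡ l
  unique' {i , k} {j , l} lt lt' u v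
    with piece (D.sound i k (FP.<⇒≢ lt)) (D.sound j l (FP.<⇒≢ lt')) u v
  ... | refl = cong (i ,_) (D.unique i lt lt' (e-inj i u) (e-inj i v))
  simple' : {k l : Σ I (λ i → D.Blk i)} {i₁ i₂ i₃ j₁ j₂ j₃ : Fin 5} → i₁ F.< i₂ → i₂ F.< i₃ →
            j₁ ≢ j₂ → j₁ ≢ j₃ → j₂ ≢ j₃ → _ → _ → _ → k ≡ l
  simple' {i , k} {j , l} lt lt' n₁ n₂ n₃ u v w
    with piece (D.sound i k (FP.<⇒≢ lt)) (D.sound j l n₁) u v
  ... | refl = cong (i ,_) (D.simple i lt lt' n₁ n₂ n₃ (e-inj i u) (e-inj i v) (e-inj i w))

-- Also used with the identity bijection, to replace `R` by an equivalent relation.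
relabel : {V W : Set} {R : V → V → Set} {S : W → W → Set} (f : V ↔ W) →
          (∀ {x y} → R x y → S (Inverse.to f x) (Inverse.to f y)) →
          (∀ {x y} → S x y → R (Inverse.from f x) (Inverse.from f y)) →
          Design V R → Design W S
relabel f into back D = amalgam (finite-Fin 1) (λ _ → D) (λ _ → to) (λ _ → to-inj) (λ _ → into)
  (λ {x} {y} s → zero , from x , from y , back s , strictlyInverseˡ x , strictlyInverseˡ y)
  (λ {i} {j} _ _ _ _ → one i j)
  where
  open Inverse f
  to-inj : ∀ {a b} → to a ≡ to b → a ≡ b
  to-inj {a} {b} p = trans (sym (strictlyInverseʳ a)) (trans (cong from p) (strictlyInverseʳ b))
  one : (i j : Fin 1) → i ≡ j
  one zero zero = refl

-- From designs to lists of blocks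

private
  variable
    v : ℕ

Full : ℕ → Set₁
Full v = Design (Fin v) _≢_

toBlock : (Fin 5 → Fin v) → Block v
toBlock = V.tabulate

-- Stated for a bare family of blocks and not for a `Design`, because it is applied to the exchanged
-- family as well, for which no trade map is at hand.
IsDD-tabulate : ∀ {N} (p : Fin N → Fin 5 → Fin v) →
  (∀ k {i j} → p k i ≡ p k j → i ≡ j) →
  (∀ x y → x ≢ y → Σ[ k ∈ Fin N ] Σ[ i ∈ Fin 5 ] Σ[ j ∈ Fin 5 ] (i F.< j) × (p k i ≡ x) × (p k j ≡ y)) →
  (∀ {k l i j i' j'} → i F.< j → i' F.< j' → p k i ≡ p l i' → p k j ≡ p l j' → k ≡ l) →
  IsDD v (L.tabulate (toBlock ∘ p))
IsDD-tabulate {v} {N} p inj cov uni = distinct , covers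
  where
  B : Fin N → Block v
  B = toBlock ∘ p
  ℓ≡N : length (L.tabulate B) ≡ N
  ℓ≡N = LP.length-tabulate B
  c : Fin (length (L.tabulate B)) → Fin N
  c = cast ℓ≡N
  at : ∀ k i → V.lookup (L.lookup (L.tabulate B) k) i ≡ p (c k) i
  at k i = trans (cong (λ b → V.lookup b i)
    (trans (cong (L.lookup (L.tabulate B)) (sym (FP.cast-involutive (sym ℓ≡N) ℓ≡N k))) (LP.lookup-tabulate B (c k))))
    (VP.lookup∘tabulate (p (c k)) i)
  distinct : ∀ k → DistinctBlock (L.lookup (L.tabulate B) k)
  distinct k i j eq = inj (c k) (trans (sym (at k i)) (trans eq (at k j)))
  covers : ∀ x y → x ≢ y → _
  covers x y ne with cov x y ne
  ... | k , i , j , lt , refl , refl = k' , (i , j , lt , at' i , at' j) , only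
    where
    k' = cast (sym ℓ≡N) k
    ck' : c k' ≡ k
    ck' = FP.cast-involutive ℓ≡N (sym ℓ≡N) k
    at' : ∀ i → V.lookup (L.lookup (L.tabulate B) k') i ≡ p k i
    at' i = trans (at k' i) (cong (λ z → p z i) ck')
    only : ∀ l → Occurs (p k i) (p k j) (L.lookup (L.tabulate B) l) → l ≡ k'
    only l (i' , j' , lt' , u , w) =
      trans (sym (FP.cast-involutive (sym ℓ≡N) ℓ≡N l)) (cong (cast (sym ℓ≡N))
        (uni lt' lt (trans (sym (at l i')) u) (trans (sym (at l j')) w)))

-- Filtering keeps the list increasing, so three survivors come in the order i < j < k that `simple`
-- expects.
filter-length≤2 : {P : Fin 5 → Set} (P? : Decidable P) →
  (∀ {i j k} → i F.< j → j F.< k → P i → P j → P k → ⊥) →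
  length (L.filter P? (allFin 5)) ≤ 2
filter-length≤2 {P} P? no3 = go (allFin 5) increasing
  where
  increasing : AllPairs F._<_ (allFin 5)
  increasing = from-yes (AP.allPairs? FP._<?_ (allFin 5))
  go : ∀ xs → AllPairs F._<_ xs → length (L.filter P? xs) ≤ 2
  go xs inc with L.filter P? xs | APP.filter⁺ P? inc | AllP.all-filter P? xs
  ... | L.[] | _ | _ = z≤n
  ... | _ L.∷ L.[] | _ | _ = s≤s z≤n
  ... | _ L.∷ _ L.∷ L.[] | _ | _ = s≤s (s≤s z≤n)
  ... | _ L.∷ _ L.∷ _ L.∷ _ | (ij All.∷ _) AP.∷ ((jk All.∷ _) AP.∷ _) | pi All.∷ pj All.∷ pk All.∷ _ = ⊥-elim (no3 ij jk pi pj pk)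

-- Trades: two blocks with a pair in opposite adjacent positions

swapAt : Fin 4 → Fin 5 → Fin 5
swapAt r i with i FP.≟ inject₁ r | i FP.≟ suc r
... | yes _ | _     = suc r
... | no _  | yes _ = inject₁ r
... | no _  | no _  = i

abstract
  swapAt-involutive : ∀ r i → swapAt r (swapAt r i) ≡ i
  swapAt-involutive = from-yes (FP.all? λ r → FP.all? λ i → swapAt r (swapAt r i) FP.≟ i)

  -- An adjacent transposition has a single inversion. This is why trades are restricted to adjacent
  -- entries: no other ordered pair of the block changes.
  swapAt-< : ∀ r i j → i F.< j → (swapAt r i F.< swapAt r j) ⊎ ((i ≡ inject₁ r) × (j ≡ suc r))
  swapAt-< = from-yes (FP.all? λ r → FP.all? λ i → FP.all? λ j →
    (i FP.<? j) →-dec ((swapAt r i FP.<? swapAt r j) ⊎-dec ((i FP.≟ inject₁ r) ×-dec (j FP.≟ suc r))))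

  swapAt-left : ∀ r → swapAt r (inject₁ r) ≡ suc r
  swapAt-left = from-yes (FP.all? λ r → swapAt r (inject₁ r) FP.≟ suc r)

  swapAt-right : ∀ r → swapAt r (suc r) ≡ inject₁ r
  swapAt-right = from-yes (FP.all? λ r → swapAt r (suc r) FP.≟ inject₁ r)

  adjacent : ∀ (r : Fin 4) → inject₁ r F.< suc r
  adjacent = from-yes (FP.all? λ (r : Fin 4) → inject₁ r FP.<? suc r)

  -- An ordered pair that survives the swap identifies the block it came from; `refute` below needs
  -- one.
  some-pair-kept : ∀ r → Σ[ i ∈ Fin 5 ] Σ[ j ∈ Fin 5 ] (i F.< j) × (swapAt r i F.< swapAt r j)
  some-pair-kept = from-yes (FP.all? λ r → FP.any? λ i → FP.any? λ j → (i FP.<? j) ×-dec (swapAt r i FP.<? swapAt r j))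

module _ {v N : ℕ} (p : Fin N → Fin 5 → Fin v)
  (inj : ∀ k {i j} → p k i ≡ p k j → i ≡ j)
  (cov : ∀ x y → x ≢ y → Σ[ k ∈ Fin N ] Σ[ i ∈ Fin 5 ] Σ[ j ∈ Fin 5 ] (i F.< j) × (p k i ≡ x) × (p k j ≡ y))
  (uni : ∀ {k l i j i' j'} → i F.< j → i' F.< j' → p k i ≡ p l i' → p k j ≡ p l j' → k ≡ l)
  where

  -- Exchanging the adjacent entries x y of one block and y x of the other.
  module Switch (k₀ s : Fin N) (P Q : Fin 4)
    (xx : p k₀ (inject₁ P) ≡ p s (suc Q)) (yy : p k₀ (suc P) ≡ p s (inject₁ Q)) where

    -- Inside one block the entries are distinct, so the positions would satisfy both P = Q + 1 and
    -- P + 1 = Q.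
    s≢k₀ : s ≢ k₀
    s≢k₀ refl = opposite P Q (inj s xx) (inj s yy)
      where
      opposite : ∀ (P Q : Fin 4) → inject₁ P ≡ suc Q → suc P ≡ inject₁ Q → ⊥
      opposite = from-yes (FP.all? λ (P : Fin 4) → FP.all? λ (Q : Fin 4) →
        (inject₁ P FP.≟ suc Q) →-dec ((suc P FP.≟ inject₁ Q) →-dec no (λ ())))

    τ : Fin N → Fin 5 → Fin 5
    τ k with k FP.≟ k₀ | k FP.≟ s
    ... | yes _ | _     = swapAt P
    ... | no _  | yes _ = swapAt Q
    ... | no _  | no _  = id

    τ-k₀ : ∀ i → τ k₀ i ≡ swapAt P i
    τ-k₀ i with k₀ FP.≟ k₀ | k₀ FP.≟ s
    ... | yes _ | _ = refl
    ... | no n  | _ = contradiction refl n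

    τ-s : ∀ i → τ s i ≡ swapAt Q i
    τ-s i with s FP.≟ k₀ | s FP.≟ s
    ... | yes e | _     = contradiction e s≢k₀
    ... | no _  | yes _ = refl
    ... | no _  | no n  = contradiction refl n

    τ-else : ∀ {k} → k ≢ k₀ → k ≢ s → ∀ i → τ k i ≡ i
    τ-else {k} a b i with k FP.≟ k₀ | k FP.≟ s
    ... | yes e | _     = contradiction e a
    ... | no _  | yes e = contradiction e b
    ... | no _  | no _  = refl

    τ-involutive : ∀ k i → τ k (τ k i) ≡ i
    τ-involutive k i with k FP.≟ k₀ | k FP.≟ s
    ... | yes _ | _     = swapAt-involutive P i
    ... | no _  | yes _ = swapAt-involutive Q i
    ... | no _  | no _  = refl

    p' : Fin N → Fin 5 → Fin v
    p' k i = p k (τ k i)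

    -- The pair that `k` loses by the exchange is found afterwards in the block `m`, at the
    -- positions i' < j'.
    Reversed : Fin N → Fin 5 → Fin 5 → Set
    Reversed k i j = (τ k i ≡ j) × (τ k j ≡ i) × Σ[ m ∈ Fin N ] Σ[ i' ∈ Fin 5 ] Σ[ j' ∈ Fin 5 ]
      (i' F.< j') × (τ m i' ≡ j') × (τ m j' ≡ i') × (p k i ≡ p m j') × (p k j ≡ p m i')

    dichotomy : ∀ k i j → i F.< j → (τ k i F.< τ k j) ⊎ Reversed k i j
    dichotomy k i j lt with k FP.≟ k₀ | k FP.≟ s
    ... | no _ | no _ = inj₁ lt
    ... | yes refl | _ with swapAt-< P i j lt
    ...   | inj₁ lt' = inj₁ lt'
    ...   | inj₂ (refl , refl) = inj₂ (swapAt-left P , swapAt-right P , s , inject₁ Q , suc Q , adjacent Q ,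
              trans (τ-s _) (swapAt-left Q) , trans (τ-s _) (swapAt-right Q) , xx , yy)
    dichotomy k i j lt | no _ | yes refl with swapAt-< Q i j lt
    ...   | inj₁ lt' = inj₁ lt'
    ...   | inj₂ (refl , refl) = inj₂ (swapAt-left Q , swapAt-right Q , k₀ , inject₁ P , suc P , adjacent P ,
              trans (τ-k₀ _) (swapAt-left P) , trans (τ-k₀ _) (swapAt-right P) , sym yy , sym xx)

    inj' : ∀ k {i j} → p' k i ≡ p' k j → i ≡ j
    inj' k {i} {j} eq = trans (sym (τ-involutive k i)) (trans (cong (τ k) (inj k eq)) (τ-involutive k j))

    cov' : ∀ x y → x ≢ y → Σ[ k ∈ Fin N ] Σ[ i ∈ Fin 5 ] Σ[ j ∈ Fin 5 ] (i F.< j) × (p' k i ≡ x) × (p' k j ≡ y)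
    cov' x y ne with cov x y ne
    ... | k , i , j , lt , refl , refl with dichotomy k i j lt
    ...   | inj₁ lt' = k , τ k i , τ k j , lt' , cong (p k) (τ-involutive k i) , cong (p k) (τ-involutive k j)
    ...   | inj₂ (_ , _ , m , i' , j' , lt' , a , b , u , w) =
              m , i' , j' , lt' , trans (cong (p m) a) (sym u) , trans (cong (p m) b) (sym w)

    -- The pair that `k` gains belonged to `m` before the exchange, so uniqueness in the old family
    -- identifies `l` with `m`. But there the pair is itself one of the two that get reversed, so it
    -- is not kept.
    mixed : ∀ {k l i j i' j'} → Reversed k i j → i' F.< j' → τ l i' F.< τ l j' →
            p' k i ≡ p' l i' → p' k j ≡ p' l j' → ⊥
    mixed {k} {l} {i} {j} {i'} {j'} (a , b , m , ī , j̄ , lt , c , d , u , w) lt' lt'' e f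
      with uni lt lt'' (trans (sym w) (trans (cong (p k) (sym a)) e)) (trans (sym u) (trans (cong (p k) (sym b)) f))
    ... | refl = FP.<-asym lt (subst₂ F._<_ i'≡ j'≡ lt')
      where
      i'≡ : i' ≡ j̄
      i'≡ = trans (sym (τ-involutive l i')) (trans (cong (τ l) (sym (inj l (trans (sym w) (trans (cong (p k) (sym a)) e))))) c)
      j'≡ : j' ≡ ī
      j'≡ = trans (sym (τ-involutive l j')) (trans (cong (τ l) (sym (inj l (trans (sym u) (trans (cong (p k) (sym b)) f))))) d)

    uni' : ∀ {k l i j i' j'} → i F.< j → i' F.< j' → p' k i ≡ p' l i' → p' k j ≡ p' l j' → k ≡ l
    uni' {k} {l} {i} {j} {i'} {j'} lt lt' e f with dichotomy k i j lt | dichotomy l i' j' lt'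
    ... | inj₁ a | inj₁ b = uni a b e f
    ... | inj₂ a | inj₁ b = ⊥-elim (mixed {k} {l} {i} {j} {i'} {j'} a lt' b e f)
    ... | inj₁ a | inj₂ b = ⊥-elim (mixed {l} {k} {i'} {j'} {i} {j} b lt a (sym e) (sym f))
    ... | inj₂ (a , b , _) | inj₂ (c , d , _) =
          uni lt lt' (trans (cong (p k) (sym b)) (trans f (cong (p l) d))) (trans (cong (p k) (sym a)) (trans e (cong (p l) c)))

    B B' : Fin N → Block v
    B  = toBlock ∘ p
    B' = toBlock ∘ p'

    B-at : ∀ {k l} → B k ≡ B l → ∀ i → p k i ≡ p l i
    B-at {k} {l} e i = trans (sym (VP.lookup∘tabulate (p k) i)) (trans (cong (λ b → V.lookup b i) e) (VP.lookup∘tabulate (p l) i))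

    B-injective : ∀ {k l} → B k ≡ B l → k ≡ l
    B-injective e = uni 0<1 0<1 (B-at e zero) (B-at e (suc zero))
      where
      0<1 : F._<_ {5} {5} zero (suc zero)
      0<1 = s≤s z≤n

    _≟B_ : (a b : Block v) → Dec (a ≡ b)
    _≟B_ = VP.≡-dec FP._≟_

    -- Defined on blocks rather than on indices, so that it can be mapped over the permutation
    -- between `S ++ rest` and the design.
    replace : Block v → Block v
    replace b with b ≟B B k₀ | b ≟B B s
    ... | yes _ | _     = B' k₀
    ... | no _  | yes _ = B' s
    ... | no _  | no _  = b

    replace-B : ∀ k → replace (B k) ≡ B' k
    replace-B k with B k ≟B B k₀ | B k ≟B B s
    ... | yes e | _     = cong B' (sym (B-injective e))
    ... | no _  | yes e = cong B' (sym (B-injective e))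
    ... | no a  | no b  = VP.tabulate-cong (λ i → cong (p k) (sym (τ-else {k} (λ { refl → a refl }) (λ { refl → b refl }) i)))

    replace-id : ∀ {b} → b ≢ B k₀ → b ≢ B s → replace b ≡ b
    replace-id {b} m n with b ≟B B k₀ | b ≟B B s
    ... | yes e | _     = contradiction e m
    ... | no _  | yes e = contradiction e n
    ... | no _  | no _  = refl

    -- If `S` contains neither block, `replace` fixes every member of `S`, so the exchanged family
    -- is another directed design that contains `S`. It would have to be a permutation of the
    -- original one, yet its block `B' k₀` does not occur there.
    not-defining : ∀ S → DefiningSet v (L.tabulate B) S → ¬ (B k₀ ∈ S) → ¬ (B s ∈ S) → ⊥
    not-defining S ((rest , perm) , only) m n = refute (MP.∈-tabulate⁻ (PP.∈-resp-↭ B'↭B (MP.∈-tabulate⁺ {f = B'} k₀)))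
      where
      untouched : L.map replace S ≡ S
      untouched = LP.map-id-local (All.tabulate λ {b} b∈S →
        replace-id {b} (λ { refl → m b∈S }) (λ { refl → n b∈S }))
      all-replaced : L.map replace (L.tabulate B) ≡ L.tabulate B'
      all-replaced = trans (LP.map-tabulate B replace) (LP.tabulate-cong replace-B)
      perm' : (S ++ L.map replace rest) ↭ L.tabulate B'
      perm' = subst₂ _↭_ (trans (LP.map-++ replace S rest) (cong (_++ L.map replace rest) untouched)) all-replaced
        (PP.map⁺ replace perm)
      B'↭B : L.tabulate B' ↭ L.tabulate B
      B'↭B = only (L.tabulate B') (IsDD-tabulate p' inj' cov' uni') (_ , perm')
      refute : (∃ λ l → B' k₀ ≡ B l) → ⊥
      -- A pair whose order survives lies in the old block `k₀` and also in the old block `l`, so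
      -- both are the same block; but the swap did move the entry at position P.
      refute (l , e) with some-pair-kept P
      ... | i , j , lt , lt' with uni (subst₂ F._<_ (sym (τ-k₀ i)) (sym (τ-k₀ j)) lt') lt (same i) (same j)
        where
        same : ∀ i → p' k₀ i ≡ p l i
        same i = trans (sym (VP.lookup∘tabulate (p' k₀) i)) (trans (cong (λ b → V.lookup b i) e) (VP.lookup∘tabulate (p l) i))
      ... | refl = contradiction (trans (sym (swapAt-left P)) (trans (sym (τ-k₀ _)) (inj k₀ (same (inject₁ P)))))
                     (λ q → FP.<⇒≢ (adjacent P) (sym q))
        where
        same : ∀ i → p' k₀ i ≡ p k₀ i
        same i = trans (sym (VP.lookup∘tabulate (p' k₀) i)) (trans (cong (λ b → V.lookup b i) e) (VP.lookup∘tabulate (p k₀) i))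

-- The list of blocks, its super-simplicity and the bound

Result : ℕ → Set
Result v = Σ (List (Block v)) λ B → IsDD v B × SuperSimple B × fAtLeastHalf v B

result : Full v → Result v
result {v} D = L.tabulate B , IsDD-tabulate p inj cov uni , supersimple , half
  where
  open Design D
  N : ℕ
  N = proj₁ finite
  open Inverse (proj₂ finite)
  p : Fin N → Fin 5 → Fin v
  p k = pt (from k)
  from-inj : ∀ {k l} → from k ≡ from l → k ≡ l
  from-inj {k} {l} e = trans (sym (strictlyInverseˡ k)) (trans (cong to e) (strictlyInverseˡ l))
  to-inj : ∀ {k l} → to k ≡ to l → k ≡ l
  to-inj {k} {l} e = trans (sym (strictlyInverseʳ k)) (trans (cong from e) (strictlyInverseʳ l))
  inj : ∀ k {i j} → p k i ≡ p k j → i ≡ j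
  inj k {i} {j} e with i FP.≟ j
  ... | yes q = q
  ... | no n  = contradiction e (sound (from k) n)
  cov : ∀ x y → x ≢ y → Σ[ k ∈ Fin N ] Σ[ i ∈ Fin 5 ] Σ[ j ∈ Fin 5 ] (i F.< j) × (p k i ≡ x) × (p k j ≡ y)
  cov x y ne with cover ne
  ... | k , i , j , lt , u , w = to k , i , j , lt , trans (cong (λ z → pt z i) (strictlyInverseʳ k)) u , trans (cong (λ z → pt z j) (strictlyInverseʳ k)) w
  uni : ∀ {k l i j i' j'} → i F.< j → i' F.< j' → p k i ≡ p l i' → p k j ≡ p l j' → k ≡ l
  uni lt lt' a b = from-inj (unique lt lt' a b)
  B : Fin N → Block v
  B = toBlock ∘ p
  ℓ≡N : length (L.tabulate B) ≡ N
  ℓ≡N = LP.length-tabulate B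
  at : ∀ k i → V.lookup (L.lookup (L.tabulate B) k) i ≡ p (cast ℓ≡N k) i
  at k i = trans (cong (λ b → V.lookup b i)
    (trans (cong (L.lookup (L.tabulate B)) (sym (FP.cast-involutive (sym ℓ≡N) ℓ≡N k))) (LP.lookup-tabulate B (cast ℓ≡N k))))
    (VP.lookup∘tabulate (p (cast ℓ≡N k)) i)
  supersimple : SuperSimple (L.tabulate B)
  supersimple k l ne = filter-length≤2 (λ i → FP.any? λ j → V.lookup (L.lookup (L.tabulate B) k) i FP.≟ V.lookup (L.lookup (L.tabulate B) l) j) λ { {i₁} {i₂} {i₃} lt lt' (j₁ , e₁) (j₂ , e₂) (j₃ , e₃) →
    ne (cast-inj (from-inj (simple lt lt'
      (λ { refl → FP.<⇒≢ lt (same k (trans e₁ (sym e₂))) })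
      (λ { refl → FP.<⇒≢ (FP.<-trans lt lt') (same k (trans e₁ (sym e₃))) })
      (λ { refl → FP.<⇒≢ lt' (same k (trans e₂ (sym e₃))) })
      (trans (sym (at k i₁)) (trans e₁ (at l j₁)))
      (trans (sym (at k i₂)) (trans e₂ (at l j₂)))
      (trans (sym (at k i₃)) (trans e₃ (at l j₃)))))) }
    where
    cast-inj : ∀ {k l} → cast ℓ≡N k ≡ cast ℓ≡N l → k ≡ l
    cast-inj {k} {l} e = trans (sym (FP.cast-involutive (sym ℓ≡N) ℓ≡N k)) (trans (cong (cast (sym ℓ≡N)) e) (FP.cast-involutive (sym ℓ≡N) ℓ≡N l))
    same : ∀ k {i j} → V.lookup (L.lookup (L.tabulate B) k) i ≡ V.lookup (L.lookup (L.tabulate B) k) j → i ≡ j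
    same k {i} {j} e = inj (cast ℓ≡N k) (trans (sym (at k i)) (trans e (at k j)))
  mate : Fin N → Fin N
  mate k = to (σ (from k))
  mate-inj : ∀ {k l} → mate k ≡ mate l → k ≡ l
  mate-inj e = from-inj (σ-inj (to-inj e))
  -- Every block k has itself or its partner in `S`. Record which of the two it is, and the position
  -- in `S`: the position determines a block, hence k, because both the block map and the partner
  -- map are injective. So N is at most twice the length of `S`.
  half : fAtLeastHalf v (L.tabulate B)
  half S def = subst₂ _≤_ (sym ℓ≡N) (cong (length S +_) (sym (ℕP.+-identityʳ _))) (FP.injective⇒≤ h-inj)
    where
    _≟B_ : (a b : Block v) → Dec (a ≡ b)
    _≟B_ = VP.≡-dec FP._≟_
    _∈?_ : (b : Block v) (S : List (Block v)) → Dec (b ∈ S)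
    b ∈? S = Any.any? (b ≟B_) S
    B-inj : ∀ {k l} → B k ≡ B l → k ≡ l
    B-inj {k} {l} e = uni {i = zero} {suc zero} (s≤s z≤n) (s≤s z≤n) (B-at zero) (B-at (suc zero))
      where
      B-at : ∀ i → p k i ≡ p l i
      B-at i = trans (sym (VP.lookup∘tabulate (p k) i)) (trans (cong (λ b → V.lookup b i) e) (VP.lookup∘tabulate (p l) i))
    meets : ∀ k → (B k ∈ S) ⊎ (B (mate k) ∈ S)
    meets k with B k ∈? S | B (mate k) ∈? S
    ... | yes a | _     = inj₁ a
    ... | no _  | yes b = inj₂ b
    ... | no a  | no b  = let (P , Q , u , w) = trade (from k) in
      ⊥-elim (Switch.not-defining p inj cov uni k (mate k) P Q
        (trans u (cong (λ z → pt z (suc Q)) (sym (strictlyInverseʳ _))))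
        (trans w (cong (λ z → pt z (inject₁ Q)) (sym (strictlyInverseʳ _)))) S def a b)
    Met : Fin N → Set
    Met k = (B k ∈ S) ⊎ (B (mate k) ∈ S)
    code : ∀ {k} → Met k → Fin (length S) ⊎ Fin (length S)
    code (inj₁ a) = inj₁ (Any.index a)
    code (inj₂ b) = inj₂ (Any.index b)
    located : ∀ {b c} (x : b ∈ S) (y : c ∈ S) → Any.index x ≡ Any.index y → b ≡ c
    located x y e = trans (lookup-index x) (trans (cong (L.lookup S) e) (sym (lookup-index y)))
    code-inj : ∀ {k l} (a : Met k) (b : Met l) → code a ≡ code b → k ≡ l
    code-inj (inj₁ a) (inj₁ b) e = B-inj (located a b (SumP.inj₁-injective e))
    code-inj (inj₂ a) (inj₂ b) e = mate-inj (B-inj (located a b (SumP.inj₂-injective e)))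
    code-inj (inj₁ _) (inj₂ _) ()
    code-inj (inj₂ _) (inj₁ _) ()
    h : Fin N → Fin (length S + length S)
    h k = F.join (length S) (length S) (code (meets k))
    h-inj : ∀ {k l} → h k ≡ h l → k ≡ l
    h-inj {k} {l} e = code-inj (meets k) (meets l)
      (trans (sym (FP.splitAt-join (length S) (length S) (code (meets k))))
        (trans (cong (F.splitAt (length S)) e) (FP.splitAt-join (length S) (length S) (code (meets l)))))

-- Difference families, checked by evaluation

∧-T : ∀ {a b} → T (a ∧ b) → T a × T b
∧-T {true} {true} _ = tt , tt

not-T : ∀ {a} → T (not a) → ¬ T a
not-T {false} _ ()

∨-T : ∀ {a b} → T (a ∨ b) → T a ⊎ T b
∨-T {true}  _ = inj₁ tt
∨-T {false} t = inj₂ t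

allN : ℕ → (ℕ → Bool) → Bool
allN zero    f = true
allN (suc n) f = f n ∧ allN n f

allN-sound : ∀ n {f} → T (allN n f) → ∀ {x} → x < n → T (f x)
allN-sound (suc n) t {x} (s≤s x≤n) with ∧-T t | ℕP.m≤n⇒m<n∨m≡n x≤n
... | _ , rest | inj₁ x<n = allN-sound n rest x<n
... | h , _    | inj₂ refl = h

allF : ∀ n → (Fin n → Bool) → Bool
allF zero    f = true
allF (suc n) f = f zero ∧ allF n (f ∘ suc)

allF-sound : ∀ n {f} → T (allF n f) → ∀ i → T (f i)
allF-sound (suc n) t zero    = proj₁ (∧-T t)
allF-sound (suc n) {f} t (suc i) = allF-sound n (proj₂ (∧-T {f zero} t)) i

_==_ : ℕ × ℕ → ℕ × ℕ → Bool
(a , b) == (c , d) = (a ≡ᵇ c) ∧ (b ≡ᵇ d)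

==-sound : ∀ {x y} → T (x == y) → x ≡ y
==-sound {a , b} {c , d} t = let (p , q) = ∧-T t in cong₂ _,_ (ℕP.≡ᵇ⇒≡ a c p) (ℕP.≡ᵇ⇒≡ b d q)

==-complete : ∀ {x y} → x ≡ y → T (x == y)
==-complete {a , b} refl with a ≡ᵇ a | ℕP.≡⇒≡ᵇ a a refl | b ≡ᵇ b | ℕP.≡⇒≡ᵇ b b refl
... | true | _ | true | _ = tt

_=F_ : ∀ {n} → Fin n → Fin n → Bool
i =F j = toℕ i ≡ᵇ toℕ j

=F-sound : ∀ {n} {i j : Fin n} → T (i =F j) → i ≡ j
=F-sound {i = i} {j} t = FP.toℕ-injective (ℕP.≡ᵇ⇒≡ (toℕ i) (toℕ j) t)

T-true : ∀ {b} → T b → b ≡ true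
T-true {true} _ = refl

-- The typed form in which designs are stated; all checks evaluate on the plain number pairs given
-- by `raw`.
record Pts (K : ℕ) (w : ℕ → ℕ) : Set where
  constructor _▸_
  field
    group : Fin K
    place : Fin (w (toℕ group))

raw : ∀ {K w} → Pts K w → ℕ × ℕ
raw (o ▸ a) = toℕ o , toℕ a

Valid : ℕ → (ℕ → ℕ) → ℕ × ℕ → Set
Valid K w (o , a) = (o < K) × (a < w o)

valid : ∀ {K w} (x : Pts K w) → Valid K w (raw x)
valid (o ▸ a) = FP.toℕ<n o , FP.toℕ<n a

raw-injective : ∀ {K w} {x y : Pts K w} → raw x ≡ raw y → x ≡ y
raw-injective {x = o ▸ a} {o' ▸ a'} e with FP.toℕ-injective {i = o} {o'} (cong proj₁ e)
... | refl = cong (o ▸_) (FP.toℕ-injective (cong proj₂ e))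

point : ∀ {K w} x → Valid K w x → Pts K w
point {K} {w} (o , a) (p , q) = fromℕ< p ▸ fromℕ< {a} (subst (λ z → a < w z) (sym (FP.toℕ-fromℕ< p)) q)

raw-point : ∀ {K w} x (v : Valid K w x) → raw (point {K} {w} x v) ≡ x
raw-point (o , a) (p , q) = cong₂ _,_ (FP.toℕ-fromℕ< p) (FP.toℕ-fromℕ< _)

-- Keys are read in binary, lowest digit first. If two keys collided, one entry would be overwritten
-- and a later check would fail.
data Trie (A : Set) : Set where
  leaf : Trie A
  node : Maybe A → Trie A → Trie A → Trie A

module _ {A : Set} where
  insert : ℕ → ℕ → A → Trie A → Trie A
  insert zero    k a leaf         = node (just a) leaf leaf
  insert zero    k a (node b l r) = node (just a) l r
  insert (suc n) k a leaf         = if k % 2 ≡ᵇ 0 then node nothing (insert n (k / 2) a leaf) leaf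
                                                  else node nothing leaf (insert n (k / 2) a leaf)
  insert (suc n) k a (node b l r) = if k % 2 ≡ᵇ 0 then node b (insert n (k / 2) a l) r
                                                  else node b l (insert n (k / 2) a r)

  search : ℕ → ℕ → Trie A → Maybe A
  search n       k leaf         = nothing
  search zero    k (node b l r) = b
  search (suc n) k (node b l r) = if k % 2 ≡ᵇ 0 then search n (k / 2) l else search n (k / 2) r

record Row : Set where
  constructor row
  field
    p₀ p₁ p₂ p₃ p₄ mate gap mine theirs : ℕ

record Base : Set where
  constructor base-block
  field
    entries : Vec (ℕ × ℕ) 5
    mate gap mine theirs : ℕ

foldF : {A : Set} → ∀ n → (Fin n → A → A) → A → A
foldF zero    h z = z
foldF (suc n) h z = h zero (foldF n (h ∘ suc) z)

clamp : ∀ n → ℕ → Fin (suc n)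
clamp n       zero    = zero
clamp zero    (suc k) = zero
clamp (suc n) (suc k) = suc (clamp n k)

-- Arithmetic modulo m

module Congruence (m-1 : ℕ) where

  m : ℕ
  m = suc m-1

  infix 4 _≈_
  _≈_ : ℕ → ℕ → Set
  a ≈ b = a % m ≡ b % m

  ≈-+ : ∀ {a b} c → a ≈ b → a + c ≈ b + c
  ≈-+ {a} {b} c e = trans (%-distribˡ-+ a c m) (trans (cong (λ z → (z + c % m) % m) e) (sym (%-distribˡ-+ b c m)))

  -- Adding c (m - 1) completes c to a multiple of m. The factor `m-1` takes the place of the sign
  -- -1 here and in `act-undo`.
  ≈-cancel : ∀ {a b} c → a + c ≈ b + c → a ≈ b
  ≈-cancel {a} {b} c e = trans (sym (shift a)) (trans (≈-+ {a + c} {b + c} (c * m-1) e) (shift b))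
    where
    shift : ∀ x → (x + c) + c * m-1 ≈ x
    shift x = trans (cong (_% m) (trans (ℕP.+-assoc x c _) (cong (x +_) (sym (ℕP.*-suc c m-1))))) ([m+kn]%n≡m%n x c m)

  %-≈ : ∀ a → a % m ≈ a
  %-≈ a = m%n%n≡m%n a m

  ≈-< : ∀ {a b} → a < m → b < m → a ≈ b → a ≡ b
  ≈-< p q e = trans (sym (m<n⇒m%n≡m p)) (trans e (m<n⇒m%n≡m q))

  diff : ℕ → ℕ → ℕ
  diff a b = (b + (m ∸ a)) % m

  diff-< : ∀ a b → diff a b < m
  diff-< a b = m%n<n (b + (m ∸ a)) m

  diff-+ : ∀ {a} b → a < m → diff a b + a ≈ b
  diff-+ {a} b a<m = trans (≈-+ {diff a b} {b + (m ∸ a)} a (%-≈ (b + (m ∸ a))))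
    (trans (cong (_% m) (trans (ℕP.+-assoc b (m ∸ a) a) (cong (b +_) (ℕP.m∸n+n≡m (ℕP.<⇒≤ a<m))))) ([m+n]%n≡m%n b m))

  diff-unique : ∀ {a b d} → a < m → d < m → d + a ≈ b → diff a b ≡ d
  diff-unique {a} {b} {d} a<m d<m e = ≈-< (diff-< a b) d<m (≈-cancel {diff a b} {d} a (trans (diff-+ b a<m) (sym e)))

  diff-shift : ∀ {a b} g → a < m → b < m → diff ((a + g) % m) ((b + g) % m) ≡ diff a b
  diff-shift {a} {b} g a<m b<m = diff-unique {b = (b + g) % m} (m%n<n (a + g) m) (diff-< a b)
    (trans (cong (_% m) (ℕP.+-comm (diff a b) _))
    (trans (≈-+ {(a + g) % m} {a + g} (diff a b) (%-≈ (a + g)))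
    (trans (cong (_% m) (trans (ℕP.+-comm (a + g) (diff a b)) (sym (ℕP.+-assoc (diff a b) a g))))
    (trans (≈-+ {diff a b + a} {b} g (diff-+ b a<m)) (sym (%-≈ (b + g)))))))

  residue : ℕ → Fin m
  residue x = fromℕ< (m%n<n x m)

  toℕ-residue : ∀ x → toℕ (residue x) ≡ x % m
  toℕ-residue x = FP.toℕ-fromℕ< (m%n<n x m)

  residue-≈ : ∀ x → toℕ (residue x) ≈ x
  residue-≈ x = trans (cong (_% m) (toℕ-residue x)) (%-≈ x)

  Fin-≈ : ∀ {x y : Fin m} → toℕ x ≈ toℕ y → x ≡ y
  Fin-≈ {x} {y} e = FP.toℕ-injective (≈-< (FP.toℕ<n x) (FP.toℕ<n y) e)

-- Base blocks over ℤ/m acting on c orbits of length m and f fixed points; a point is a pair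
-- (orbit , coordinate), and the fixed points are the orbits c, …, c + f - 1. A row lists the codes
-- orbit · m + coordinate (c · m + i for the i-th fixed point) of the points B₀, …, B₄ of a base block
-- B, and its partner B' under σ: B_p = B'_{q+1} + gap and B_{p+1} = B'_q + gap for p = mine, q = theirs.
module Development (m-1 c f : ℕ) (lab : ℕ × ℕ → ℕ) (π : ℕ → ℕ) where

  open Congruence m-1

  C : ℕ
  C = c + f

  md : ℕ → ℕ
  md o = if o <ᵇ c then m else 1

  act : ℕ → ℕ × ℕ → ℕ × ℕ
  act g (o , a) = o , (if o <ᵇ c then (a + g) % m else 0)

  decode : ℕ → ℕ × ℕ
  decode x = if x <ᵇ c * m then (x / m , x % m) else (c + (x ∸ c * m) , 0)

  decodeRow : Row → Base
  decodeRow (row a b c d e j g p q) = base-block (decode a ∷ decode b ∷ decode c ∷ decode d ∷ decode e ∷ []) j g p q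

  -- Separates the points that are moved by ℤ/m from the fixed ones, which are traditionally called
  -- infinite points.
  finite? : ℕ × ℕ → Bool
  finite? (o , _) = o <ᵇ c

  gapOf : ℕ × ℕ → ℕ × ℕ → ℕ
  gapOf (o , a) (o' , b) = if o <ᵇ c then (if o' <ᵇ c then diff a b else 0) else 0

  Key : Set
  Key = ℕ × ℕ × ℕ

  -- A complete invariant of ordered pairs of points under translation: `key-act` shows the
  -- invariance and `transport` the completeness. If a fixed point takes part, all pairs from the
  -- two orbits are translates of each other, and the difference is set to 0.
  key : ℕ × ℕ → ℕ × ℕ → Key
  key x y = proj₁ x , proj₁ y , gapOf x y

  _=K_ : Key → Key → Bool
  (a , b , d) =K (a' , b' , d') = (a ≡ᵇ a') ∧ ((b ≡ᵇ b') ∧ (d ≡ᵇ d'))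

  =K-sound : ∀ {x y} → T (x =K y) → x ≡ y
  =K-sound {a , b , d} {a' , b' , d'} t =
    let (p , q) = ∧-T {a ≡ᵇ a'} t ; (q , r) = ∧-T {b ≡ᵇ b'} q in
    cong₂ _,_ (ℕP.≡ᵇ⇒≡ a a' p) (cong₂ _,_ (ℕP.≡ᵇ⇒≡ b b' q) (ℕP.≡ᵇ⇒≡ d d' r))

  valid? : ℕ × ℕ → Bool
  valid? (o , a) = (o <ᵇ C) ∧ (a <ᵇ md o)

  valid?-sound : ∀ x → T (valid? x) → Valid C md x
  valid?-sound (o , a) t = let (p , q) = ∧-T {o <ᵇ C} t in ℕP.<ᵇ⇒< o C p , ℕP.<ᵇ⇒< a (md o) q

  On : ℕ × ℕ → Set
  On = Valid C md

  act-on : ∀ g {x} → On x → On (act g x)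
  act-on g {o , a} (p , q) with o <ᵇ c
  ... | true  = p , m%n<n (a + g) m
  ... | false = p , s≤s z≤n

  act-∘ : ∀ g h x → act g (act h x) ≡ act (h + g) x
  act-∘ g h (o , a) with o <ᵇ c
  ... | true  = cong (o ,_) (trans (≈-+ {(a + h) % m} {a + h} g (%-≈ (a + h))) (cong (_% m) (ℕP.+-assoc a h g)))
  ... | false = refl

  act-≈ : ∀ {g h} → g ≈ h → ∀ x → act g x ≡ act h x
  act-≈ {g} {h} e (o , a) with o <ᵇ c
  ... | true  = cong (o ,_) (trans (cong (_% m) (ℕP.+-comm a g)) (trans (≈-+ {g} {h} a e) (cong (_% m) (ℕP.+-comm h a))))
  ... | false = refl

  act-zero : ∀ {x} → On x → act 0 x ≡ x
  act-zero {o , a} (p , q) with o <ᵇ c in e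
  ... | true  = cong (o ,_) (trans (cong (_% m) (ℕP.+-identityʳ a)) (m<n⇒m%n≡m q))
  act-zero {o , zero} (p , q)        | false = refl
  act-zero {o , suc a} (p , s≤s ()) | false

  act-undo : ∀ g {x} → On x → act (g * m-1) (act g x) ≡ x
  act-undo g {x} on = trans (act-∘ (g * m-1) g x)
    (trans (act-≈ {g + g * m-1} {0} (trans (cong (_% m) (sym (ℕP.*-suc g m-1))) ([m+kn]%n≡m%n 0 g m)) x) (act-zero on))

  act-injective : ∀ g {x y} → On x → On y → act g x ≡ act g y → x ≡ y
  act-injective g p q e = trans (sym (act-undo g p)) (trans (cong (act (g * m-1)) e) (act-undo g q))

  free : ∀ {g h x} → T (finite? x) → act g x ≡ act h x → g ≈ h
  free {g} {h} {o , a} t e with o <ᵇ c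
  ... | true = ≈-cancel {g} {h} a (trans (cong (_% m) (ℕP.+-comm g a)) (trans (cong proj₂ e) (cong (_% m) (ℕP.+-comm a h))))

  key-act : ∀ g {x y} → On x → On y → key (act g x) (act g y) ≡ key x y
  key-act g {o , a} {o' , b} (_ , p) (_ , q) with o <ᵇ c | o' <ᵇ c
  ... | true  | true  = cong (λ z → o , o' , z) (diff-shift g p q)
  ... | true  | false = refl
  ... | false | _     = refl

  transport : ∀ {x y x' y'} → On x → On y → On x' → On y' → key x y ≡ key x' y' →
              Σ[ g ∈ ℕ ] (act g x ≡ x') × (act g y ≡ y')
  transport {o , a} {p , b} {o' , a'} {p' , b'} (_ , u) (_ , v) (_ , u') (_ , v') e with cong proj₁ e | cong (proj₁ ∘ proj₂) e | cong (proj₂ ∘ proj₂) e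
  ... | refl | refl | e' with o <ᵇ c | p <ᵇ c
  ...   | true | true = diff a a' , cong (o ,_) to-a' , cong (p ,_) to-b'
    where
    to-a' : (a + diff a a') % m ≡ a'
    to-a' = trans (cong (_% m) (ℕP.+-comm a _)) (trans (diff-+ a' u) (m<n⇒m%n≡m u'))
    to-b' : (b + diff a a') % m ≡ b'
    to-b' = trans (sym (≈-+ {diff a b + a} {b} (diff a a') (diff-+ b u)))
      (trans (cong (_% m) (ℕP.+-assoc (diff a b) a _))
      (trans (cong (_% m) (ℕP.+-comm (diff a b) _))
      (trans (sym (≈-+ {(a + diff a a') % m} {a + diff a a'} (diff a b) (%-≈ (a + diff a a'))))
      (trans (cong₂ (λ z w → (z + w) % m) to-a' e')
      (trans (cong (_% m) (ℕP.+-comm a' _)) (trans (diff-+ b' u') (m<n⇒m%n≡m v')))))))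
  ...   | true | false = diff a a' ,
            cong (o ,_) (trans (cong (_% m) (ℕP.+-comm a _)) (trans (diff-+ a' u) (m<n⇒m%n≡m u'))) ,
            cong (p ,_) (sym (ℕP.n<1⇒n≡0 v'))
  ...   | false | true = diff b b' , cong (o ,_) (sym (ℕP.n<1⇒n≡0 u')) ,
            cong (p ,_) (trans (cong (_% m) (ℕP.+-comm b _)) (trans (diff-+ b' v) (m<n⇒m%n≡m v')))
  ...   | false | false = 0 , cong (o ,_) (sym (ℕP.n<1⇒n≡0 u')) , cong (p ,_) (sym (ℕP.n<1⇒n≡0 v'))

  module Table {b-1 : ℕ} (rows : Vec Base (suc b-1)) where
    b : ℕ
    b = suc b-1

    Entry : Set
    Entry = Fin b × Fin 5 × Fin 5

    entry : Vec (ℕ × ℕ) 5 → Fin 5 → ℕ × ℕ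
    entry = V.lookup

    base : Fin b → Fin 5 → ℕ × ℕ
    base k = entry (Base.entries (V.lookup rows k))

    encode : Key → ℕ
    encode (o , o' , d) = (o * C + o') * m + d

    pairs : List (Fin 5 × Fin 5)
    pairs = (# 0 , # 1) ∷ (# 0 , # 2) ∷ (# 0 , # 3) ∷ (# 0 , # 4) ∷ (# 1 , # 2) ∷
            (# 1 , # 3) ∷ (# 1 , # 4) ∷ (# 2 , # 3) ∷ (# 2 , # 4) ∷ (# 3 , # 4) ∷ []

    table : Trie Entry
    table = foldF b (λ k → enter k (Base.entries (V.lookup rows k))) leaf
      where
      enter : Fin b → Vec (ℕ × ℕ) 5 → Trie Entry → Trie Entry
      enter k e t = foldr (λ { (i , j) → insert 20 (encode (key (entry e i) (entry e j))) (k , i , j) }) t pairs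

    mates : Trie (Fin b)
    mates = foldF b (λ k → insert 20 (Base.mate (V.lookup rows k)) k) leaf

    _≟E_ : Maybe Entry → Entry → Bool
    nothing ≟E _ = false
    just (k , i , j) ≟E (k' , i' , j') = (k =F k') ∧ ((i =F i') ∧ (j =F j'))

    ≟E-sound : ∀ {x y} → T (x ≟E y) → x ≡ just y
    ≟E-sound {just (k , i , j)} {k' , i' , j'} t =
      let (p , q) = ∧-T {k =F k'} t ; (q , r) = ∧-T {i =F i'} q in
      cong just (cong₂ _,_ (=F-sound p) (cong₂ _,_ (=F-sound q) (=F-sound r)))

    mateOf : Fin b → Fin b
    mateOf k = clamp b-1 (Base.mate (V.lookup rows k))

    -- The lookup tables are arbitrary here: every property that is needed of them is checked.
    module Check (tab : Trie Entry) (inv : Trie (Fin b)) where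

      find : Key → Maybe Entry
      find κ = search 20 (encode κ) tab

      entriesValid : Vec (ℕ × ℕ) 5 → Bool
      entriesValid e = allF 5 λ i → valid? (entry e i)

      -- Two fixed points in one base block would lie together in all m of its translates, so of any
      -- two entries one has to be moved.
      separated : Vec (ℕ × ℕ) 5 → Bool
      separated e = allF 5 λ i → allF 5 λ j → (i =F j) ∨
        (not (lab (entry e i) ≡ᵇ lab (entry e j)) ∧ (finite? (entry e i) ∨ finite? (entry e j)))

      -- Since a key leads to one table entry only, this makes the keys of all ordered pairs in all
      -- base blocks distinct, which is the uniqueness half of a difference family.
      located : Fin b → Vec (ℕ × ℕ) 5 → Bool
      located k e = allF 5 λ i → allF 5 λ j → not (toℕ i <ᵇ toℕ j) ∨
        (find (key (entry e i) (entry e j)) ≟E (k , i , j))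

      -- One moved point determines the shift; if the first point is fixed, `separated` guarantees
      -- that the second one is moved.
      translation : ℕ × ℕ → ℕ × ℕ → ℕ × ℕ → ℕ × ℕ → ℕ
      translation (o , a) (_ , a') (_ , b) (_ , b') = if o <ᵇ c then diff a a' else diff b b'

      apart : Vec (ℕ × ℕ) 5 → Fin 5 → Fin 5 → Vec (ℕ × ℕ) 5 → ℕ → Bool
      apart e i j e' γ = allF 5 λ r → ((r =F i) ∨ (r =F j)) ∨ (allF 5 λ s → not (act γ (entry e' s) == entry e r))

      meetsTwice : Vec (ℕ × ℕ) 5 → Fin 5 → Fin 5 → Vec (ℕ × ℕ) 5 → Fin 5 → Fin 5 → ℕ → Bool
      meetsTwice e i j e' p q γ = (act γ (entry e' p) == entry e j) ∧ ((act γ (entry e' q) == entry e i) ∧ apart e i j e' γ)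

      reversal : Vec (ℕ × ℕ) 5 → Fin 5 → Fin 5 → Maybe Entry → Bool
      reversal e i j nothing = false
      reversal e i j (just (l , p , q)) = go (Base.entries (V.lookup rows l))
        where
        go : Vec (ℕ × ℕ) 5 → Bool
        go e' = meetsTwice e i j e' p q (translation (entry e' p) (entry e j) (entry e' q) (entry e i))

      -- The test for super-simplicity. Blocks that share two points in the same order coincide, so
      -- a second block with three common points contains the first two of them reversed. The block
      -- with that reversed pair is unique; it is looked up and must share no further point.
      reversals : Vec (ℕ × ℕ) 5 → Bool
      reversals e = allF 5 λ i → allF 5 λ j → not (toℕ i <ᵇ toℕ j) ∨ reversal e i j (find (key (entry e j) (entry e i)))

      _≟M_ : Maybe (Fin b) → Fin b → Bool
      nothing ≟M _ = false
      just k ≟M l = k =F l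

      -- The lookup in `inv` recovers k from its partner, which proves that the partner map is
      -- injective on the base blocks.
      trades : Fin b → Base → Bool
      trades k r = (search 20 (toℕ (clamp b-1 (Base.mate r))) inv ≟M k) ∧ go (Base.entries r) (Base.entries (V.lookup rows (clamp b-1 (Base.mate r))))
        where
        go : Vec (ℕ × ℕ) 5 → Vec (ℕ × ℕ) 5 → Bool
        go e e' = (entry e (inject₁ (clamp 3 (Base.mine r))) == act (Base.gap r) (entry e' (suc (clamp 3 (Base.theirs r))))) ∧
                  (entry e (suc (clamp 3 (Base.mine r))) == act (Base.gap r) (entry e' (inject₁ (clamp 3 (Base.theirs r)))))

      rowOK : Fin b → Base → Bool
      rowOK k r = entriesValid (Base.entries r) ∧ (separated (Base.entries r) ∧
        (located k (Base.entries r) ∧ (reversals (Base.entries r) ∧ trades k r)))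

      covers : Key → Maybe Entry → Bool
      covers κ nothing = false
      covers κ (just (k , i , j)) = (toℕ i <ᵇ toℕ j) ∧ (key (base k i) (base k j) =K κ)

      gaps : ℕ → ℕ → ℕ
      gaps o o' = if o <ᵇ c then md o' else 1

      -- The existence half of a difference family. Each orbit of pairs is tested at one
      -- representative, with first coordinate 0.
      covered : Bool
      covered = allN C λ o → allN C λ o' → allN (gaps o o') λ d →
        (lab (o , 0) ≡ᵇ lab (o' , d)) ∨ covers (o , o' , d) (find (o , o' , d))

      -- Translation maps label classes to label classes. One step of the cyclic group suffices, and
      -- since translations can be undone, pairs with different labels keep different labels.
      labels : Bool
      labels = allN C λ o → allN (md o) λ a → lab (act 1 (o , a)) ≡ᵇ π (lab (o , a))

      check : Bool
      check = (allF b λ k → rowOK k (V.lookup rows k)) ∧ (covered ∧ labels)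

      module Sound (ok : check ≡ true) where

        R : Pts C md → Pts C md → Set
        R x y = lab (raw x) ≢ lab (raw y)

        okT : T check
        okT = subst T (sym ok) tt

        coveredT : T covered
        coveredT = proj₁ (∧-T {covered} (proj₂ (∧-T {allF b λ k → rowOK k (V.lookup rows k)} okT)))

        labelsT : T labels
        labelsT = proj₂ (∧-T {covered} (proj₂ (∧-T {allF b λ k → rowOK k (V.lookup rows k)} okT)))

        ent : Fin b → Vec (ℕ × ℕ) 5
        ent k = Base.entries (V.lookup rows k)

        rowT : ∀ k → T (rowOK k (V.lookup rows k))
        rowT = allF-sound b (proj₁ (∧-T okT))

        validT : ∀ k → T (entriesValid (ent k))
        validT k = proj₁ (∧-T (rowT k))
        separatedT : ∀ k → T (separated (ent k))
        separatedT k = proj₁ (∧-T (proj₂ (∧-T {entriesValid (ent k)} (rowT k))))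
        rest₃ : ∀ k → T (located k (ent k) ∧ (reversals (ent k) ∧ trades k (V.lookup rows k)))
        rest₃ k = proj₂ (∧-T {separated (ent k)} (proj₂ (∧-T {entriesValid (ent k)} (rowT k))))
        locatedT : ∀ k → T (located k (ent k))
        locatedT k = proj₁ (∧-T (rest₃ k))
        reversalsT : ∀ k → T (reversals (ent k))
        reversalsT k = proj₁ (∧-T (proj₂ (∧-T {located k (ent k)} (rest₃ k))))
        tradesT : ∀ k → T (trades k (V.lookup rows k))
        tradesT k = proj₂ (∧-T {reversals (ent k)} (proj₂ (∧-T {located k (ent k)} (rest₃ k))))

        base-on : ∀ k i → On (base k i)
        base-on k i = valid?-sound (base k i) (allF-sound 5 {λ i → valid? (base k i)} (validT k) i)

        apart? : Fin b → Fin 5 → Fin 5 → Bool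
        apart? k i j = not (lab (base k i) ≡ᵇ lab (base k j)) ∧ (finite? (base k i) ∨ finite? (base k j))

        sep : ∀ k {i j} → i ≢ j → T (apart? k i j)
        sep k {i} {j} ne with ∨-T {i =F j} (allF-sound 5 {λ j → (i =F j) ∨ apart? k i j}
                                (allF-sound 5 {λ i → allF 5 λ j → (i =F j) ∨ apart? k i j} (separatedT k) i) j)
        ... | inj₁ t = contradiction (=F-sound t) ne
        ... | inj₂ t = t

        lab-base : ∀ k {i j} → i ≢ j → lab (base k i) ≢ lab (base k j)
        lab-base k {i} {j} ne e = not-T (proj₁ (∧-T (sep k {i} {j} ne))) (ℕP.≡⇒≡ᵇ _ _ e)

        one-finite : ∀ k {i j} → i ≢ j → T (finite? (base k i)) ⊎ T (finite? (base k j))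
        one-finite k {i} {j} ne = ∨-T (proj₂ (∧-T {not (lab (base k i) ≡ᵇ lab (base k j))} (sep k {i} {j} ne)))

        guard : ∀ {i j : Fin 5} {x} → i F.< j → T (not (toℕ i <ᵇ toℕ j) ∨ x) → T x
        guard {i} {j} lt t with ∨-T {not (toℕ i <ᵇ toℕ j)} t
        ... | inj₁ u = contradiction (ℕP.<⇒<ᵇ lt) (not-T u)
        ... | inj₂ u = u

        find-base : ∀ k {i j} → i F.< j → find (key (base k i) (base k j)) ≡ just (k , i , j)
        find-base k {i} {j} lt = ≟E-sound (guard {i} {j} lt (allF-sound 5 {λ j → not (toℕ i <ᵇ toℕ j) ∨ (find (key (base k i) (base k j)) ≟E (k , i , j))}
          (allF-sound 5 {λ i → allF 5 λ j → not (toℕ i <ᵇ toℕ j) ∨ (find (key (base k i) (base k j)) ≟E (k , i , j))} (locatedT k) i) j))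

        lab-act₁ : ∀ {x} → On x → lab (act 1 x) ≡ π (lab x)
        lab-act₁ {o , a} (p , q) = ℕP.≡ᵇ⇒≡ _ _ (allN-sound (md o) (allN-sound C labelsT p) q)

        lab-act : ∀ g {x y} → On x → On y → lab x ≡ lab y → lab (act g x) ≡ lab (act g y)
        lab-act zero    p q e = trans (cong lab (act-zero p)) (trans e (cong lab (sym (act-zero q))))
        lab-act (suc g) {x} {y} p q e =
          trans (cong lab (sym (act-∘ g 1 x))) (trans (lab-act g (act-on 1 p) (act-on 1 q)
            (trans (lab-act₁ p) (trans (cong π e) (sym (lab-act₁ q))))) (cong lab (act-∘ g 1 y)))

        lab-act⁻ : ∀ g {x y} → On x → On y → lab (act g x) ≡ lab (act g y) → lab x ≡ lab y
        lab-act⁻ g p q e = trans (cong lab (sym (act-undo g p)))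
          (trans (lab-act (g * m-1) (act-on g p) (act-on g q) e) (cong lab (act-undo g q)))

        on : (x : Pts C md) → On (raw x)
        on = valid

        Blk : Set
        Blk = Fin b × Fin m

        image : Blk → Fin 5 → ℕ × ℕ
        image (k , g) i = act (toℕ g) (base k i)

        pt : Blk → Fin 5 → Pts C md
        pt (k , g) i = point (image (k , g) i) (act-on (toℕ g) (base-on k i))

        raw-pt : ∀ k i → raw (pt k i) ≡ image k i
        raw-pt (k , g) i = raw-point {w = md} (image (k , g) i) (act-on (toℕ g) (base-on k i))

        image≡ : ∀ {k l i j} → pt k i ≡ pt l j → image k i ≡ image l j
        image≡ {k} {l} {i} {j} e = trans (sym (raw-pt k i)) (trans (cong raw e) (raw-pt l j))

        key-image : ∀ k i j → key (image k i) (image k j) ≡ key (base (proj₁ k) i) (base (proj₁ k) j)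
        key-image (k , g) i j = key-act (toℕ g) (base-on k i) (base-on k j)

        just-injective : ∀ {x y : Entry} → just x ≡ just y → x ≡ y
        just-injective refl = refl

        same-entry : ∀ {k l : Blk} {i j i' j'} → i F.< j → i' F.< j' →
          image k i ≡ image l i' → image k j ≡ image l j' → (proj₁ k , i , j) ≡ (proj₁ l , i' , j')
        same-entry {k} {l} {i} {j} {i'} {j'} lt lt' u w = just-injective
          (trans (sym (find-base (proj₁ k) lt)) (trans (cong find
            (trans (sym (key-image k i j)) (trans (cong₂ key u w) (key-image l i' j')))) (find-base (proj₁ l) lt')))

        unique' : ∀ {k l : Blk} {i j i' j'} → i F.< j → i' F.< j' →
          image k i ≡ image l i' → image k j ≡ image l j' → k ≡ l
        unique' {k , g} {l , h} {i} {j} lt lt' u w with same-entry {k , g} {l , h} lt lt' u w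
        ... | refl with one-finite k (FP.<⇒≢ lt)
        ...   | inj₁ t = cong (k ,_) (Fin-≈ (free {toℕ g} {toℕ h} {base k i} t u))
        ...   | inj₂ t = cong (k ,_) (Fin-≈ (free {toℕ g} {toℕ h} {base k j} t w))

        cover' : ∀ {x y} → R x y → Σ[ k ∈ Blk ] Σ[ i ∈ Fin 5 ] Σ[ j ∈ Fin 5 ] (i F.< j) × (pt k i ≡ x) × (pt k j ≡ y)
        cover' {x} {y} r = found (∨-T (allN-sound (gaps o o') (allN-sound C (allN-sound C coveredT (proj₁ (on x))) (proj₁ (on y))) d<))
          where
          o o' d : ℕ
          o = proj₁ (raw x)
          o' = proj₁ (raw y)
          d = gapOf (raw x) (raw y)
          x-on : On (raw x)
          x-on = on x
          y-on : On (raw y)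
          y-on = on y
          -- These facts show that (o , 0) and (o' , d) are points, have the same key as x and y,
          -- and fall within the range that `covered` runs through. If one of the orbits is a fixed
          -- point, d is 0.
          gap-< : ∀ p q a e → a < md p → e < md q → gapOf (p , a) (q , e) < gaps p q × gapOf (p , a) (q , e) < md q × (0 < md p) × (gapOf (p , 0) (q , gapOf (p , a) (q , e)) ≡ gapOf (p , a) (q , e))
          gap-< p q a e u v with p <ᵇ c | q <ᵇ c
          ... | true  | true  = diff-< a e , diff-< a e , s≤s z≤n ,
                diff-unique {b = diff a e} (s≤s z≤n) (diff-< a e) (cong (_% m) (ℕP.+-identityʳ (diff a e)))
          ... | true  | false = s≤s z≤n , s≤s z≤n , s≤s z≤n , refl
          ... | false | true  = s≤s z≤n , s≤s z≤n , s≤s z≤n , refl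
          ... | false | false = s≤s z≤n , s≤s z≤n , s≤s z≤n , refl
          facts = gap-< o o' (proj₂ (raw x)) (proj₂ (raw y)) (proj₂ x-on) (proj₂ y-on)
          d< : d < gaps o o'
          d< = proj₁ facts
          x₀-on : On (o , 0)
          x₀-on = proj₁ x-on , proj₁ (proj₂ (proj₂ facts))
          y₀-on : On (o' , d)
          y₀-on = proj₁ y-on , proj₁ (proj₂ facts)
          canonical : key (o , 0) (o' , d) ≡ key (raw x) (raw y)
          canonical = cong (λ z → o , o' , z) (proj₂ (proj₂ (proj₂ facts)))
          found : T (lab (o , 0) ≡ᵇ lab (o' , d)) ⊎ T (covers (o , o' , d) (find (o , o' , d))) → _
          found (inj₁ t) = let (g , u , w) = transport x₀-on y₀-on x-on y-on canonical in
            contradiction (trans (cong lab (sym u)) (trans (lab-act g x₀-on y₀-on (ℕP.≡ᵇ⇒≡ _ _ t)) (cong lab w))) r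
          found (inj₂ t) with find (o , o' , d)
          ... | just (k , i , j) =
            let (lt , eq) = ∧-T {toℕ i <ᵇ toℕ j} t
                (g , u , w) = transport (base-on k i) (base-on k j) x-on y-on (=K-sound eq)
                at : ∀ z → act (toℕ (residue g)) (base k z) ≡ act g (base k z)
                at z = act-≈ {toℕ (residue g)} {g} (residue-≈ g) (base k z)
            in (k , residue g) , i , j , ℕP.<ᵇ⇒< _ _ lt ,
               raw-injective (trans (raw-pt (k , residue g) i) (trans (at i) u)) ,
               raw-injective (trans (raw-pt (k , residue g) j) (trans (at j) w))

        clash : ∀ k {i j} l {p q} γ → i ≢ j → T (meetsTwice (ent k) i j (ent l) p q γ) →
          (act γ (base l p) ≡ base k j) × (act γ (base l q) ≡ base k i) ×
          (∀ r s → r ≢ i → r ≢ j → act γ (base l s) ≢ base k r)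
        clash k {i} {j} l {p} {q} γ ne t =
          let (u , t') = ∧-T {act γ (base l p) == base k j} t
              (w , t'') = ∧-T {act γ (base l q) == base k i} t'
          in ==-sound u , ==-sound w , λ r s ri rj e → away r s ri rj e (allF-sound 5 {λ r → ((r =F i) ∨ (r =F j)) ∨ (allF 5 λ s → not (act γ (base l s) == base k r))} t'' r)
          where
          away : ∀ r s → r ≢ i → r ≢ j → act γ (base l s) ≡ base k r →
                 T (((r =F i) ∨ (r =F j)) ∨ (allF 5 λ s → not (act γ (base l s) == base k r))) → ⊥
          away r s ri rj e t with ∨-T {(r =F i) ∨ (r =F j)} t
          ... | inj₂ t' = not-T (allF-sound 5 {λ s → not (act γ (base l s) == base k r)} t' s) (==-complete e)
          ... | inj₁ t' with ∨-T {r =F i} t'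
          ...   | inj₁ z = ri (=F-sound z)
          ...   | inj₂ z = rj (=F-sound z)

        -- The reversed pair leads to the entry of `l` in the table, so `reversals` has compared the
        -- base block of k with the translate by γ of the base block of l. That translate is the
        -- actual relative position of the two blocks, so the check excludes the third point.
        no-third : ∀ {k l : Blk} {i₁ i₂ i₃ j₁ j₂ j₃} → i₁ F.< i₂ → i₂ F.< i₃ → j₂ F.< j₁ →
          image k i₁ ≡ image l j₁ → image k i₂ ≡ image l j₂ → image k i₃ ≡ image l j₃ → ⊥
        no-third {k , g} {l , h} {i₁} {i₂} {i₃} {j₁} {j₂} {j₃} lt lt' gt e₁ e₂ e₃ =
          excluded i₃ j₃ (λ q → FP.<⇒≢ (FP.<-trans lt lt') (sym q)) (λ q → FP.<⇒≢ lt' (sym q))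
            (act-injective (toℕ g) (act-on γ (base-on l j₃)) (base-on k i₃)
              (trans (act-∘ (toℕ g) γ (base l j₃)) (trans (act-≈ {γ + toℕ g} {toℕ h} γ+g≈h (base l j₃)) (sym e₃))))
          where
          at-reverse : find (key (base k i₂) (base k i₁)) ≡ just (l , j₂ , j₁)
          at-reverse = trans (cong find (trans (sym (key-image (k , g) i₂ i₁)) (trans (cong₂ key e₂ e₁) (key-image (l , h) j₂ j₁))))
            (find-base l gt)
          γ : ℕ
          γ = translation (base l j₂) (base k i₂) (base l j₁) (base k i₁)
          rev : T (reversal (ent k) i₁ i₂ (just (l , j₂ , j₁)))
          rev = subst (λ z → T (reversal (ent k) i₁ i₂ z)) at-reverse
            (guard {i₁} {i₂} lt (allF-sound 5 {λ j → not (toℕ i₁ <ᵇ toℕ j) ∨ reversal (ent k) i₁ j (find (key (base k j) (base k i₁)))}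
              (allF-sound 5 {λ i → allF 5 λ j → not (toℕ i <ᵇ toℕ j) ∨ reversal (ent k) i j (find (key (base k j) (base k i)))}
                (reversalsT k) i₁) i₂))
          C' = clash k {i₁} {i₂} l {j₂} {j₁} γ (FP.<⇒≢ lt) rev
          excluded = proj₂ (proj₂ C')
          -- Of the two common points one is moved, and a moved point determines the translation.
          γ+g≈h : γ + toℕ g ≈ toℕ h
          γ+g≈h with one-finite l (FP.<⇒≢ gt)
          ... | inj₁ t = free {γ + toℕ g} {toℕ h} {base l j₂} t (trans (sym (act-∘ (toℕ g) γ (base l j₂))) (trans (cong (act (toℕ g)) (proj₁ C')) e₂))
          ... | inj₂ t = free {γ + toℕ g} {toℕ h} {base l j₁} t (trans (sym (act-∘ (toℕ g) γ (base l j₁))) (trans (cong (act (toℕ g)) (proj₁ (proj₂ C'))) e₁))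

        simple' : ∀ {k l : Blk} {i₁ i₂ i₃ j₁ j₂ j₃} → i₁ F.< i₂ → i₂ F.< i₃ → j₁ ≢ j₂ →
          image k i₁ ≡ image l j₁ → image k i₂ ≡ image l j₂ → image k i₃ ≡ image l j₃ → k ≡ l
        simple' {k} {l} {j₁ = j₁} {j₂} lt lt' ne e₁ e₂ e₃ with FP.<-cmp j₁ j₂
        ... | tri< a _ _ = unique' {k} {l} lt a e₁ e₂
        ... | tri≈ _ q _ = contradiction q ne
        ... | tri> _ _ z = ⊥-elim (no-third {k} {l} lt lt' z e₁ e₂ e₃)

        gap : Fin b → ℕ
        gap k = Base.gap (V.lookup rows k)

        σ : Blk → Blk
        σ (k , g) = mateOf k , residue (gap k + toℕ g)

        mate-found : ∀ k → search 20 (toℕ (mateOf k)) inv ≡ just k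
        mate-found k = go (proj₁ (∧-T {search 20 (toℕ (mateOf k)) inv ≟M k} (tradesT k)))
          where
          go : ∀ {x} → T (x ≟M k) → x ≡ just k
          go {just l} t = cong just (=F-sound t)

        σ-inj : ∀ {k l} → σ k ≡ σ l → k ≡ l
        σ-inj {k , g} {l , h} e with trans (sym (mate-found k)) (trans (cong (λ z → search 20 (toℕ (proj₁ z)) inv) e) (mate-found l))
        ... | refl = cong (k ,_) (Fin-≈ (≈-cancel {toℕ g} {toℕ h} (gap k)
              (trans (cong (_% m) (ℕP.+-comm (toℕ g) (gap k))) (trans (sym (residue-≈ (gap k + toℕ g)))
              (trans (cong (λ z → toℕ (proj₂ z) % m) e) (trans (residue-≈ (gap k + toℕ h)) (cong (_% m) (ℕP.+-comm (gap k) (toℕ h)))))))))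

        trade : ∀ k → Σ[ p ∈ Fin 4 ] Σ[ q ∈ Fin 4 ]
                (pt k (inject₁ p) ≡ pt (σ k) (suc q)) × (pt k (suc p) ≡ pt (σ k) (inject₁ q))
        trade (k , g) = p , q , lift (proj₁ both) , lift (proj₂ both)
          where
          p q : Fin 4
          p = clamp 3 (Base.mine (V.lookup rows k))
          q = clamp 3 (Base.theirs (V.lookup rows k))
          both : (base k (inject₁ p) ≡ act (gap k) (base (mateOf k) (suc q))) × (base k (suc p) ≡ act (gap k) (base (mateOf k) (inject₁ q)))
          both = let t = proj₂ (∧-T {search 20 (toℕ (mateOf k)) inv ≟M k} (tradesT k))
                     (u , w) = ∧-T {base k (inject₁ p) == act (gap k) (base (mateOf k) (suc q))} t
                 in ==-sound u , ==-sound w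
          lift : ∀ {i j} → base k i ≡ act (gap k) (base (mateOf k) j) → pt (k , g) i ≡ pt (σ (k , g)) j
          lift {i} {j} e = raw-injective (trans (raw-pt (k , g) i) (trans (cong (act (toℕ g)) e)
            (trans (act-∘ (toℕ g) (gap k) (base (mateOf k) j))
            (trans (act-≈ {gap k + toℕ g} {toℕ (residue (gap k + toℕ g))} (sym (residue-≈ (gap k + toℕ g))) (base (mateOf k) j))
              (sym (raw-pt (σ (k , g)) j))))))

        design : Design (Pts C md) R
        design = record
          { Blk    = Blk
          ; finite = b * m , ↔-sym FP.*↔×
          ; pt     = pt
          ; sound  = λ { (k , g) {i} {j} ne e → lab-base k ne (lab-act⁻ (toℕ g) (base-on k i) (base-on k j)
                       (trans (cong lab (sym (raw-pt (k , g) i))) (trans e (cong lab (raw-pt (k , g) j))))) }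
          ; cover  = cover'
          ; unique = λ {k} {l} lt lt' u w → unique' {k} {l} lt lt' (image≡ {k} {l} u) (image≡ {k} {l} w)
          ; simple = λ {k} {l} lt lt' n _ _ u v w → simple' {k} {l} lt lt' n (image≡ {k} {l} u) (image≡ {k} {l} v) (image≡ {k} {l} w)
          ; σ      = σ
          ; σ-inj  = σ-inj
          ; trade  = trade
          }

-- Filling holes and Wilson's construction

Labelled : (K : ℕ) (w : ℕ → ℕ) → (ℕ × ℕ → ℕ) → Set₁
Labelled K w lab = Design (Pts K w) (λ x y → lab (raw x) ≢ lab (raw y))

module _ {K K' : ℕ} {w w' : ℕ → ℕ} (to from : ℕ × ℕ → ℕ × ℕ) where

  inPts : ℕ → (ℕ → ℕ) → ℕ × ℕ → Bool
  inPts K w (o , a) = (o <ᵇ K) ∧ (a <ᵇ w o)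

  inPts-sound : ∀ K w x → T (inPts K w x) → Valid K w x
  inPts-sound K w (o , a) t = let (p , q) = ∧-T {o <ᵇ K} t in ℕP.<ᵇ⇒< o K p , ℕP.<ᵇ⇒< a (w o) q

  bijective? : Bool
  bijective? = (allN K λ o → allN (w o) λ a → inPts K' w' (to (o , a)) ∧ (from (to (o , a)) == (o , a))) ∧
               (allN K' λ o → allN (w' o) λ a → inPts K w (from (o , a)) ∧ (to (from (o , a)) == (o , a)))

  bijection : bijective? ≡ true → Σ[ e ∈ Pts K w ↔ Pts K' w' ] (∀ x → raw (Inverse.to e x) ≡ to (raw x))
  bijection ok = mk↔ₛ′ f g fg gf , raw-f
    where
    okT = ∧-T (subst T (sym ok) tt)
    F : ∀ x → Valid K w x → Valid K' w' (to x) × (from (to x) ≡ x)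
    F (o , a) (p , q) = let (u , v) = ∧-T {inPts K' w' (to (o , a))} (allN-sound (w o) (allN-sound K (proj₁ okT) p) q)
      in inPts-sound K' w' _ u , ==-sound v
    G : ∀ x → Valid K' w' x → Valid K w (from x) × (to (from x) ≡ x)
    G (o , a) (p , q) = let (u , v) = ∧-T {inPts K w (from (o , a))} (allN-sound (w' o) (allN-sound K' (proj₂ okT) p) q)
      in inPts-sound K w _ u , ==-sound v
    f : Pts K w → Pts K' w'
    f x = point (to (raw x)) (proj₁ (F (raw x) (valid x)))
    g : Pts K' w' → Pts K w
    g y = point (from (raw y)) (proj₁ (G (raw y) (valid y)))
    raw-f : ∀ x → raw (f x) ≡ to (raw x)
    raw-f x = raw-point {w = w'} _ (proj₁ (F (raw x) (valid x)))
    raw-g : ∀ y → raw (g y) ≡ from (raw y)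
    raw-g y = raw-point {w = w} _ (proj₁ (G (raw y) (valid y)))
    fg : ∀ y → f (g y) ≡ y
    fg y = raw-injective (trans (raw-f (g y)) (trans (cong to (raw-g y)) (proj₂ (G (raw y) (valid y)))))
    gf : ∀ x → g (f x) ≡ x
    gf x = raw-injective (trans (raw-g (f x)) (trans (cong from (raw-f x)) (proj₂ (F (raw x) (valid x)))))

  transfer : (lab : ℕ × ℕ → ℕ) → bijective? ≡ true → Labelled K w (lab ∘ to) → Labelled K' w' lab
  transfer lab ok = relabel e
    (λ {x} {y} ne q → ne (trans (cong lab (sym (raw-e x))) (trans q (cong lab (raw-e y)))))
    (λ {x} {y} ne q → ne (trans (cong lab (back x)) (trans q (cong lab (sym (back y))))))
    where
    e = proj₁ (bijection ok)
    raw-e = proj₂ (bijection ok)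
    back : ∀ y → raw y ≡ to (raw (Inverse.from e y))
    back y = trans (cong raw (sym (Inverse.strictlyInverseˡ e y))) (raw-e (Inverse.from e y))

≢-on : {A B : Set} → A ↔ B → Design A _≢_ → Design B _≢_
≢-on e = relabel e (λ ne q → ne (trans (sym (Inverse.strictlyInverseʳ e _)) (trans (cong (Inverse.from e) q) (Inverse.strictlyInverseʳ e _))))
                   (λ ne q → ne (trans (sym (Inverse.strictlyInverseˡ e _)) (trans (cong (Inverse.to e) q) (Inverse.strictlyInverseˡ e _))))

Pts↔Σ : ∀ {K w} → Pts K w ↔ (Σ (Fin K) λ i → Fin (w (toℕ i)))
Pts↔Σ = mk↔ₛ′ (λ { (i ▸ a) → i , a }) (λ { (i , a) → i ▸ a }) (λ _ → refl) (λ _ → refl)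

Holed : (A : Set) (e : ℕ) → A ⊎ Fin e → A ⊎ Fin e → Set
Holed A e x y = (x ≢ y) × ¬ ((∃ λ a → x ≡ inj₂ a) × (∃ λ b → y ≡ inj₂ b))

GDD : (K : ℕ) → (Fin K → Set) → Set₁
GDD K G = Design (Σ (Fin K) G) (λ x y → proj₁ x ≢ proj₁ y)

module _ {K : ℕ} {G : Fin K → Set} {e : ℕ} (last : Fin K) where

  data Piece : Set where
    blocks : Piece
    group  : Fin K → Piece

  Piece-finite : Finite Piece
  Piece-finite = suc K , mk↔ₛ′ (λ { blocks → zero ; (group i) → suc i }) (λ { zero → blocks ; (suc i) → group i })
    (λ { zero → refl ; (suc i) → refl }) (λ { blocks → refl ; (group i) → refl })

  fill : GDD K G → Design (G last ⊎ Fin e) _≢_ → (∀ i → i ≢ last → Design (G i ⊎ Fin e) (Holed (G i) e)) →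
         Design (Σ (Fin K) G ⊎ Fin e) _≢_
  fill D full holed = amalgam Piece-finite designs embed (λ i → embed-inj i) (λ i → into i) cov apart
    where
    On : Piece → Set
    On blocks    = Σ (Fin K) G
    On (group i) = G i ⊎ Fin e
    -- The pairs inside the hole belong to the last group.
    Pair : ∀ i → On i → On i → Set
    Pair blocks x y = proj₁ x ≢ proj₁ y
    Pair (group i) x y = (x ≢ y) × (i ≢ last → ¬ ((∃ λ a → x ≡ inj₂ a) × (∃ λ b → y ≡ inj₂ b)))
    designs : ∀ i → Design (On i) (Pair i)
    designs blocks = D
    designs (group i) with i FP.≟ last
    ... | yes refl = relabel (mk↔ₛ′ id id (λ _ → refl) (λ _ → refl)) (λ ne → ne , λ n → contradiction refl n) proj₁ full
    ... | no n = relabel (mk↔ₛ′ id id (λ _ → refl) (λ _ → refl)) (λ { (ne , h) → ne , λ _ → h }) (λ { (ne , h) → ne , h n }) (holed i n)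
    embed : ∀ i → On i → Σ (Fin K) G ⊎ Fin e
    embed blocks x           = inj₁ x
    embed (group i) (inj₁ a) = inj₁ (i , a)
    embed (group i) (inj₂ a) = inj₂ a
    Σ-inj : ∀ {i} {a b : G i} → _≡_ {A = Σ (Fin K) G} (i , a) (i , b) → a ≡ b
    Σ-inj refl = refl
    embed-inj : ∀ i {a b} → embed i a ≡ embed i b → a ≡ b
    embed-inj blocks refl = refl
    embed-inj (group i) {inj₁ a} {inj₁ b} q = cong inj₁ (Σ-inj (SumP.inj₁-injective q))
    embed-inj (group i) {inj₂ a} {inj₂ b} q = cong inj₂ (SumP.inj₂-injective q)
    embed-inj (group i) {inj₁ a} {inj₂ b} ()
    embed-inj (group i) {inj₂ a} {inj₁ b} ()
    into : ∀ i {a b} → Pair i a b → embed i a ≢ embed i b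
    into blocks ne q = ne (cong proj₁ (SumP.inj₁-injective q))
    into (group i) (ne , _) q = ne (embed-inj (group i) q)
    cov : ∀ {x y} → x ≢ y → Σ[ i ∈ Piece ] Σ[ a ∈ On i ] Σ[ b ∈ On i ] Pair i a b × (embed i a ≡ x) × (embed i b ≡ y)
    cov {inj₁ (i , a)} {inj₁ (j , b)} ne with i FP.≟ j
    ... | no n     = blocks , (i , a) , (j , b) , n , refl , refl
    ... | yes refl = group i , inj₁ a , inj₁ b , ((λ { refl → ne refl }) , λ { _ ((_ , ()) , _) }) , refl , refl
    cov {inj₁ (i , a)} {inj₂ b} ne = group i , inj₁ a , inj₂ b , ((λ ()) , λ { _ ((_ , ()) , _) }) , refl , refl
    cov {inj₂ a} {inj₁ (i , b)} ne = group i , inj₂ a , inj₁ b , ((λ ()) , λ { _ (_ , (_ , ())) }) , refl , refl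
    cov {inj₂ a} {inj₂ b} ne = group last , inj₂ a , inj₂ b , ((λ { refl → ne refl }) , λ n → contradiction refl n) , refl , refl
    same-group : ∀ {i j a b c d} → Pair (group i) a b → Pair (group j) c d →
      embed (group i) a ≡ embed (group j) c → embed (group i) b ≡ embed (group j) d → i ≡ j
    same-group {a = inj₁ _} {c = inj₁ _} _ _ refl _ = refl
    same-group {b = inj₁ _} {d = inj₁ _} _ _ _ refl = refl
    same-group {i} {j} {a = inj₂ x} {inj₂ y} {inj₂ z} {inj₂ t} (_ , p) (_ , q) _ _ with i FP.≟ last | j FP.≟ last
    ... | yes u | yes w = trans u (sym w)
    ... | no n  | _     = contradiction ((x , refl) , (y , refl)) (p n)
    ... | _     | no n  = contradiction ((z , refl) , (t , refl)) (q n)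
    same-group {a = inj₁ _} {c = inj₂ _} _ _ () _
    same-group {a = inj₂ _} {c = inj₁ _} _ _ () _
    same-group {b = inj₁ _} {d = inj₂ _} _ _ _ ()
    same-group {b = inj₂ _} {d = inj₁ _} _ _ _ ()
    crossing : ∀ {j c d} {x y : Σ (Fin K) G} → proj₁ x ≢ proj₁ y → inj₁ x ≡ embed (group j) c → inj₁ y ≡ embed (group j) d → ⊥
    crossing {c = inj₁ _} {inj₁ _} ne refl refl = ne refl
    apart : ∀ {i j a b c d} → Pair i a b → Pair j c d → embed i a ≡ embed j c → embed i b ≡ embed j d → i ≡ j
    apart {blocks}  {blocks}  _ _ _ _ = refl
    apart {group i} {group j} {a} {b} {c} {d} p q u w = cong group (same-group {i} {j} {a} {b} {c} {d} p q u w)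
    apart {blocks}  {group j} {c = c} {d} p _ u w = ⊥-elim (crossing {j} {c} {d} p u w)
    apart {group i} {blocks}  {a} {b} _ q u w = ⊥-elim (crossing {i} {a} {b} q (sym u) (sym w))

-- Wilson's fundamental construction: `X g x` is the set of copies of the point x of the group g,
-- and an empty set deletes the point. Lines must join two points, and be determined by them, only
-- where both have copies. Thus a deleted group imposes no condition on the modulus.
inflate : {K n : ℕ} {Λ : Set} (X : Fin K → Fin n → Set) (at : Λ → Fin K → Fin n) → Finite Λ →
  (∀ ℓ → GDD K (λ g → X g (at ℓ g))) →
  (∀ {g h} → g ≢ h → ∀ {x y} → X g x → X h y → Σ[ ℓ ∈ Λ ] (at ℓ g ≡ x) × (at ℓ h ≡ y)) →
  (∀ {g h} → g ≢ h → ∀ {ℓ ℓ'} → X g (at ℓ g) → X h (at ℓ h) → at ℓ g ≡ at ℓ' g → at ℓ h ≡ at ℓ' h → ℓ ≡ ℓ') →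
  GDD K (λ g → Σ (Fin n) (X g))
inflate {K} {n} {Λ} X at fin D meet only = amalgam fin D (λ ℓ (g , a) → g , at ℓ g , a) (λ ℓ → inj ℓ) (λ ℓ ne → ne) cov piece
  where
  inj : ∀ ℓ {a b : Σ (Fin K) λ g → X g (at ℓ g)} →
        _≡_ {A = Σ (Fin K) λ g → Σ (Fin n) (X g)} (proj₁ a , at ℓ (proj₁ a) , proj₂ a) (proj₁ b , at ℓ (proj₁ b) , proj₂ b) → a ≡ b
  inj ℓ {g , a} {h , b} q with cong proj₁ q
  ... | refl = cong (g ,_) (lemma q)
    where
    lemma : ∀ {a b : X g (at ℓ g)} → _≡_ {A = Σ (Fin K) λ g → Σ (Fin n) (X g)} (g , at ℓ g , a) (g , at ℓ g , b) → a ≡ b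
    lemma refl = refl
  cov : {x y : Σ (Fin K) λ g → Σ (Fin n) (X g)} → proj₁ x ≢ proj₁ y →
    Σ[ ℓ ∈ Λ ] Σ[ a ∈ Σ (Fin K) (λ g → X g (at ℓ g)) ] Σ[ b ∈ Σ (Fin K) (λ g → X g (at ℓ g)) ] (proj₁ a ≢ proj₁ b) ×
      (_≡_ {A = Σ (Fin K) λ g → Σ (Fin n) (X g)} (proj₁ a , at ℓ (proj₁ a) , proj₂ a) x) × ((proj₁ b , at ℓ (proj₁ b) , proj₂ b) ≡ y)
  cov {g , x , a} {h , y , b} ne with meet ne a b
  ... | ℓ , refl , refl = ℓ , (g , a) , (h , b) , ne , refl , refl
  level : ∀ {g h : Fin K} {x : Fin n} {y : Fin n} {a : X g x} {b : X h y} (q : g ≡ h) →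
          _≡_ {A = Σ (Fin K) λ g → Σ (Fin n) (X g)} (g , x , a) (h , y , b) → x ≡ y
  level _ refl = refl
  piece : ∀ {ℓ ℓ'} {a b : Σ (Fin K) λ g → X g (at ℓ g)} {c d : Σ (Fin K) λ g → X g (at ℓ' g)} →
    proj₁ a ≢ proj₁ b → proj₁ c ≢ proj₁ d →
    _≡_ {A = Σ (Fin K) λ g → Σ (Fin n) (X g)} (proj₁ a , at ℓ (proj₁ a) , proj₂ a) (proj₁ c , at ℓ' (proj₁ c) , proj₂ c) →
    _≡_ {A = Σ (Fin K) λ g → Σ (Fin n) (X g)} (proj₁ b , at ℓ (proj₁ b) , proj₂ b) (proj₁ d , at ℓ' (proj₁ d) , proj₂ d) → ℓ ≡ ℓ'
  piece {ℓ} {ℓ'} {g , a} {h , b} {g' , c} {h' , d} ne _ u w with cong proj₁ u | cong proj₁ w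
  ... | refl | refl = only ne a b (level refl u) (level refl w)

-- Places an ingredient with k groups among the K groups of the master design, where the groups that
-- are not hit are empty.
reindex : ∀ {k K w} {s : Fin K → ℕ} (φ : Fin k → Fin K) → (∀ {i j} → φ i ≡ φ j → i ≡ j) →
  (∀ i → w (toℕ i) ≡ s (φ i)) → (∀ g → (Σ[ i ∈ Fin k ] φ i ≡ g) ⊎ (s g ≡ 0)) →
  Labelled k w proj₁ → GDD K (Fin ∘ s)
reindex {k} {K} {w} {s} φ φ-inj sizes onto D = amalgam (finite-Fin 1) (λ _ → D) (λ _ → e) (λ _ → e-inj) (λ _ ne q → ne (cong toℕ (φ-inj q))) cov
  (λ {i} {j} _ _ _ _ → one i j)
  where
  one : (i j : Fin 1) → i ≡ j
  one zero zero = refl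
  e : Pts k w → Σ (Fin K) (Fin ∘ s)
  e (i ▸ a) = φ i , subst Fin (sizes i) a
  e-inj : ∀ {x y} → e x ≡ e y → x ≡ y
  e-inj {i ▸ a} {j ▸ b} q with φ-inj (cong proj₁ q)
  ... | refl = cong (i ▸_) (subst-inj (sizes i) (lemma q))
    where
    lemma : ∀ {g} {a b : Fin (s g)} → _≡_ {A = Σ (Fin K) (Fin ∘ s)} (g , a) (g , b) → a ≡ b
    lemma refl = refl
    subst-inj : ∀ {m n} {a b : Fin m} (q : m ≡ n) → subst Fin q a ≡ subst Fin q b → a ≡ b
    subst-inj refl q = q
  hit : ∀ g → Fin (s g) → Σ[ i ∈ Fin k ] φ i ≡ g
  hit g a with onto g
  ... | inj₁ p = p
  ... | inj₂ z with subst Fin z a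
  ...   | ()
  preimage : ∀ x → Σ[ y ∈ Pts k w ] e y ≡ x
  preimage (g , a) with hit g a
  ... | i , refl = i ▸ subst Fin (sym (sizes i)) a , cong (φ i ,_) (cancel (sizes i))
    where
    cancel : ∀ {m n} {a : Fin n} (q : m ≡ n) → subst Fin q (subst Fin (sym q) a) ≡ a
    cancel refl = refl
  cov : ∀ {x y : Σ (Fin K) (Fin ∘ s)} → proj₁ x ≢ proj₁ y →
    Σ[ _ ∈ Fin 1 ] Σ[ a ∈ Pts k w ] Σ[ b ∈ Pts k w ] (proj₁ (raw a) ≢ proj₁ (raw b)) × (e a ≡ x) × (e b ≡ y)
  cov {x} {y} ne with preimage x | preimage y
  ... | a@(i ▸ _) , refl | b@(j ▸ _) , refl = zero , a , b , (λ q → ne (cong φ (FP.toℕ-injective q))) , refl , refl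

-- The transversal design over ℤ/m: the line (a , b) has level a + g b in the groups g = 0, …, 6
-- and level b in the group 7.
module Plane (m-1 : ℕ) where

  open Congruence m-1

  ≈-* : ∀ {a b} c → a ≈ b → a * c ≈ b * c
  ≈-* {a} {b} c e = trans (%-distribˡ-* a c m) (trans (cong (λ z → (z * (c % m)) % m) e) (sym (%-distribˡ-* b c m)))

  Unit : ℕ → Set
  Unit d = Σ[ u ∈ ℕ ] d * u ≈ 1

  coprime⇒unit : ∀ {d} → Coprime d m → Unit d
  coprime⇒unit {d} cop with coprime-Bézout cop
  ... | Bézout.+- x y e = x , trans (cong (_% m) (trans (ℕP.*-comm d x) (sym e))) ([m+kn]%n≡m%n 1 y m)
  -- Here 1 + x d is a multiple of m, so the inverse of d is -x, written as x (m - 1).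
  ... | Bézout.-+ x y e = x * m-1 , ≈-cancel {d * (x * m-1)} {1} m-1
        (trans (cong (_% m) (trans (cong (_+ m-1) (sym (ℕP.*-assoc d x m-1))) (ℕP.+-comm _ m-1)))
        (trans (cong (λ z → (m-1 + z * m-1) % m) (ℕP.*-comm d x))
        (trans (cong (_% m) (cong (_* m-1) e))
        (trans (cong (_% m) (trans (ℕP.*-assoc y m m-1) (trans (cong (y *_) (ℕP.*-comm m m-1)) (sym (ℕP.*-assoc y m-1 m)))))
        (trans ([m+kn]%n≡m%n 0 (y * m-1) m) (sym ([m+n]%n≡m%n 0 m)))))))

  -- The numbers 1, ..., 4 all divide 12, as 1, ..., 6 all divide 60 below; so a number coprime to m
  -- bounds the slopes that can be used.
  unit-12 : Coprime 12 m → ∀ d → 0 < d → d < 5 → Unit d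
  unit-12 cop d p q = coprime⇒unit λ { (u , v) → cop (∣-trans u (go d p q) , v) }
    where
    go : ∀ d → 0 < d → d < 5 → d ∣ 12
    go 1 _ _ = from-yes (1 ∣? 12)
    go 2 _ _ = from-yes (2 ∣? 12)
    go 3 _ _ = from-yes (3 ∣? 12)
    go 4 _ _ = from-yes (4 ∣? 12)
    go (suc (suc (suc (suc (suc _))))) _ (s≤s (s≤s (s≤s (s≤s (s≤s ())))))

  unit-60 : Coprime 60 m → ∀ d → 0 < d → d < 7 → Unit d
  unit-60 cop d p q = coprime⇒unit λ { (u , v) → cop (∣-trans u (go d p q) , v) }
    where
    go : ∀ d → 0 < d → d < 7 → d ∣ 60
    go 1 _ _ = from-yes (1 ∣? 60)
    go 2 _ _ = from-yes (2 ∣? 60)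
    go 3 _ _ = from-yes (3 ∣? 60)
    go 4 _ _ = from-yes (4 ∣? 60)
    go 5 _ _ = from-yes (5 ∣? 60)
    go 6 _ _ = from-yes (6 ∣? 60)
    go (suc (suc (suc (suc (suc (suc (suc _))))))) _ (s≤s (s≤s (s≤s (s≤s (s≤s (s≤s (s≤s ())))))))

  -- Subtracting the two equations leaves (h - g) b ≈ y - x. The same determinant h - g gives
  -- uniqueness in `separate`.
  join : ∀ {g h} → g ≤ h → Unit (h ∸ g) → ∀ x y → x < m →
         Σ[ a ∈ ℕ ] Σ[ b ∈ ℕ ] (a + g * b ≈ x) × (a + h * b ≈ y)
  join {g} {h} g≤h (u , δu) x y x<m = a , b , a+gb , a+hb
    where
    δ = h ∸ g
    b = u * diff x y
    a = diff ((g * b) % m) x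
    a+gb : a + g * b ≈ x
    a+gb = trans (cong (_% m) (ℕP.+-comm a (g * b))) (trans (sym (≈-+ {(g * b) % m} {g * b} a (%-≈ (g * b))))
      (trans (cong (_% m) (ℕP.+-comm ((g * b) % m) a)) (diff-+ {(g * b) % m} x (m%n<n (g * b) m))))
    δb : δ * b ≈ diff x y
    δb = trans (cong (_% m) (sym (ℕP.*-assoc δ u (diff x y)))) (trans (≈-* {δ * u} {1} (diff x y) δu) (cong (_% m) (ℕP.*-identityˡ (diff x y))))
    split : a + h * b ≡ (a + g * b) + δ * b
    split = trans (cong (λ z → a + z * b) (sym (ℕP.m+[n∸m]≡n g≤h))) (trans (cong (a +_) (ℕP.*-distribʳ-+ b g δ)) (sym (ℕP.+-assoc a _ _)))
    a+hb : a + h * b ≈ y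
    a+hb = trans (cong (_% m) split) (trans (≈-+ {a + g * b} {x} (δ * b) a+gb)
      (trans (cong (_% m) (ℕP.+-comm x (δ * b))) (trans (≈-+ {δ * b} {diff x y} x δb) (diff-+ y x<m))))

  separate : ∀ {g h} → g ≤ h → Unit (h ∸ g) → ∀ {a b a' b'} →
             a + g * b ≈ a' + g * b' → a + h * b ≈ a' + h * b' → (a ≈ a') × (b ≈ b')
  separate {g} {h} g≤h (u , δu) {a} {b} {a'} {b'} e₁ e₂ = a≈ , b≈
    where
    δ = h ∸ g
    split : ∀ a b → a + h * b ≡ δ * b + (a + g * b)
    split a b = trans (cong (λ z → a + z * b) (sym (ℕP.m+[n∸m]≡n g≤h))) (trans (cong (a +_) (ℕP.*-distribʳ-+ b g δ))
      (trans (sym (ℕP.+-assoc a _ _)) (ℕP.+-comm _ (δ * b))))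
    δ≈ : δ * b ≈ δ * b'
    δ≈ = ≈-cancel {δ * b} {δ * b'} (a' + g * b') (trans (trans (cong (_% m) (ℕP.+-comm (δ * b) _))
      (trans (sym (≈-+ {a + g * b} {a' + g * b'} (δ * b) e₁)) (cong (_% m) (trans (ℕP.+-comm _ (δ * b)) (sym (split a b))))))
      (trans e₂ (cong (_% m) (split a' b'))))
    undo : ∀ b → (δ * b) * u ≈ b
    undo b = trans (cong (_% m) (trans (ℕP.*-assoc δ b u) (trans (cong (δ *_) (ℕP.*-comm b u)) (sym (ℕP.*-assoc δ u b)))))
      (trans (≈-* {δ * u} {1} b δu) (cong (_% m) (ℕP.*-identityˡ b)))
    b≈ : b ≈ b'
    b≈ = trans (sym (undo b)) (trans (≈-* {δ * b} {δ * b'} u δ≈) (undo b'))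
    a≈ : a ≈ a'
    a≈ = ≈-cancel {a} {a'} (g * b) (trans e₁ (trans (cong (_% m) (ℕP.+-comm a' _))
      (trans (≈-+ {g * b'} {g * b} a' (trans (cong (_% m) (ℕP.*-comm g b')) (trans (≈-* {b'} {b} g (sym b≈)) (cong (_% m) (ℕP.*-comm b g)))))
        (cong (_% m) (ℕP.+-comm _ a')))))

  residue-cong : ∀ {x y} → x ≈ y → residue x ≡ residue y
  residue-cong {x} {y} e = FP.toℕ-injective (trans (toℕ-residue x) (trans e (sym (toℕ-residue y))))

  residue-injective : ∀ {x y} → residue x ≡ residue y → x ≈ y
  residue-injective {x} {y} e = trans (sym (toℕ-residue x)) (trans (cong toℕ e) (toℕ-residue y))

  residue-toℕ : ∀ x → residue (toℕ x) ≡ x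
  residue-toℕ x = FP.toℕ-injective (trans (toℕ-residue (toℕ x)) (m<n⇒m%n≡m (FP.toℕ<n x)))

  Line : Set
  Line = Fin m × Fin m

  Line-finite : Finite Line
  Line-finite = m * m , ↔-sym FP.*↔×

  at : Line → Fin 8 → Fin m
  at (a , b) g = if toℕ g <ᵇ 7 then residue (toℕ a + toℕ g * toℕ b) else b

  module _ (X : Fin 8 → Fin m → Set)
    (unit : ∀ {g h} → toℕ g < toℕ h → toℕ h < 7 → ∀ {x y} → X g x → X h y → Unit (toℕ h ∸ toℕ g)) where

    through : ∀ {g x} a b → toℕ g < 7 → a + toℕ g * b ≈ toℕ x → at (residue a , residue b) g ≡ x
    through {g} {x} a b lt e rewrite T-true (ℕP.<⇒<ᵇ lt) = trans (residue-cong {toℕ (residue a) + toℕ g * toℕ (residue b)} {toℕ x}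
      (trans (cong₂ (λ z w → (z + toℕ g * w) % m) (toℕ-residue a) (toℕ-residue b))
      (trans (≈-+ {a % m} {a} (toℕ g * (b % m)) (%-≈ a))
      (trans (cong (_% m) (ℕP.+-comm a _))
      (trans (≈-+ {toℕ g * (b % m)} {toℕ g * b} a (trans (cong (_% m) (ℕP.*-comm (toℕ g) _)) (trans (≈-* {b % m} {b} (toℕ g) (%-≈ b)) (cong (_% m) (ℕP.*-comm b (toℕ g))))))
      (trans (cong (_% m) (ℕP.+-comm _ a)) e)))))) (residue-toℕ x)

    at-≈ : ∀ {g} → toℕ g < 7 → ∀ {ℓ ℓ'} → at ℓ g ≡ at ℓ' g →
           toℕ (proj₁ ℓ) + toℕ g * toℕ (proj₂ ℓ) ≈ toℕ (proj₁ ℓ') + toℕ g * toℕ (proj₂ ℓ')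
    at-≈ {g} lt {ℓ} {ℓ'} e with toℕ g <ᵇ 7 | T-true (ℕP.<⇒<ᵇ lt)
    ... | true | _ = residue-injective {toℕ (proj₁ ℓ) + toℕ g * toℕ (proj₂ ℓ)} {toℕ (proj₁ ℓ') + toℕ g * toℕ (proj₂ ℓ')} e

    is-7 : ∀ g → (toℕ g < 7) ⊎ (g ≡ # 7)
    is-7 = from-yes (FP.all? λ g → dec g)
      where
      dec : ∀ (g : Fin 8) → Dec ((toℕ g < 7) ⊎ (g ≡ # 7))
      dec g = (toℕ g ℕP.<? 7) ⊎-dec (g FP.≟ # 7)

    meet< : ∀ {g h} → toℕ g < toℕ h → ∀ {x y} → X g x → X h y → Σ[ ℓ ∈ Line ] (at ℓ g ≡ x) × (at ℓ h ≡ y)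
    meet< {g} {h} lt {x} {y} p q with is-7 h
    ... | inj₁ h<7 = let (a , b , u , w) = join (ℕP.<⇒≤ lt) (unit lt h<7 p q) (toℕ x) (toℕ y) (FP.toℕ<n x) in
          (residue a , residue b) , through {g} a b (ℕP.<-trans lt h<7) u , through {h} a b h<7 w
    ... | inj₂ refl = (residue a , y) , subst (λ z → at (residue a , z) g ≡ x) (residue-toℕ y)
            (through {g} a (toℕ y) lt (trans (cong (_% m) (ℕP.+-comm a _)) (trans (sym (≈-+ {gy % m} {gy} a (%-≈ gy)))
              (trans (cong (_% m) (ℕP.+-comm (gy % m) a)) (diff-+ {gy % m} (toℕ x) (m%n<n gy m)))))) , refl
      where
      gy = toℕ g * toℕ y
      a = diff (gy % m) (toℕ x)

    only< : ∀ {g h} → toℕ g < toℕ h → ∀ {ℓ ℓ'} → X g (at ℓ g) → X h (at ℓ h) → at ℓ g ≡ at ℓ' g → at ℓ h ≡ at ℓ' h → ℓ ≡ ℓ'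
    only< {g} {h} lt {a , b} {a' , b'} p q u w with is-7 h
    ... | inj₁ h<7 = let (a≈ , b≈) = separate (ℕP.<⇒≤ lt) (unit lt h<7 p q) {toℕ a} {toℕ b} {toℕ a'} {toℕ b'}
                           (at-≈ {g} (ℕP.<-trans lt h<7) {a , b} {a' , b'} u) (at-≈ {h} h<7 {a , b} {a' , b'} w)
                     in cong₂ _,_ (Fin-≈ {a} {a'} a≈) (Fin-≈ {b} {b'} b≈)
    ... | inj₂ refl with w
    ...   | refl = cong (_, b) (Fin-≈ {a} {a'} (≈-cancel {toℕ a} {toℕ a'} (toℕ g * toℕ b) (at-≈ {g} lt {a , b} {a' , b} u)))

    inflate-plane : (∀ ℓ → GDD 8 (λ g → X g (at ℓ g))) → GDD 8 (λ g → Σ (Fin m) (X g))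
    inflate-plane D = inflate X at Line-finite D meet only
      where
      order : ∀ {g h : Fin 8} → g ≢ h → (toℕ g < toℕ h) ⊎ (toℕ h < toℕ g)
      order {g} {h} ne with ℕP.<-cmp (toℕ g) (toℕ h)
      ... | tri< a _ _ = inj₁ a
      ... | tri≈ _ e _ = contradiction (FP.toℕ-injective e) ne
      ... | tri> _ _ c = inj₂ c
      meet : ∀ {g h} → g ≢ h → ∀ {x y} → X g x → X h y → Σ[ ℓ ∈ Line ] (at ℓ g ≡ x) × (at ℓ h ≡ y)
      meet {g} {h} ne p q with order ne
      ... | inj₁ lt = meet< {g} {h} lt p q
      ... | inj₂ lt = let (ℓ , u , w) = meet< {h} {g} lt q p in ℓ , w , u
      only : ∀ {g h} → g ≢ h → ∀ {ℓ ℓ'} → X g (at ℓ g) → X h (at ℓ h) → at ℓ g ≡ at ℓ' g → at ℓ h ≡ at ℓ' h → ℓ ≡ ℓ'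
      only {g} {h} ne {ℓ} {ℓ'} p q u w with order ne
      ... | inj₁ lt = only< {g} {h} lt {ℓ} {ℓ'} p q u w
      ... | inj₂ lt = only< {h} {g} lt {ℓ} {ℓ'} q p w u

-- One step of the recursion

single-point : Full 1
single-point = record
  { Blk = ⊥ ; finite = 0 , mk↔ₛ′ (λ ()) (λ ()) (λ ()) (λ ()) ; pt = λ () ; sound = λ ()
  ; cover = λ {x} {y} ne → contradiction (only x y) ne
  ; unique = λ {k} → ⊥-elim k ; simple = λ {k} → ⊥-elim k ; σ = id ; σ-inj = id ; trade = λ () }
  where
  only : (x y : Fin 1) → x ≡ y
  only zero zero = refl

⊎-Fin : ∀ {A : Set} {n} e → A ↔ Fin n → (A ⊎ Fin e) ↔ Fin (n + e)
⊎-Fin {A} {n} e i = proj₂ (finite-⊎ (n , i) (finite-Fin e))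

full-on : ∀ {A : Set} {n e v} → A ↔ Fin n → n + e ≡ v → Full v → Design (A ⊎ Fin e) _≢_
full-on {e = e} i refl = ≢-on (↔-sym (⊎-Fin e i))

-- A hole of at most one point contains no pair. This is why adding the single point ∞ needs only
-- ordinary designs as fillers.
holed : ∀ {A : Set} {e} → Design (A ⊎ Fin e) _≢_ → e ≤ 1 → Design (A ⊎ Fin e) (Holed A e)
holed {A} {e} D e≤1 = relabel (mk↔ₛ′ id id (λ _ → refl) (λ _ → refl)) (λ ne → ne , λ { ((a , refl) , (b , refl)) → ne (cong inj₂ (same a b e≤1)) }) proj₁ D
  where
  same : ∀ {e} (a b : Fin e) → e ≤ 1 → a ≡ b
  same zero zero (s≤s z≤n) = refl

subst-Full : ∀ {v w} → v ≡ w → Full v → Full w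
subst-Full refl D = D

-- The sizes are compared through an explicit table t, so that all side conditions are decidable.
place-groups : ∀ {k w} {s : Fin 8 → ℕ} (φ : Vec (Fin 8) k) (t : Vec ℕ 8) → (∀ g → V.lookup t g ≡ s g) →
  {True (FP.all? λ i → FP.all? λ j → (V.lookup φ i FP.≟ V.lookup φ j) →-dec (i FP.≟ j))} →
  {True (FP.all? λ i → w (toℕ i) ℕP.≟ V.lookup t (V.lookup φ i))} →
  {True (FP.all? λ g → (FP.any? λ i → V.lookup φ i FP.≟ g) ⊎-dec (V.lookup t g ℕP.≟ 0))} →
  Labelled k w proj₁ → GDD 8 (Fin ∘ s)
place-groups {w = w} {s} φ t t≡s {inj} {sizes} {onto} = reindex {w = w} {s} (V.lookup φ) (λ {i} {j} → toWitness inj i j)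
  (λ i → trans (toWitness sizes i) (t≡s (V.lookup φ i)))
  (λ g → cover (toWitness onto g))
  where
  cover : ∀ {g} → (Σ[ i ∈ Fin _ ] V.lookup φ i ≡ g) ⊎ (V.lookup t g ≡ 0) → (Σ[ i ∈ Fin _ ] V.lookup φ i ≡ g) ⊎ (s g ≡ 0)
  cover (inj₁ p) = inj₁ p
  cover {g} (inj₂ z) = inj₂ (trans (sym (t≡s g)) z)

sumF-cong : ∀ n {w w' : Fin n → ℕ} → (∀ i → w i ≡ w' i) → sumF n w ≡ sumF n w'
sumF-cong zero    e = refl
sumF-cong (suc n) e = cong₂ _+_ (e zero) (sumF-cong n (e ∘ suc))

sumF-const : ∀ n k → sumF n (λ _ → k) ≡ n * k
sumF-const zero    k = refl
sumF-const (suc n) k = cong (k +_) (sumF-const n k)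

sumF-prefix : ∀ n {j} k → j ≤ n → sumF n (λ l → if toℕ l <ᵇ j then k else 0) ≡ j * k
sumF-prefix zero    k z≤n = refl
sumF-prefix (suc n) {zero}  k z≤n     = trans (sumF-const n 0) (ℕP.*-zeroʳ n)
sumF-prefix (suc n) {suc j} k (s≤s p) = cong (k +_) (sumF-prefix n k p)

tens : ℕ → ℕ → ℕ → ℕ
tens k r g = if g <ᵇ k then 10 else r

module Step
  (g10⁵ : Labelled 5 (λ _ → 10) proj₁) (g10⁶ : Labelled 6 (λ _ → 10) proj₁)
  (g10⁷ : Labelled 7 (λ _ → 10) proj₁) (g10⁸ : Labelled 8 (λ _ → 10) proj₁)
  (g10⁵4 : Labelled 6 (tens 5 4) proj₁) (g10⁷4 : Labelled 8 (tens 7 4) proj₁)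
  where

  data Last : Set where
    ten four : Last

  weight : Last → ℕ
  weight ten  = 10
  weight four = 4

  module _ (m-1 j c : ℕ) (h : Last) where

    open Plane m-1
    open Congruence m-1 using (m; residue)

    wt : Fin 8 → ℕ → ℕ
    wt g l = if toℕ g <ᵇ 5 then 10 else
             if toℕ g <ᵇ 7 then (if l <ᵇ j then 10 else 0) else
             (if l <ᵇ c then (if l ≡ᵇ 0 then weight h else 10) else 0)

    ingredient : ∀ (ℓ : Line) → GDD 8 (λ g → Fin (wt g (toℕ (at ℓ g))))
    ingredient ℓ@(a , b) = go h refl (toℕ (at ℓ (# 5)) <ᵇ j) refl (toℕ (at ℓ (# 6)) <ᵇ j) refl (toℕ b <ᵇ c) refl (toℕ b) refl
      where
      s : Fin 8 → ℕ
      s g = wt g (toℕ (at ℓ g))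
      table : ℕ → ℕ → ℕ → Vec ℕ 8
      table x y z = 10 ∷ 10 ∷ 10 ∷ 10 ∷ 10 ∷ x ∷ y ∷ z ∷ []
      sizes : ∀ {x y z} → x ≡ s (# 5) → y ≡ s (# 6) → z ≡ s (# 7) → ∀ g → V.lookup (table x y z) g ≡ s g
      sizes p q r zero = refl
      sizes p q r (suc zero) = refl
      sizes p q r (suc (suc zero)) = refl
      sizes p q r (suc (suc (suc zero))) = refl
      sizes p q r (suc (suc (suc (suc zero)))) = refl
      sizes p q r (suc (suc (suc (suc (suc zero))))) = p
      sizes p q r (suc (suc (suc (suc (suc (suc zero)))))) = q
      sizes p q r (suc (suc (suc (suc (suc (suc (suc zero))))))) = r
      on : ∀ {x b'} → b' ≡ x → (if b' then 10 else 0) ≡ (if x then 10 else 0)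
      on = cong (if_then 10 else 0)
      last : ∀ {v} l {t} → toℕ b ≡ l → (toℕ b <ᵇ c) ≡ t → (if t then (if l ≡ᵇ 0 then weight h else 10) else 0) ≡ v → v ≡ s (# 7)
      last l p q r = sym (trans (cong₂ (λ t l → if t then (if l ≡ᵇ 0 then weight h else 10) else 0) q p) r)
      -- Hence a line through the point of weight 4 meets both or none of the cut-down groups.
      level : toℕ b ≡ 0 → (toℕ (at ℓ (# 5)) <ᵇ j) ≡ (toℕ (at ℓ (# 6)) <ᵇ j)
      level e = cong (λ z → toℕ z <ᵇ j) (cong (λ z → residue (toℕ a + z)) (trans (cong (5 *_) e) (sym (cong (6 *_) e))))
      go : ∀ h' → h ≡ h' → ∀ x → (toℕ (at ℓ (# 5)) <ᵇ j) ≡ x → ∀ y → (toℕ (at ℓ (# 6)) <ᵇ j) ≡ y →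
           ∀ z → (toℕ b <ᵇ c) ≡ z → ∀ l → toℕ b ≡ l → GDD 8 (Fin ∘ s)
      go _ _ false p false q false r l u = place-groups (# 0 ∷ # 1 ∷ # 2 ∷ # 3 ∷ # 4 ∷ []) (table 0 0 0) (sizes (sym (on p)) (sym (on q)) (last l u r refl)) g10⁵
      go _ _ true  p false q false r l u = place-groups (# 0 ∷ # 1 ∷ # 2 ∷ # 3 ∷ # 4 ∷ # 5 ∷ []) (table 10 0 0) (sizes (sym (on p)) (sym (on q)) (last l u r refl)) g10⁶
      go _ _ false p true  q false r l u = place-groups (# 0 ∷ # 1 ∷ # 2 ∷ # 3 ∷ # 4 ∷ # 6 ∷ []) (table 0 10 0) (sizes (sym (on p)) (sym (on q)) (last l u r refl)) g10⁶
      go _ _ true  p true  q false r l u = place-groups (# 0 ∷ # 1 ∷ # 2 ∷ # 3 ∷ # 4 ∷ # 5 ∷ # 6 ∷ []) (table 10 10 0) (sizes (sym (on p)) (sym (on q)) (last l u r refl)) g10⁷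
      go h' e x p y q true r (suc l) u = more x p y q
        where
        more : ∀ x → (toℕ (at ℓ (# 5)) <ᵇ j) ≡ x → ∀ y → (toℕ (at ℓ (# 6)) <ᵇ j) ≡ y → GDD 8 (Fin ∘ s)
        more false p false q = place-groups (# 0 ∷ # 1 ∷ # 2 ∷ # 3 ∷ # 4 ∷ # 7 ∷ []) (table 0 0 10) (sizes (sym (on p)) (sym (on q)) (last (suc l) u r refl)) g10⁶
        more true  p false q = place-groups (# 0 ∷ # 1 ∷ # 2 ∷ # 3 ∷ # 4 ∷ # 5 ∷ # 7 ∷ []) (table 10 0 10) (sizes (sym (on p)) (sym (on q)) (last (suc l) u r refl)) g10⁷
        more false p true  q = place-groups (# 0 ∷ # 1 ∷ # 2 ∷ # 3 ∷ # 4 ∷ # 6 ∷ # 7 ∷ []) (table 0 10 10) (sizes (sym (on p)) (sym (on q)) (last (suc l) u r refl)) g10⁷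
        more true  p true  q = place-groups (# 0 ∷ # 1 ∷ # 2 ∷ # 3 ∷ # 4 ∷ # 5 ∷ # 6 ∷ # 7 ∷ []) (table 10 10 10) (sizes (sym (on p)) (sym (on q)) (last (suc l) u r refl)) g10⁸
      go ten e x p y q true r zero u = more x p y q
        where
        more : ∀ x → (toℕ (at ℓ (# 5)) <ᵇ j) ≡ x → ∀ y → (toℕ (at ℓ (# 6)) <ᵇ j) ≡ y → GDD 8 (Fin ∘ s)
        more false p false q = place-groups (# 0 ∷ # 1 ∷ # 2 ∷ # 3 ∷ # 4 ∷ # 7 ∷ []) (table 0 0 10) (sizes (sym (on p)) (sym (on q)) (last 0 u r (cong weight e))) g10⁶
        more true  p false q = place-groups (# 0 ∷ # 1 ∷ # 2 ∷ # 3 ∷ # 4 ∷ # 5 ∷ # 7 ∷ []) (table 10 0 10) (sizes (sym (on p)) (sym (on q)) (last 0 u r (cong weight e))) g10⁷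
        more false p true  q = place-groups (# 0 ∷ # 1 ∷ # 2 ∷ # 3 ∷ # 4 ∷ # 6 ∷ # 7 ∷ []) (table 0 10 10) (sizes (sym (on p)) (sym (on q)) (last 0 u r (cong weight e))) g10⁷
        more true  p true  q = place-groups (# 0 ∷ # 1 ∷ # 2 ∷ # 3 ∷ # 4 ∷ # 5 ∷ # 6 ∷ # 7 ∷ []) (table 10 10 10) (sizes (sym (on p)) (sym (on q)) (last 0 u r (cong weight e))) g10⁸
      go four e false p false q true r zero u = place-groups (# 0 ∷ # 1 ∷ # 2 ∷ # 3 ∷ # 4 ∷ # 7 ∷ []) (table 0 0 4) (sizes (sym (on p)) (sym (on q)) (last 0 u r (cong weight e))) g10⁵4
      go four e true  p true  q true r zero u = place-groups (# 0 ∷ # 1 ∷ # 2 ∷ # 3 ∷ # 4 ∷ # 5 ∷ # 6 ∷ # 7 ∷ []) (table 10 10 4) (sizes (sym (on p)) (sym (on q)) (last 0 u r (cong weight e))) g10⁷4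
      go four e true  p false q true r zero u = contradiction (trans (sym p) (trans (level u) q)) λ ()
      go four e false p true  q true r zero u = contradiction (trans (sym q) (trans (sym (level u)) p)) λ ()

    tail : ℕ → ℕ
    tail zero    = 0
    tail (suc c) = weight h + c * 10

    -- For j = 0 the groups of slopes 5 and 6 have no points, so only differences up to 4 have to be
    -- invertible. This admits n = 5.
    Units : Set
    Units = (Coprime 60 m) ⊎ ((j ≡ 0) × Coprime 12 m)

    sizeOf : Fin 8 → ℕ
    sizeOf g = if toℕ g <ᵇ 5 then m * 10 else if toℕ g <ᵇ 7 then j * 10 else tail c

    sum-wt : j ≤ m → c ≤ m → ∀ g → sumF m (wt g ∘ toℕ) ≡ sizeOf g
    sum-wt p q g with toℕ g <ᵇ 5 | toℕ g <ᵇ 7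
    ... | true  | _     = sumF-const m 10
    ... | false | true  = sumF-prefix m 10 p
    ... | false | false = tail-sum c q
      where
      tail-sum : ∀ c → c ≤ m → sumF m (λ l → if toℕ l <ᵇ c then (if toℕ l ≡ᵇ 0 then weight h else 10) else 0) ≡ tail c
      tail-sum zero    q       = trans (sumF-const m 0) (ℕP.*-zeroʳ m)
      tail-sum (suc c) (s≤s q) = cong (weight h +_) (sumF-prefix m-1 10 q)

    unit : Units → ∀ {g h} → toℕ g < toℕ h → toℕ h < 7 → ∀ {x y : Fin m} → Fin (wt g (toℕ x)) → Fin (wt h (toℕ y)) → Unit (toℕ h ∸ toℕ g)
    unit (inj₁ cop) {g} {h} lt lt' _ _ = unit-60 cop _ (ℕP.m<n⇒0<n∸m lt) (ℕP.≤-<-trans (ℕP.m∸n≤m (toℕ h) (toℕ g)) lt')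
    unit (inj₂ (refl , cop)) {g} {h} lt lt' {y = y} _ v = unit-12 cop _ (ℕP.m<n⇒0<n∸m lt) (ℕP.≤-<-trans (ℕP.m∸n≤m (toℕ h) (toℕ g)) (small h lt' v))
      where
      small : ∀ (h : Fin 8) → toℕ h < 7 → Fin (wt h (toℕ y)) → toℕ h < 5
      small h lt v with toℕ h <ᵇ 5 in e | toℕ h <ᵇ 7 | T-true (ℕP.<⇒<ᵇ lt)
      ... | true  | _ | _ = ℕP.<ᵇ⇒< (toℕ h) 5 (subst T (sym e) tt)
      ... | false | true | _ with v
      ...   | ()

    step : Units → j ≤ m → c ≤ m → Full (m * 10 + 1) → Full (j * 10 + 1) → Full (tail c + 1) → Full (sumF 8 sizeOf + 1)
    step u p q Dm Dj Dc = ≢-on (⊎-Fin 1 whole) (fill (# 0) gdd (fillers (# 0)) (λ i _ → holed (fillers i) (s≤s z≤n)))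
      where
      X : Fin 8 → Fin m → Set
      X g l = Fin (wt g (toℕ l))
      gdd : GDD 8 (λ g → Σ (Fin m) (X g))
      gdd = inflate-plane X (λ {g} {h} → unit u {g} {h}) ingredient
      group≃ : ∀ g → Σ (Fin m) (X g) ↔ Fin (sizeOf g)
      group≃ g = subst (λ z → Σ (Fin m) (X g) ↔ Fin z) (sum-wt p q g) (Σ-Fin m (wt g ∘ toℕ))
      fillers : ∀ g → Design (Σ (Fin m) (X g) ⊎ Fin 1) _≢_
      fillers g = full-on (group≃ g) refl (pick (toℕ g <ᵇ 5) (toℕ g <ᵇ 7))
        where
        pick : ∀ x y → Full ((if x then m * 10 else if y then j * 10 else tail c) + 1)
        pick true  _     = Dm
        pick false true  = Dj
        pick false false = Dc
      whole : (Σ (Fin 8) λ g → Σ (Fin m) (X g)) ↔ Fin (sumF 8 sizeOf)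
      whole = Σ-Fin 8 sizeOf ↔-∘ mk↔ₛ′ (λ { (g , x) → g , Inverse.to (group≃ g) x }) (λ { (g , x) → g , Inverse.from (group≃ g) x })
        (λ { (g , x) → cong (g ,_) (Inverse.strictlyInverseˡ (group≃ g) x) }) (λ { (g , x) → cong (g ,_) (Inverse.strictlyInverseʳ (group≃ g) x) })

-- Constructions from base blocks

-- The effect of the translation by 1 on the labels: c cycles of length k, all other labels fixed.
rotate : ℕ → (k-1 : ℕ) → ℕ → ℕ
rotate c k-1 l = if l <ᵇ c * suc k-1 then (l / suc k-1) * suc k-1 + (l % suc k-1 + 1) % suc k-1 else l

module Checked (m-1 c f : ℕ) (K : ℕ) (w : ℕ → ℕ) (to from : ℕ × ℕ → ℕ × ℕ) (lab : ℕ × ℕ → ℕ) (π : ℕ → ℕ) where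

  sizes : ℕ → ℕ
  sizes = Development.md m-1 c f (lab ∘ to) π

  bijective : Bool
  bijective = bijective? {c + f} {K} {sizes} {w} to from

  decoded : ∀ {n} → Vec Row n → Vec Base n
  decoded = V.map (Development.decodeRow m-1 c f (lab ∘ to) π)

  passes : ∀ {b-1} → Vec Row (suc b-1) → Bool
  passes rows = checked (decoded rows)
    where
    checked : ∀ {b-1} → Vec Base (suc b-1) → Bool
    checked rows = Development.Table.Check.check m-1 c f (lab ∘ to) π rows
      (Development.Table.table m-1 c f (lab ∘ to) π rows) (Development.Table.mates m-1 c f (lab ∘ to) π rows)

  labelled : ∀ {b-1} (rows : Vec Row (suc b-1)) → passes rows ≡ true → bijective ≡ true → Labelled K w lab
  labelled rows ok bij = transfer {c + f} {K} {sizes} {w} to from lab bij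
    (Development.Table.Check.Sound.design m-1 c f (lab ∘ to) π (decoded rows)
      (Development.Table.table m-1 c f (lab ∘ to) π (decoded rows)) (Development.Table.mates m-1 c f (lab ∘ to) π (decoded rows)) ok)

module Whole (m-1 c f : ℕ) where
  m n : ℕ
  m = suc m-1
  n = c * m + f
  to from : ℕ × ℕ → ℕ × ℕ
  to (o , a) = 0 , (if o <ᵇ c then o * m + a else c * m + (o ∸ c))
  from (_ , x) = if x <ᵇ c * m then (x / m , x % m) else (c + (x ∸ c * m) , 0)
  open Checked m-1 c f 1 (λ _ → n) to from proj₂ (rotate c m-1) public

  full : ∀ {b-1} (rows : Vec Row (suc b-1)) → passes rows ≡ true → bijective ≡ true → Full n
  full rows ok bij = relabel (mk↔ₛ′ t (zero ▸_) (λ _ → refl) ut)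
    (λ { {zero ▸ a} {zero ▸ b} ne q → ne (cong toℕ q) ; {suc () ▸ _} ; {_} {suc () ▸ _} }) (λ ne q → ne (FP.toℕ-injective q)) (labelled rows ok bij)
    where
    t : Pts 1 (λ _ → n) → Fin n
    t (zero ▸ a) = a
    ut : ∀ x → zero ▸ t x ≡ x
    ut (zero ▸ a) = refl

-- The fixed points form the hole. They share the label n, so that no pair of them has to be
-- covered.
module WithHole (m-1 c f : ℕ) where
  m n : ℕ
  m = suc m-1
  n = c * m
  to from : ℕ × ℕ → ℕ × ℕ
  to (o , a) = if o <ᵇ c then (0 , o * m + a) else (1 , (o ∸ c))
  from (g , x) = if g ≡ᵇ 0 then (x / m , x % m) else (c + x , 0)
  lab : ℕ × ℕ → ℕ
  lab (g , x) = if g ≡ᵇ 0 then x else n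
  open Checked m-1 c f 2 (λ g → if g ≡ᵇ 0 then n else f) to from lab (rotate c m-1) public

  holey : ∀ {b-1} (rows : Vec Row (suc b-1)) → passes rows ≡ true → bijective ≡ true → Design (Fin n ⊎ Fin f) (Holed (Fin n) f)
  holey rows ok bij = relabel (mk↔ₛ′ t u tu ut) into back (labelled rows ok bij)
    where
    P : Set
    P = Pts 2 (λ g → if g ≡ᵇ 0 then n else f)
    t : P → Fin n ⊎ Fin f
    t (zero ▸ a)     = inj₁ a
    t (suc zero ▸ a) = inj₂ a
    u : Fin n ⊎ Fin f → P
    u (inj₁ a) = zero ▸ a
    u (inj₂ a) = suc zero ▸ a
    tu : ∀ y → t (u y) ≡ y
    tu (inj₁ a) = refl
    tu (inj₂ a) = refl
    ut : ∀ x → u (t x) ≡ x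
    ut (zero ▸ a)     = refl
    ut (suc zero ▸ a) = refl
    into : ∀ {x y} → lab (raw x) ≢ lab (raw y) → Holed (Fin n) f (t x) (t y)
    into {zero ▸ a}     {zero ▸ b}     ne = (λ { refl → ne refl }) , λ { ((_ , ()) , _) }
    into {zero ▸ a}     {suc zero ▸ b} ne = (λ ()) , λ { ((_ , ()) , _) }
    into {suc zero ▸ a} {zero ▸ b}     ne = (λ ()) , λ { (_ , (_ , ())) }
    into {suc zero ▸ a} {suc zero ▸ b} ne = contradiction refl ne
    back : ∀ {x y} → Holed (Fin n) f x y → lab (raw (u x)) ≢ lab (raw (u y))
    back {inj₁ a} {inj₁ b} (ne , _) q = ne (cong inj₁ (FP.toℕ-injective q))
    back {inj₁ a} {inj₂ b} _ q = ℕP.<⇒≢ (FP.toℕ<n a) q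
    back {inj₂ a} {inj₁ b} _ q = ℕP.<⇒≢ (FP.toℕ<n b) (sym q)
    back {inj₂ a} {inj₂ b} (_ , h) q = h ((a , refl) , (b , refl))

-- ℤ/(kg) with the residue classes modulo k as groups.
module Cyclic (k-1 g m-1 : ℕ) where
  k : ℕ
  k = suc k-1
  to from : ℕ × ℕ → ℕ × ℕ
  to (_ , a) = a % k , a / k
  from (i , b) = 0 , b * k + i
  open Checked m-1 1 0 k (λ _ → g) to from proj₁ (rotate 1 k-1) public

-- The coordinate is the group; the fixed points form one more group.
module Levels (m-1 c f : ℕ) where
  m : ℕ
  m = suc m-1
  level-sizes : ℕ → ℕ
  level-sizes g = if g <ᵇ m then c else f
  to from : ℕ × ℕ → ℕ × ℕ
  to (o , a) = if o <ᵇ c then (a , o) else (m , o ∸ c)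
  from (g , b) = if g <ᵇ m then (b , g) else (c + b , 0)
  open Checked m-1 c f (suc m) level-sizes to from proj₁ (rotate 1 m-1) public

-- The five groups are unions of g orbits.
module Orbits (m-1 g-1 : ℕ) where
  m g : ℕ
  m = suc m-1
  g = suc g-1
  to from : ℕ × ℕ → ℕ × ℕ
  to (o , a) = o / g , (o % g) * m + a
  from (i , x) = i * g + x / m , x % m
  open Checked m-1 (5 * g) 0 5 (λ _ → g * m) to from proj₁ id public

  -- A row of the argument is a block B of a design with five groups of size g (the point x of the
  -- group i has the code i g + x) and a shift s, stored as the gap. It is replaced by the base blocks
  -- with the points x of level i b + s i² in the group i, for b ∈ ℤ/m. The shifts separate blocks
  -- that have three or more points in common, since the points (i , i²) are in general position.
  twist : ∀ {B} → Vec Row B → Vec Row (B * m)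
  twist rows = V.concat (V.map (λ r → V.tabulate λ b → spread r (toℕ b)) rows)
    where
    shiftOf : ℕ → ℕ
    shiftOf j = go j rows
      where
      go : ∀ {B} → ℕ → Vec Row B → ℕ
      go j []             = 0
      go zero (r ∷ _)     = Row.gap r
      go (suc j) (_ ∷ rs) = go j rs
    spread : Row → ℕ → Row
    -- The partner has parameters b' and shift s', and Δ = s' - s. Matching levels in the groups t =
    -- i and t = i' requires (b - b') t = Δ t² + gap, with the solution b' = b - Δ (i + i') and gap
    -- = Δ i i'.
    spread (row x₀ x₁ x₂ x₃ x₄ j s p q) b = row (move x₀) (move x₁) (move x₂) (move x₃) (move x₄)
      (j * m + (b + (m ∸ (Δ * (i + i')) % m)) % m) ((Δ * (i * i')) % m) p q
      where
      move : ℕ → ℕ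
      move x = x * m + ((x / g) * b + s * ((x / g) * (x / g))) % m
      groups : Vec ℕ 5
      groups = V.map (_/ g) (x₀ ∷ x₁ ∷ x₂ ∷ x₃ ∷ x₄ ∷ [])
      i i' Δ : ℕ
      i  = V.lookup groups (inject₁ (clamp 3 p))
      i' = V.lookup groups (suc (clamp 3 p))
      Δ  = shiftOf j + (m ∸ s)

-- The base blocks

full21-rows : Vec Row 2
full21-rows =
    row 19 7 20 17 3 1 1 1 3
  ∷ row 13 4 3 19 6 0 20 3 1 ∷ []

full25-rows : Vec Row 5
full25-rows =
    row 11 19 15 2 3 4 10 3 1
  ∷ row 6 12 24 15 1 2 7 0 1
  ∷ row 18 17 11 12 9 3 10 0 2
  ∷ row 15 5 19 20 17 1 4 1 3
  ∷ row 8 5 4 10 15 0 2 1 3 ∷ []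

full31-rows : Vec Row 3
full31-rows =
    row 20 3 0 18 22 2 8 3 3
  ∷ row 18 28 21 27 13 0 24 3 0
  ∷ row 20 2 9 14 10 1 12 1 1 ∷ []

full35-rows : Vec Row 7
full35-rows =
    row 22 30 4 1 28 6 7 0 2
  ∷ row 2 30 31 27 7 4 6 0 0
  ∷ row 8 6 16 29 10 3 7 2 2
  ∷ row 8 23 22 9 27 2 10 2 2
  ∷ row 24 13 34 18 8 1 11 0 0
  ∷ row 10 0 6 9 26 0 5 2 2
  ∷ row 30 20 23 32 15 5 6 3 3 ∷ []

full41-rows : Vec Row 4
full41-rows =
    row 18 19 0 31 25 3 26 1 0
  ∷ row 12 30 4 21 0 2 9 1 1
  ∷ row 38 36 21 31 35 1 32 1 1
  ∷ row 15 34 20 36 23 0 15 0 1 ∷ []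

full45-rows : Vec Row 9
full45-rows =
    row 15 26 13 19 2 3 1 3 3
  ∷ row 32 15 24 29 33 2 18 1 0
  ∷ row 28 19 34 41 22 7 21 1 1
  ∷ row 43 29 41 1 18 0 21 3 3
  ∷ row 11 21 23 13 40 8 20 2 3
  ∷ row 24 2 3 10 23 6 20 1 0
  ∷ row 5 4 20 17 43 5 2 0 1
  ∷ row 39 35 20 28 1 1 6 0 3
  ∷ row 23 19 44 15 25 4 2 3 2 ∷ []

full51-rows : Vec Row 5
full51-rows =
    row 27 28 41 49 10 2 30 2 2
  ∷ row 12 38 18 3 35 4 13 0 2
  ∷ row 15 9 19 11 18 3 24 1 3
  ∷ row 31 18 7 46 36 0 41 0 1
  ∷ row 6 1 25 50 36 1 38 2 0 ∷ []

full55-rows : Vec Row 11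
full55-rows =
    row 51 2 47 13 32 6 10 3 2
  ∷ row 3 34 18 38 52 4 17 3 2
  ∷ row 16 52 5 30 12 8 8 2 3
  ∷ row 53 24 54 3 51 3 6 2 1
  ∷ row 46 38 35 48 7 1 10 2 3
  ∷ row 31 10 23 52 34 9 23 1 2
  ∷ row 5 10 49 3 22 0 17 2 3
  ∷ row 37 27 1 22 38 10 0 1 1
  ∷ row 21 27 34 49 24 2 19 3 2
  ∷ row 17 19 0 14 18 5 4 2 1
  ∷ row 34 1 27 10 33 7 0 1 1 ∷ []

full65-rows : Vec Row 32
full65-rows =
    row 2 3 0 7 42 17 3 2 2
  ∷ row 17 28 43 37 38 9 5 1 0
  ∷ row 49 20 29 11 32 26 10 3 2
  ∷ row 17 52 12 21 54 8 11 0 3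
  ∷ row 11 27 54 58 29 10 12 1 2
  ∷ row 60 17 10 55 41 21 3 2 0
  ∷ row 54 52 16 49 8 29 12 1 0
  ∷ row 60 63 26 59 39 14 5 1 0
  ∷ row 47 40 37 54 19 3 2 3 0
  ∷ row 51 36 15 13 9 1 8 0 1
  ∷ row 9 58 55 28 36 4 1 2 1
  ∷ row 63 8 22 56 23 30 11 2 2
  ∷ row 29 22 17 47 7 13 10 1 3
  ∷ row 34 8 18 20 25 12 3 3 1
  ∷ row 34 58 27 4 41 7 8 0 1
  ∷ row 48 26 24 43 64 31 2 1 1
  ∷ row 50 42 15 44 54 28 9 3 3
  ∷ row 53 2 4 10 40 0 10 2 2
  ∷ row 50 11 63 24 37 24 12 1 3
  ∷ row 16 26 51 2 30 22 0 3 0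
  ∷ row 45 44 13 0 41 25 3 1 1
  ∷ row 52 7 32 37 40 5 10 0 2
  ∷ row 30 2 37 52 53 19 0 0 3
  ∷ row 18 35 45 34 2 27 0 0 0
  ∷ row 45 46 49 64 12 18 1 3 1
  ∷ row 43 23 41 52 29 20 10 1 1
  ∷ row 2 11 35 1 22 2 3 2 3
  ∷ row 35 18 41 6 24 23 0 0 0
  ∷ row 26 1 37 58 48 16 4 3 3
  ∷ row 17 53 6 60 51 6 1 0 1
  ∷ row 53 5 58 24 21 11 2 2 2
  ∷ row 19 22 37 18 63 15 11 1 1 ∷ []

full71-rows : Vec Row 7
full71-rows =
    row 70 40 61 30 35 1 67 0 2
  ∷ row 30 47 44 3 50 0 4 2 0
  ∷ row 41 24 63 67 52 3 16 2 1
  ∷ row 67 51 47 14 49 4 60 0 3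
  ∷ row 69 55 70 62 7 2 3 1 3
  ∷ row 11 24 43 5 53 6 28 0 1
  ∷ row 17 67 54 42 66 5 43 1 0 ∷ []

full75-rows : Vec Row 15
full75-rows =
    row 66 42 23 37 65 2 5 0 1
  ∷ row 62 16 74 59 23 12 35 0 1
  ∷ row 1 37 61 14 6 0 32 1 0
  ∷ row 47 12 53 31 3 4 8 1 1
  ∷ row 5 45 4 0 70 6 31 2 1
  ∷ row 44 10 54 30 24 11 7 0 2
  ∷ row 68 6 10 69 36 3 16 2 2
  ∷ row 52 69 71 37 41 13 4 1 2
  ∷ row 35 8 33 14 45 9 26 1 2
  ∷ row 61 45 7 19 57 8 11 2 1
  ∷ row 32 50 35 22 43 14 33 1 3
  ∷ row 18 43 3 37 57 5 30 2 0
  ∷ row 7 18 64 15 42 1 2 1 0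
  ∷ row 38 49 67 65 1 7 33 2 1
  ∷ row 1 22 24 2 54 10 4 3 1 ∷ []

full95-rows : Vec Row 47
full95-rows =
    row 7 19 43 21 73 46 14 1 3
  ∷ row 36 94 9 64 10 9 10 2 3
  ∷ row 81 1 69 54 38 27 18 2 3
  ∷ row 39 59 52 2 48 6 13 3 1
  ∷ row 37 29 45 35 90 35 6 1 3
  ∷ row 85 76 77 58 89 30 14 1 2
  ∷ row 72 54 8 90 40 3 6 1 3
  ∷ row 69 9 3 90 19 43 13 3 3
  ∷ row 84 17 3 42 82 36 16 1 3
  ∷ row 29 93 11 73 18 33 4 2 2
  ∷ row 53 12 70 23 1 14 16 1 0
  ∷ row 20 4 63 76 29 16 17 2 1
  ∷ row 19 17 52 59 35 31 2 1 3
  ∷ row 45 77 92 36 70 17 18 0 0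
  ∷ row 73 15 44 81 46 10 3 0 1
  ∷ row 37 33 32 50 80 26 12 2 1
  ∷ row 43 78 65 35 61 11 2 1 2
  ∷ row 78 46 25 10 33 13 1 0 0
  ∷ row 19 0 65 69 75 42 5 1 1
  ∷ row 67 76 16 39 46 40 14 2 1
  ∷ row 58 44 5 52 83 28 11 0 0
  ∷ row 82 6 59 57 73 34 5 3 2
  ∷ row 40 63 86 15 41 45 16 2 2
  ∷ row 57 17 30 13 90 25 11 2 2
  ∷ row 1 58 39 20 77 32 14 3 3
  ∷ row 25 73 2 19 88 23 8 2 2
  ∷ row 93 38 20 69 59 15 7 1 2
  ∷ row 32 41 38 55 70 2 1 3 2
  ∷ row 52 66 76 60 21 20 8 0 0
  ∷ row 84 50 35 36 7 44 13 0 2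
  ∷ row 79 93 82 81 41 5 5 2 1
  ∷ row 28 79 21 50 15 12 17 3 1
  ∷ row 65 66 58 82 25 24 5 3 3
  ∷ row 27 15 69 7 76 1 5 1 3
  ∷ row 69 52 68 71 57 21 14 2 3
  ∷ row 15 37 59 39 23 4 13 3 1
  ∷ row 54 16 3 6 1 8 3 3 1
  ∷ row 6 58 16 21 80 39 16 2 0
  ∷ row 54 41 34 53 45 41 7 1 2
  ∷ row 24 0 89 28 60 37 3 0 2
  ∷ row 91 44 2 77 18 19 5 1 2
  ∷ row 69 1 27 53 13 38 12 2 1
  ∷ row 15 60 14 35 55 18 14 1 1
  ∷ row 48 90 57 25 77 7 6 3 3
  ∷ row 81 60 56 90 31 29 6 2 0
  ∷ row 48 92 18 89 1 22 3 2 2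
  ∷ row 33 87 36 48 24 0 5 3 1 ∷ []

full111-rows : Vec Row 11
full111-rows =
    row 45 60 57 104 77 8 102 0 3
  ∷ row 63 34 98 87 24 6 3 0 0
  ∷ row 54 23 37 59 65 5 38 0 1
  ∷ row 54 57 31 9 22 0 108 0 1
  ∷ row 2 101 11 108 57 9 18 1 3
  ∷ row 46 96 16 8 18 2 73 1 0
  ∷ row 31 60 87 47 27 1 108 0 0
  ∷ row 91 67 10 85 48 10 83 1 2
  ∷ row 103 35 61 69 54 3 4 1 1
  ∷ row 34 18 79 104 83 4 93 3 1
  ∷ row 56 97 38 95 96 7 28 2 1 ∷ []

full115-rows : Vec Row 23
full115-rows =
    row 41 110 19 8 49 2 29 1 2
  ∷ row 5 73 85 62 27 12 23 1 0
  ∷ row 9 106 47 81 99 0 28 2 1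
  ∷ row 51 48 92 65 14 22 7 1 1
  ∷ row 104 4 48 106 57 6 7 1 0
  ∷ row 110 95 94 101 6 8 4 1 0
  ∷ row 41 54 18 50 36 4 50 0 1
  ∷ row 48 24 73 94 55 9 3 3 2
  ∷ row 90 91 24 14 7 5 53 0 1
  ∷ row 3 58 52 91 81 7 54 2 3
  ∷ row 52 103 70 99 6 14 22 2 2
  ∷ row 64 81 2 67 86 15 16 3 2
  ∷ row 62 107 111 54 13 1 34 0 1
  ∷ row 76 6 16 4 89 17 33 2 0
  ∷ row 0 94 77 105 25 10 35 2 2
  ∷ row 113 111 70 108 40 11 41 2 3
  ∷ row 52 76 114 112 22 21 55 0 3
  ∷ row 28 40 82 0 107 19 45 3 1
  ∷ row 47 38 53 52 32 20 47 2 0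
  ∷ row 43 62 12 99 14 13 10 3 3
  ∷ row 5 6 9 98 68 18 10 0 2
  ∷ row 109 35 96 78 54 16 2 3 0
  ∷ row 70 85 41 105 79 3 50 1 1 ∷ []

full131-rows : Vec Row 13
full131-rows =
    row 48 63 47 49 60 2 87 0 1
  ∷ row 37 103 86 43 32 6 76 0 3
  ∷ row 73 107 92 54 50 0 44 1 0
  ∷ row 55 116 94 130 16 1 44 3 1
  ∷ row 66 92 120 56 74 5 117 0 3
  ∷ row 82 130 8 106 80 4 14 3 0
  ∷ row 72 117 88 27 92 3 103 2 0
  ∷ row 0 21 51 43 80 10 120 0 1
  ∷ row 58 9 85 65 127 11 117 1 2
  ∷ row 111 76 116 48 18 12 11 1 1
  ∷ row 63 32 11 57 115 7 11 1 0
  ∷ row 64 55 99 23 87 8 14 2 1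
  ∷ row 55 105 65 58 21 9 120 1 1 ∷ []

full191-rows : Vec Row 19
full191-rows =
    row 178 63 8 164 154 11 181 0 0
  ∷ row 75 149 7 86 173 10 55 1 2
  ∷ row 81 14 53 111 78 18 167 1 3
  ∷ row 160 90 74 40 158 9 39 0 1
  ∷ row 13 132 164 167 86 14 148 0 0
  ∷ row 77 3 129 50 110 7 182 1 2
  ∷ row 176 23 11 80 67 15 90 3 3
  ∷ row 110 109 138 12 49 5 9 2 1
  ∷ row 82 71 62 105 64 17 72 2 3
  ∷ row 150 51 121 128 59 3 152 1 0
  ∷ row 93 8 143 94 112 1 136 2 1
  ∷ row 73 188 113 77 158 0 10 0 0
  ∷ row 64 130 38 126 79 16 19 2 2
  ∷ row 168 36 185 147 4 6 162 2 0
  ∷ row 175 56 117 4 131 4 43 0 0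
  ∷ row 114 43 126 168 181 13 132 2 1
  ∷ row 101 164 107 19 24 12 172 2 2
  ∷ row 92 38 128 33 181 8 119 3 2
  ∷ row 61 46 55 77 38 2 24 3 1 ∷ []

-- A single base block multiplied by the powers of 260, an element of order 31 modulo 311. The
-- partner of a row lies two powers back, and the gaps are multiplied along.
full311-rows : Vec Row 31
full311-rows =
    row 0 195 117 145 220 29 188 3 1
  ∷ row 0 7 253 69 287 30 53 3 1
  ∷ row 0 265 159 213 291 0 96 3 1
  ∷ row 0 169 288 22 87 1 80 3 1
  ∷ row 0 89 240 122 228 2 274 3 1
  ∷ row 0 126 200 309 190 3 21 3 1
  ∷ row 0 105 63 102 262 4 173 3 1
  ∷ row 0 243 208 85 11 5 196 3 1
  ∷ row 0 47 277 19 61 6 267 3 1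
  ∷ row 0 91 179 275 310 7 67 3 1
  ∷ row 0 24 201 281 51 8 4 3 1
  ∷ row 0 20 12 286 198 9 107 3 1
  ∷ row 0 224 10 31 165 10 141 3 1
  ∷ row 0 83 112 285 293 11 273 3 1
  ∷ row 0 121 197 82 296 12 72 3 1
  ∷ row 0 49 216 172 143 13 60 3 1
  ∷ row 0 300 180 247 171 14 50 3 1
  ∷ row 0 250 150 154 298 15 249 3 1
  ∷ row 0 1 125 232 41 16 52 3 1
  ∷ row 0 260 156 297 86 17 147 3 1
  ∷ row 0 113 130 92 279 18 278 3 1
  ∷ row 0 146 212 284 77 19 128 3 1
  ∷ row 0 18 73 133 116 20 3 3 1
  ∷ row 0 15 9 59 304 21 158 3 1
  ∷ row 0 168 163 101 46 22 28 3 1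
  ∷ row 0 140 84 136 142 23 127 3 1
  ∷ row 0 13 70 217 222 24 54 3 1
  ∷ row 0 270 162 129 185 25 45 3 1
  ∷ row 0 225 135 263 206 26 193 3 1
  ∷ row 0 32 268 271 68 27 109 3 1
  ∷ row 0 234 16 174 264 28 39 3 1 ∷ []

-- Here and in the next table m = 1: the group is trivial and every block is listed.
holed31-rows : Vec Row 91
holed31-rows =
    row 24 22 9 29 2 28 0 3 3
  ∷ row 8 26 15 7 5 40 0 1 2
  ∷ row 3 1 0 13 29 60 0 3 3
  ∷ row 3 14 19 21 28 57 0 0 2
  ∷ row 0 12 4 2 28 66 0 0 2
  ∷ row 12 9 21 3 15 16 0 3 2
  ∷ row 7 17 22 25 26 78 0 1 3
  ∷ row 18 6 1 26 20 89 0 1 2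
  ∷ row 28 25 9 19 24 48 0 0 0
  ∷ row 5 6 29 18 8 76 0 3 2
  ∷ row 21 29 20 14 17 81 0 0 2
  ∷ row 8 0 9 1 22 62 0 0 3
  ∷ row 11 14 15 20 9 80 0 3 1
  ∷ row 5 14 11 10 26 30 0 3 2
  ∷ row 16 3 22 18 12 46 0 3 1
  ∷ row 22 13 4 5 16 54 0 3 3
  ∷ row 22 28 15 3 8 5 0 2 3
  ∷ row 19 20 11 8 2 84 0 3 2
  ∷ row 9 0 18 25 11 38 0 1 0
  ∷ row 27 24 23 15 12 26 0 0 1
  ∷ row 19 17 23 4 13 82 0 1 0
  ∷ row 16 29 9 4 23 68 0 0 0
  ∷ row 15 2 25 6 13 51 0 0 1
  ∷ row 24 0 30 17 5 39 0 1 1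
  ∷ row 26 12 17 1 24 74 0 3 1
  ∷ row 20 29 25 5 15 10 0 0 1
  ∷ row 4 24 27 14 25 19 0 1 0
  ∷ row 20 3 6 4 7 58 0 1 0
  ∷ row 7 23 10 2 29 0 0 3 3
  ∷ row 15 4 29 10 22 64 0 3 2
  ∷ row 2 0 26 10 3 13 0 2 3
  ∷ row 24 26 4 21 6 35 0 3 2
  ∷ row 27 5 13 0 21 87 0 0 2
  ∷ row 21 26 18 13 9 55 0 3 2
  ∷ row 2 23 1 5 9 53 0 3 0
  ∷ row 16 30 6 21 25 31 0 2 3
  ∷ row 23 26 22 11 19 65 0 0 2
  ∷ row 14 1 2 30 4 79 0 2 1
  ∷ row 18 0 15 14 24 18 0 0 1
  ∷ row 11 30 0 23 16 23 0 1 1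
  ∷ row 19 16 15 26 0 1 0 2 1
  ∷ row 10 8 25 4 17 72 0 0 2
  ∷ row 10 6 15 23 28 43 0 0 1
  ∷ row 12 6 10 11 27 42 0 1 0
  ∷ row 1 8 28 23 21 85 0 3 2
  ∷ row 16 20 1 19 10 56 0 2 1
  ∷ row 14 12 18 23 7 14 0 1 3
  ∷ row 7 13 28 11 12 50 0 1 3
  ∷ row 25 28 10 20 0 8 0 0 0
  ∷ row 17 8 12 20 30 61 0 3 3
  ∷ row 24 20 16 28 13 47 0 3 1
  ∷ row 17 2 15 21 11 22 0 1 0
  ∷ row 13 2 20 27 18 59 0 2 3
  ∷ row 9 5 17 28 7 34 0 0 3
  ∷ row 10 21 12 16 5 15 0 3 3
  ∷ row 30 10 9 13 14 33 0 2 3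
  ∷ row 5 19 1 12 25 45 0 1 2
  ∷ row 25 7 14 3 16 3 0 2 0
  ∷ row 6 3 5 2 24 27 0 0 1
  ∷ row 22 0 7 27 20 52 0 3 2
  ∷ row 12 14 8 29 13 2 0 3 3
  ∷ row 5 23 3 30 20 49 0 3 3
  ∷ row 7 21 4 0 8 11 0 3 0
  ∷ row 30 8 24 3 11 69 0 3 3
  ∷ row 18 21 22 10 30 29 0 2 3
  ∷ row 13 3 26 23 25 36 0 2 0
  ∷ row 29 6 12 0 19 4 0 2 0
  ∷ row 4 15 30 18 19 73 0 3 1
  ∷ row 29 16 11 7 24 21 0 0 0
  ∷ row 27 4 1 11 3 63 0 3 3
  ∷ row 3 17 27 9 10 86 0 2 0
  ∷ row 13 30 7 1 15 75 0 3 0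
  ∷ row 13 24 8 10 19 41 0 2 0
  ∷ row 17 19 18 29 3 67 0 1 3
  ∷ row 10 24 1 7 18 24 0 1 3
  ∷ row 15 1 16 27 17 71 0 0 3
  ∷ row 25 23 8 18 27 9 0 2 3
  ∷ row 19 7 6 9 30 90 0 0 3
  ∷ row 11 13 6 22 17 6 0 3 1
  ∷ row 25 30 2 12 22 37 0 1 2
  ∷ row 4 9 20 12 26 12 0 1 3
  ∷ row 11 25 29 21 1 25 0 1 1
  ∷ row 23 17 14 0 6 20 0 0 1
  ∷ row 18 28 2 17 16 88 0 0 1
  ∷ row 26 16 2 8 14 17 0 2 3
  ∷ row 20 22 21 23 24 44 0 2 3
  ∷ row 9 27 8 6 16 70 0 0 2
  ∷ row 19 14 5 27 22 32 0 2 0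
  ∷ row 11 28 18 5 4 83 0 1 0
  ∷ row 28 22 1 6 14 7 0 2 1
  ∷ row 21 27 2 7 19 77 0 3 0 ∷ []

holed35-rows : Vec Row 117
holed35-rows =
    row 5 9 6 8 7 59 0 3 1
  ∷ row 2 0 1 3 4 62 0 3 2
  ∷ row 2 26 21 7 33 26 0 2 1
  ∷ row 22 27 34 3 8 16 0 0 2
  ∷ row 31 0 29 5 24 18 0 1 1
  ∷ row 4 30 9 23 28 23 0 1 1
  ∷ row 20 6 25 32 1 55 0 2 1
  ∷ row 14 19 31 8 3 12 0 0 3
  ∷ row 5 0 16 11 33 116 0 1 1
  ∷ row 7 13 2 18 30 84 0 1 2
  ∷ row 9 15 4 32 10 80 0 0 1
  ∷ row 34 1 6 17 12 24 0 0 1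
  ∷ row 24 29 32 19 14 7 0 3 0
  ∷ row 25 20 33 10 15 79 0 2 2
  ∷ row 18 28 13 31 23 42 0 0 3
  ∷ row 21 34 11 26 16 74 0 2 3
  ∷ row 30 12 27 22 17 3 0 2 0
  ∷ row 1 32 23 16 9 6 0 0 3
  ∷ row 33 29 0 12 7 4 0 1 1
  ∷ row 8 22 15 0 31 98 0 2 3
  ∷ row 5 3 10 31 27 114 0 2 0
  ∷ row 33 24 17 5 2 56 0 0 0
  ∷ row 28 32 6 11 4 87 0 3 2
  ∷ row 14 9 30 26 2 5 0 1 1
  ∷ row 8 1 34 13 25 11 0 1 0
  ∷ row 3 6 18 34 20 51 0 3 2
  ∷ row 30 7 21 19 4 2 0 1 2
  ∷ row 30 18 11 8 10 64 0 3 2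
  ∷ row 16 31 4 14 17 86 0 0 1
  ∷ row 15 19 12 2 34 96 0 0 2
  ∷ row 10 18 17 32 0 77 0 2 3
  ∷ row 30 15 16 3 13 92 0 1 1
  ∷ row 14 33 6 13 16 66 0 2 2
  ∷ row 12 9 11 31 19 88 0 0 0
  ∷ row 5 13 32 12 15 85 0 2 3
  ∷ row 19 33 11 1 18 99 0 0 2
  ∷ row 7 17 14 34 10 78 0 2 3
  ∷ row 18 16 25 12 26 101 0 2 2
  ∷ row 29 15 17 11 25 81 0 1 0
  ∷ row 19 29 28 10 16 76 0 1 3
  ∷ row 12 24 16 10 20 97 0 1 1
  ∷ row 21 22 12 18 14 73 0 0 1
  ∷ row 15 14 27 28 18 14 0 3 0
  ∷ row 13 17 19 26 27 46 0 0 2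
  ∷ row 10 19 23 22 13 83 0 1 3
  ∷ row 14 24 11 15 23 93 0 1 2
  ∷ row 11 20 17 13 21 43 0 2 0
  ∷ row 32 28 20 22 2 65 0 3 2
  ∷ row 29 33 21 3 23 102 0 2 3
  ∷ row 24 4 25 34 22 75 0 1 1
  ∷ row 26 0 20 23 30 63 0 1 3
  ∷ row 29 9 20 34 27 25 0 2 3
  ∷ row 1 21 24 27 31 69 0 2 2
  ∷ row 26 29 6 31 22 104 0 0 1
  ∷ row 28 21 5 30 25 72 0 1 2
  ∷ row 23 32 25 27 7 17 0 0 1
  ∷ row 24 33 8 28 26 21 0 0 0
  ∷ row 2 19 25 6 5 110 0 1 1
  ∷ row 7 6 3 15 26 112 0 3 2
  ∷ row 4 7 8 16 27 0 0 1 3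
  ∷ row 0 17 28 8 9 109 0 1 0
  ∷ row 9 18 5 1 29 82 0 3 2
  ∷ row 23 12 4 3 5 1 0 2 3
  ∷ row 14 7 1 20 0 50 0 3 1
  ∷ row 21 1 10 8 2 27 0 2 3
  ∷ row 11 3 2 22 9 47 0 2 3
  ∷ row 4 24 13 6 0 32 0 2 2
  ∷ row 25 23 8 18 24 113 0 1 1
  ∷ row 20 26 19 24 9 111 0 3 3
  ∷ row 2 28 27 24 12 52 0 2 2
  ∷ row 0 22 26 10 25 106 0 2 0
  ∷ row 17 22 7 23 29 108 0 1 0
  ∷ row 27 15 5 21 20 54 0 2 1
  ∷ row 16 22 21 6 28 41 0 1 0
  ∷ row 27 23 1 26 11 15 0 3 2
  ∷ row 14 25 4 21 29 49 0 1 1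
  ∷ row 13 20 3 28 29 39 0 3 1
  ∷ row 8 19 21 32 17 30 0 3 2
  ∷ row 11 28 0 34 14 36 0 3 2
  ∷ row 27 13 10 33 4 13 0 2 2
  ∷ row 18 15 9 33 22 10 0 1 0
  ∷ row 17 15 30 6 24 38 0 0 1
  ∷ row 10 12 29 1 30 61 0 2 3
  ∷ row 16 34 5 23 19 44 0 3 1
  ∷ row 25 31 2 13 11 9 0 2 1
  ∷ row 26 3 14 12 32 34 0 3 2
  ∷ row 20 31 16 18 7 28 0 1 0
  ∷ row 20 8 4 11 12 22 0 2 3
  ∷ row 9 12 0 21 13 33 0 0 0
  ∷ row 5 26 17 4 18 107 0 3 2
  ∷ row 6 2 23 10 14 100 0 1 0
  ∷ row 25 9 3 17 16 105 0 0 2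
  ∷ row 2 16 15 8 29 31 0 1 1
  ∷ row 10 3 11 24 7 45 0 2 1
  ∷ row 13 1 5 14 22 115 0 2 3
  ∷ row 0 18 27 6 19 103 0 2 1
  ∷ row 1 28 19 15 7 29 0 2 0
  ∷ row 22 16 24 30 1 40 0 1 1
  ∷ row 23 34 21 0 15 19 0 3 2
  ∷ row 22 4 33 19 20 35 0 2 0
  ∷ row 23 2 17 31 20 90 0 0 1
  ∷ row 7 31 12 25 28 37 0 2 2
  ∷ row 32 24 18 3 21 48 0 3 2
  ∷ row 11 6 27 30 29 95 0 1 2
  ∷ row 32 29 26 13 8 53 0 1 0
  ∷ row 33 27 9 25 14 91 0 2 0
  ∷ row 10 26 5 34 28 70 0 0 2
  ∷ row 34 29 18 4 2 89 0 2 3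
  ∷ row 7 22 11 32 5 71 0 0 1
  ∷ row 28 17 3 1 33 60 0 0 1
  ∷ row 3 25 19 30 0 57 0 1 1
  ∷ row 13 34 7 9 24 68 0 3 3
  ∷ row 4 31 26 15 1 58 0 2 3
  ∷ row 12 8 23 6 33 67 0 1 1
  ∷ row 31 10 6 21 9 20 0 0 2
  ∷ row 8 30 20 14 5 94 0 3 2
  ∷ row 27 16 0 2 32 8 0 1 1 ∷ []

holed51-rows : Vec Row 11
holed51-rows =
    row 33 12 47 38 10 2 21 0 0
  ∷ row 20 42 46 12 30 6 16 3 0
  ∷ row 14 35 48 38 18 0 2 0 0
  ∷ row 33 4 11 17 24 5 17 1 0
  ∷ row 23 24 31 44 20 10 17 2 3
  ∷ row 17 10 18 20 6 3 6 0 1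
  ∷ row 37 19 50 30 18 1 7 0 3
  ∷ row 13 10 29 41 4 8 15 3 1
  ∷ row 27 12 26 17 44 7 8 1 3
  ∷ row 23 15 49 10 27 9 18 2 1
  ∷ row 12 35 41 27 37 4 6 3 2 ∷ []

gdd10^6-rows : Vec Row 5
gdd10^6-rows =
    row 59 24 7 51 10 2 50 2 3
  ∷ row 8 59 22 48 9 4 47 2 1
  ∷ row 24 2 22 1 17 0 10 3 2
  ∷ row 17 26 22 7 39 1 18 0 0
  ∷ row 28 1 35 3 32 3 56 2 3 ∷ []

gdd10^7-rows : Vec Row 6
gdd10^7-rows =
    row 24 56 6 33 37 5 29 0 2
  ∷ row 29 40 66 58 63 2 51 3 0
  ∷ row 12 7 22 10 55 1 19 0 3
  ∷ row 67 13 19 43 9 4 9 1 1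
  ∷ row 55 10 4 63 54 3 61 1 1
  ∷ row 26 10 27 65 67 0 41 2 0 ∷ []

gdd10^8-rows : Vec Row 7
gdd10^8-rows =
    row 2 36 62 65 47 3 14 0 0
  ∷ row 54 53 74 4 41 4 36 1 3
  ∷ row 36 58 11 17 29 6 23 0 3
  ∷ row 22 68 72 41 66 0 66 0 0
  ∷ row 0 43 15 38 17 5 42 1 1
  ∷ row 46 53 1 42 43 1 69 3 0
  ∷ row 22 79 8 35 13 2 57 3 0 ∷ []

gdd30^7-rows : Vec Row 18
gdd30^7-rows =
    row 49 29 37 172 87 4 178 3 2
  ∷ row 65 110 15 21 167 8 13 1 0
  ∷ row 56 27 18 54 185 9 89 1 1
  ∷ row 166 22 83 35 95 12 75 0 2
  ∷ row 123 33 119 204 139 0 32 2 3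
  ∷ row 80 123 177 124 91 13 67 2 2
  ∷ row 209 121 39 21 204 14 82 1 0
  ∷ row 130 83 122 29 61 10 161 0 2
  ∷ row 2 97 196 102 166 1 197 0 1
  ∷ row 114 139 148 194 88 2 121 1 1
  ∷ row 43 156 132 179 40 7 49 2 0
  ∷ row 94 81 184 112 75 17 124 1 3
  ∷ row 81 153 157 91 156 3 135 2 0
  ∷ row 91 93 57 110 34 5 143 2 2
  ∷ row 167 39 126 8 150 6 128 0 1
  ∷ row 206 89 74 64 126 16 135 1 3
  ∷ row 90 116 204 149 164 15 75 3 1
  ∷ row 30 71 138 60 167 11 86 3 1 ∷ []

gdd30^11-rows : Vec Row 30
gdd30^11-rows =
    row 258 315 149 173 80 21 26 2 2
  ∷ row 306 286 136 17 89 17 153 1 2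
  ∷ row 207 190 149 93 164 27 48 2 3
  ∷ row 163 142 278 281 106 7 54 3 2
  ∷ row 272 188 288 293 311 24 196 2 2
  ∷ row 103 97 129 260 24 10 235 2 2
  ∷ row 170 160 33 111 200 13 231 2 3
  ∷ row 61 97 52 227 280 3 276 2 3
  ∷ row 222 109 249 234 303 23 59 1 2
  ∷ row 193 155 139 190 68 29 317 2 3
  ∷ row 204 247 25 224 144 5 95 2 2
  ∷ row 160 258 19 166 191 18 246 0 0
  ∷ row 90 163 170 1 180 20 91 2 2
  ∷ row 8 208 222 210 132 6 99 3 2
  ∷ row 150 30 26 288 256 16 233 0 2
  ∷ row 42 94 159 168 187 22 157 1 0
  ∷ row 140 188 127 247 87 14 97 2 0
  ∷ row 91 29 313 133 99 1 177 2 1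
  ∷ row 12 244 16 76 62 11 84 0 0
  ∷ row 51 80 266 329 148 25 126 3 3
  ∷ row 17 173 240 79 154 12 239 2 2
  ∷ row 318 276 147 123 73 0 304 2 2
  ∷ row 2 267 176 305 304 15 173 0 1
  ∷ row 132 114 190 50 84 8 271 2 1
  ∷ row 13 209 97 92 184 4 134 2 2
  ∷ row 238 61 30 22 203 19 204 3 3
  ∷ row 227 81 94 190 276 28 156 2 2
  ∷ row 184 0 328 45 101 2 282 3 2
  ∷ row 186 157 34 268 269 26 174 2 2
  ∷ row 18 11 278 203 152 9 13 3 2 ∷ []

gdd45^7-rows : Vec Row 27
gdd45^7-rows =
    row 109 134 97 304 226 17 49 2 2
  ∷ row 137 287 215 164 27 8 53 1 2
  ∷ row 258 183 299 252 184 18 111 0 2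
  ∷ row 5 9 4 104 238 6 59 1 1
  ∷ row 193 182 199 272 44 23 190 1 1
  ∷ row 46 49 79 255 232 9 144 3 3
  ∷ row 109 260 265 138 206 3 256 1 1
  ∷ row 156 280 117 10 232 10 46 1 1
  ∷ row 21 69 162 234 5 1 262 2 1
  ∷ row 8 143 289 88 111 5 171 3 3
  ∷ row 7 71 234 90 291 7 269 1 1
  ∷ row 0 13 215 225 11 13 209 2 2
  ∷ row 119 179 250 23 90 22 200 0 2
  ∷ row 36 159 16 6 18 11 106 2 2
  ∷ row 123 82 212 176 132 26 55 2 1
  ∷ row 225 94 54 179 233 25 306 2 1
  ∷ row 142 248 81 14 118 12 306 2 3
  ∷ row 312 135 255 48 161 0 266 2 2
  ∷ row 155 265 72 147 283 2 204 2 0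
  ∷ row 308 8 304 54 32 20 263 0 3
  ∷ row 98 118 1 60 45 19 52 3 0
  ∷ row 18 127 65 167 56 24 80 1 1
  ∷ row 152 127 294 234 100 16 46 1 1
  ∷ row 35 9 307 274 208 4 125 1 1
  ∷ row 266 300 47 165 297 21 235 1 1
  ∷ row 31 188 63 18 254 15 9 1 2
  ∷ row 105 121 157 36 179 14 260 1 2 ∷ []

gdd21^11-rows : Vec Row 21
gdd21^11-rows =
    row 29 129 35 80 99 1 215 0 0
  ∷ row 145 45 158 80 119 0 16 0 0
  ∷ row 177 91 189 29 81 18 185 2 0
  ∷ row 96 100 71 37 176 8 220 1 3
  ∷ row 194 173 230 199 127 15 188 2 3
  ∷ row 2 23 124 217 164 20 25 3 3
  ∷ row 122 172 43 81 115 19 74 0 0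
  ∷ row 89 138 130 90 184 13 45 1 1
  ∷ row 3 64 120 82 111 3 11 3 1
  ∷ row 67 230 16 149 91 2 58 2 1
  ∷ row 89 61 219 104 207 16 36 0 2
  ∷ row 205 192 108 47 110 17 137 1 0
  ∷ row 191 27 216 8 89 14 157 1 2
  ∷ row 227 85 93 204 33 7 186 1 1
  ∷ row 181 184 59 101 166 12 74 2 1
  ∷ row 47 46 56 11 42 4 43 3 2
  ∷ row 142 169 25 53 149 10 195 2 0
  ∷ row 202 55 222 49 175 11 94 0 1
  ∷ row 75 4 165 89 72 9 73 3 1
  ∷ row 98 48 225 223 24 6 157 0 0
  ∷ row 123 80 48 139 192 5 206 3 3 ∷ []

gdd10^5,4-rows : Vec Row 48
gdd10^5,4-rows =
    row 12 29 46 43 50 10 1 3 0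
  ∷ row 37 31 34 33 25 25 0 0 1
  ∷ row 1 2 5 4 48 6 2 2 2
  ∷ row 46 38 4 10 37 36 3 0 1
  ∷ row 32 24 45 23 6 14 1 3 1
  ∷ row 53 8 35 42 21 27 4 2 1
  ∷ row 40 6 2 8 9 2 3 2 2
  ∷ row 35 23 7 50 4 40 2 0 0
  ∷ row 17 31 0 50 39 19 4 1 0
  ∷ row 51 2 45 26 24 18 0 1 2
  ∷ row 50 42 26 23 9 0 4 0 3
  ∷ row 15 26 2 43 44 15 0 0 3
  ∷ row 48 49 42 46 30 37 0 3 0
  ∷ row 40 26 17 34 18 39 0 2 0
  ∷ row 6 5 22 33 19 4 4 1 3
  ∷ row 9 48 37 26 15 11 0 3 0
  ∷ row 14 6 10 18 12 42 1 1 3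
  ∷ row 44 22 46 15 51 32 3 2 1
  ∷ row 53 31 45 2 18 9 0 2 1
  ∷ row 1 32 20 44 13 8 1 0 1
  ∷ row 27 11 23 29 25 31 4 2 3
  ∷ row 20 12 41 4 33 33 3 1 1
  ∷ row 4 27 43 35 26 38 4 3 1
  ∷ row 41 44 35 47 43 34 0 1 3
  ∷ row 52 49 21 3 15 44 4 2 1
  ∷ row 24 31 37 38 35 1 0 1 0
  ∷ row 12 38 11 49 20 29 2 2 3
  ∷ row 51 43 36 17 10 5 1 1 2
  ∷ row 11 33 22 44 0 35 4 0 1
  ∷ row 6 20 48 47 14 26 3 3 2
  ∷ row 25 4 12 36 3 43 0 0 1
  ∷ row 18 21 22 25 24 20 1 3 2
  ∷ row 29 17 48 5 36 17 2 1 2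
  ∷ row 7 43 14 53 25 21 2 1 1
  ∷ row 12 6 52 35 44 23 0 3 1
  ∷ row 36 34 12 51 5 28 1 1 0
  ∷ row 19 35 48 6 27 3 2 1 0
  ∷ row 30 46 28 53 14 12 0 0 3
  ∷ row 18 27 36 45 9 22 1 1 3
  ∷ row 34 17 6 30 43 13 0 0 2
  ∷ row 21 38 17 44 52 7 3 0 0
  ∷ row 17 13 1 15 19 46 2 2 1
  ∷ row 52 26 32 14 5 16 4 3 1
  ∷ row 6 4 25 51 32 30 0 1 0
  ∷ row 40 4 22 13 31 24 1 1 2
  ∷ row 50 17 14 33 45 47 0 3 1
  ∷ row 36 18 4 20 53 41 3 1 2
  ∷ row 29 45 33 1 52 45 0 1 3 ∷ []

gdd10^7,4-rows : Vec Row 68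
gdd10^7,4-rows =
    row 11 7 61 51 38 66 4 3 1
  ∷ row 50 48 9 21 26 22 6 3 2
  ∷ row 29 17 7 37 32 48 6 2 1
  ∷ row 21 30 3 13 5 37 2 1 0
  ∷ row 22 38 19 0 71 16 3 1 2
  ∷ row 26 58 66 8 53 19 2 3 2
  ∷ row 47 36 53 38 28 15 4 3 1
  ∷ row 30 39 59 28 64 63 2 3 2
  ∷ row 16 67 42 20 5 38 4 0 3
  ∷ row 39 7 22 47 23 43 6 3 1
  ∷ row 24 32 49 69 23 53 0 0 1
  ∷ row 4 37 38 62 42 67 3 0 0
  ∷ row 69 9 28 71 66 54 4 1 0
  ∷ row 18 57 72 31 5 44 0 1 0
  ∷ row 24 53 58 21 36 62 1 2 2
  ∷ row 71 31 41 50 0 6 3 1 3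
  ∷ row 53 54 16 35 50 4 4 2 1
  ∷ row 9 61 67 55 8 45 2 0 2
  ∷ row 66 70 68 1 21 42 2 2 1
  ∷ row 19 43 51 13 17 5 5 2 3
  ∷ row 51 61 70 57 53 47 1 3 0
  ∷ row 45 11 40 62 64 26 2 1 2
  ∷ row 9 4 27 22 33 1 1 2 3
  ∷ row 66 73 29 41 23 25 6 3 3
  ∷ row 26 36 39 69 45 27 4 3 1
  ∷ row 5 36 20 24 35 23 1 3 3
  ∷ row 12 34 38 9 18 21 5 2 1
  ∷ row 54 48 65 38 1 24 3 1 3
  ∷ row 20 22 53 45 63 61 2 0 2
  ∷ row 63 8 61 13 18 60 2 2 0
  ∷ row 66 34 50 33 58 55 5 3 2
  ∷ row 15 17 60 63 44 46 3 2 3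
  ∷ row 21 59 1 73 61 51 4 2 0
  ∷ row 1 33 66 60 51 50 0 3 2
  ∷ row 0 64 3 44 54 40 4 2 0
  ∷ row 69 25 51 47 21 39 4 2 0
  ∷ row 29 48 59 30 25 64 4 1 3
  ∷ row 1 28 25 12 72 3 5 0 1
  ∷ row 69 36 72 63 19 8 3 3 0
  ∷ row 43 54 72 52 42 35 3 0 2
  ∷ row 47 6 52 4 30 34 3 0 2
  ∷ row 47 56 71 48 60 52 1 3 0
  ∷ row 51 6 66 0 12 18 5 1 2
  ∷ row 2 24 48 63 68 9 1 1 3
  ∷ row 72 57 40 25 13 13 0 0 1
  ∷ row 23 19 59 7 15 17 5 2 0
  ∷ row 68 38 20 67 57 31 4 3 2
  ∷ row 52 56 29 16 33 20 6 0 3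
  ∷ row 13 38 8 49 2 2 1 1 2
  ∷ row 54 71 27 14 10 56 2 2 3
  ∷ row 6 3 51 60 19 33 0 2 3
  ∷ row 73 4 14 12 66 32 3 0 2
  ∷ row 59 47 63 41 39 41 6 0 3
  ∷ row 16 32 24 34 54 10 0 1 0
  ∷ row 31 12 44 73 48 12 3 0 1
  ∷ row 5 37 60 28 41 30 2 2 3
  ∷ row 43 58 20 19 25 49 5 3 2
  ∷ row 44 28 6 5 17 58 5 0 1
  ∷ row 43 30 46 48 10 57 2 1 0
  ∷ row 27 47 32 15 70 65 0 3 0
  ∷ row 11 59 12 2 42 29 5 0 2
  ∷ row 17 40 27 18 1 28 5 2 0
  ∷ row 58 56 27 57 3 14 6 2 2
  ∷ row 53 10 69 33 65 7 5 2 3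
  ∷ row 67 29 14 62 44 36 3 3 1
  ∷ row 70 15 40 7 34 59 0 0 3
  ∷ row 17 41 54 73 53 0 3 1 3
  ∷ row 41 1 10 70 44 11 4 0 0 ∷ []

gdd6^5,8-rows : Vec Row 24
gdd6^5,8-rows =
    row 13 29 21 17 34 1 0 0 0
  ∷ row 29 13 36 12 26 0 0 0 0
  ∷ row 26 37 22 13 15 20 4 1 1
  ∷ row 4 15 12 8 33 17 2 1 1
  ∷ row 17 0 36 1 19 22 4 3 0
  ∷ row 10 30 27 21 13 8 0 2 3
  ∷ row 28 33 29 7 0 21 0 2 3
  ∷ row 17 35 26 18 24 9 4 2 3
  ∷ row 3 34 0 21 27 5 0 3 2
  ∷ row 16 28 31 19 27 7 1 3 2
  ∷ row 9 23 36 22 6 12 0 3 3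
  ∷ row 20 29 3 6 35 23 1 1 1
  ∷ row 0 24 31 6 22 10 0 3 3
  ∷ row 5 34 19 6 12 14 3 2 3
  ∷ row 5 17 30 8 16 13 2 3 2
  ∷ row 8 11 31 0 12 16 1 0 2
  ∷ row 13 35 10 7 1 15 4 2 0
  ∷ row 21 10 18 32 22 3 3 1 1
  ∷ row 4 32 10 16 2 19 1 2 2
  ∷ row 21 33 15 14 23 18 4 2 2
  ∷ row 6 23 37 2 25 2 1 1 1
  ∷ row 8 26 32 7 29 6 0 3 2
  ∷ row 15 2 11 37 9 4 1 0 3
  ∷ row 20 2 28 30 1 11 4 1 1 ∷ []

-- The smallest seed for `twist`: one block in both orders, with the shifts 0 and 1. The seeds below
-- have groups of size 2 and 3.
td1-rows : Vec Row 2
td1-rows =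
    row 0 1 2 3 4 1 0 0 3
  ∷ row 4 3 2 1 0 0 1 3 0 ∷ []

td2-rows : Vec Row 8
td2-rows =
    row 2 6 4 9 0 2 0 0 2
  ∷ row 3 1 9 4 7 4 0 3 2
  ∷ row 9 1 6 2 5 0 1 2 0
  ∷ row 3 8 0 5 6 6 0 2 1
  ∷ row 0 8 7 4 2 1 1 2 3
  ∷ row 4 6 8 1 3 7 1 2 3
  ∷ row 7 5 0 9 3 3 1 1 2
  ∷ row 5 2 7 1 8 5 0 3 2 ∷ []

td3-rows : Vec Row 18
td3-rows =
    row 8 13 5 9 0 14 0 3 2
  ∷ row 1 8 4 10 12 5 0 0 3
  ∷ row 10 14 8 2 3 12 0 0 0
  ∷ row 2 4 9 13 6 15 0 0 2
  ∷ row 0 7 13 3 10 17 0 1 2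
  ∷ row 9 12 3 8 1 1 1 3 0
  ∷ row 2 7 12 11 5 13 0 0 2
  ∷ row 0 5 8 14 11 9 1 3 1
  ∷ row 1 6 3 11 13 16 0 0 0
  ∷ row 4 11 14 1 7 7 0 1 3
  ∷ row 11 3 0 12 6 11 1 3 1
  ∷ row 5 6 12 2 10 10 1 1 3
  ∷ row 14 10 6 4 0 2 0 0 0
  ∷ row 3 9 7 2 14 6 1 2 0
  ∷ row 12 7 0 9 4 0 0 2 3
  ∷ row 13 11 4 2 8 3 1 2 0
  ∷ row 6 1 14 9 5 8 0 0 0
  ∷ row 10 5 13 7 1 4 1 2 1 ∷ []

-- Designs evaluated from the base blocks

abstract

  full21 : Full 21
  full21 = Whole.full 20 1 0 full21-rows refl refl

  full25 : Full 25
  full25 = Whole.full 11 2 1 full25-rows refl refl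

  full31 : Full 31
  full31 = Whole.full 30 1 0 full31-rows refl refl

  full35 : Full 35
  full35 = Whole.full 16 2 1 full35-rows refl refl

  full41 : Full 41
  full41 = Whole.full 40 1 0 full41-rows refl refl

  full45 : Full 45
  full45 = Whole.full 21 2 1 full45-rows refl refl

  full51 : Full 51
  full51 = Whole.full 50 1 0 full51-rows refl refl

  full55 : Full 55
  full55 = Whole.full 26 2 1 full55-rows refl refl

  full65 : Full 65
  full65 = Whole.full 12 5 0 full65-rows refl refl

  full71 : Full 71
  full71 = Whole.full 70 1 0 full71-rows refl refl

  full75 : Full 75
  full75 = Whole.full 36 2 1 full75-rows refl refl

  full95 : Full 95
  full95 = Whole.full 18 5 0 full95-rows refl refl

  full111 : Full 111
  full111 = Whole.full 110 1 0 full111-rows refl refl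

  full115 : Full 115
  full115 = Whole.full 56 2 1 full115-rows refl refl

  full131 : Full 131
  full131 = Whole.full 130 1 0 full131-rows refl refl

  full191 : Full 191
  full191 = Whole.full 190 1 0 full191-rows refl refl

  full311 : Full 311
  full311 = Whole.full 310 1 0 full311-rows refl refl

  holed31 : Design (Fin 26 ⊎ Fin 5) (Holed (Fin 26) 5)
  holed31 = WithHole.holey 0 26 5 holed31-rows refl refl

  holed35 : Design (Fin 30 ⊎ Fin 5) (Holed (Fin 30) 5)
  holed35 = WithHole.holey 0 30 5 holed35-rows refl refl

  holed51 : Design (Fin 46 ⊎ Fin 5) (Holed (Fin 46) 5)
  holed51 = WithHole.holey 22 2 5 holed51-rows refl refl

  gdd10^6 : Labelled 6 (λ _ → 10) proj₁
  gdd10^6 = Cyclic.labelled 5 10 59 gdd10^6-rows refl refl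

  gdd10^7 : Labelled 7 (λ _ → 10) proj₁
  gdd10^7 = Cyclic.labelled 6 10 69 gdd10^7-rows refl refl

  gdd10^8 : Labelled 8 (λ _ → 10) proj₁
  gdd10^8 = Cyclic.labelled 7 10 79 gdd10^8-rows refl refl

  gdd30^7 : Labelled 7 (λ _ → 30) proj₁
  gdd30^7 = Cyclic.labelled 6 30 209 gdd30^7-rows refl refl

  gdd30^11 : Labelled 11 (λ _ → 30) proj₁
  gdd30^11 = Cyclic.labelled 10 30 329 gdd30^11-rows refl refl

  gdd45^7 : Labelled 7 (λ _ → 45) proj₁
  gdd45^7 = Cyclic.labelled 6 45 314 gdd45^7-rows refl refl

  gdd21^11 : Labelled 11 (λ _ → 21) proj₁
  gdd21^11 = Cyclic.labelled 10 21 230 gdd21^11-rows refl refl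

  gdd10^5,4 : Labelled 6 (tens 5 4) proj₁
  gdd10^5,4 = Levels.labelled 4 10 4 gdd10^5,4-rows refl refl

  gdd10^7,4 : Labelled 8 (tens 7 4) proj₁
  gdd10^7,4 = Levels.labelled 6 10 4 gdd10^7,4-rows refl refl

  gdd6^5,8 : Labelled 6 (λ g → if g <ᵇ 5 then 6 else 8) proj₁
  gdd6^5,8 = Levels.labelled 4 6 8 gdd6^5,8-rows refl refl

  td31 : Labelled 5 (λ _ → 31) proj₁
  td31 = Orbits.labelled 30 0 (Orbits.twist 30 0 td1-rows) refl refl

  td35 : Labelled 5 (λ _ → 35) proj₁
  td35 = Orbits.labelled 34 0 (Orbits.twist 34 0 td1-rows) refl refl

  td55 : Labelled 5 (λ _ → 55) proj₁
  td55 = Orbits.labelled 54 0 (Orbits.twist 54 0 td1-rows) refl refl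

  td71 : Labelled 5 (λ _ → 71) proj₁
  td71 = Orbits.labelled 70 0 (Orbits.twist 70 0 td1-rows) refl refl

  td10 : Labelled 5 (λ _ → 10) proj₁
  td10 = Orbits.labelled 4 1 (Orbits.twist 4 1 td2-rows) refl refl

  td26 : Labelled 5 (λ _ → 26) proj₁
  td26 = Orbits.labelled 12 1 (Orbits.twist 12 1 td2-rows) refl refl

  td34 : Labelled 5 (λ _ → 34) proj₁
  td34 = Orbits.labelled 16 1 (Orbits.twist 16 1 td2-rows) refl refl

  td46 : Labelled 5 (λ _ → 46) proj₁
  td46 = Orbits.labelled 22 1 (Orbits.twist 22 1 td2-rows) refl refl

  td51 : Labelled 5 (λ _ → 51) proj₁
  td51 = Orbits.labelled 16 2 (Orbits.twist 16 2 td3-rows) refl refl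

-- The remaining small orders, and the recursion

no-pairs : ∀ {V : Set} {R : V → V → Set} → (∀ {x y} → ¬ R x y) → Design V R
no-pairs none = record
  { Blk = ⊥ ; finite = 0 , mk↔ₛ′ (λ ()) (λ ()) (λ ()) (λ ()) ; pt = λ () ; sound = λ ()
  ; cover = λ r → ⊥-elim (none r)
  ; unique = λ {k} → ⊥-elim k ; simple = λ {k} → ⊥-elim k ; σ = id ; σ-inj = id ; trade = λ () }

grouped : ∀ {K w} → Labelled K w proj₁ → GDD K (λ i → Fin (w (toℕ i)))
grouped = relabel Pts↔Σ (λ ne q → ne (cong toℕ q)) (λ ne q → ne (FP.toℕ-injective q))

-- One full filler covers the pairs among the e extra points, and the other groups leave them out.
-- For e = 5 the design with a hole cannot be cut out of a super-simple design, because the five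
-- points would carry two blocks on the same point set.
fill-equal : ∀ K g e → Labelled (suc K) (λ _ → g) proj₁ → Full (g + e) →
             Design (Fin g ⊎ Fin e) (Holed (Fin g) e) → Full (suc K * g + e)
fill-equal K g e D full hole = subst-Full (cong (_+ e) (sumF-const (suc K) g))
  (≢-on (⊎-Fin e (Σ-Fin (suc K) (λ _ → g))) (fill zero (grouped D) (full-on (proj₂ (finite-Fin g)) refl full) (λ _ _ → hole)))

fill-small : ∀ K g e → e ≤ 1 → Labelled (suc K) (λ _ → g) proj₁ → Full (g + e) → Full (suc K * g + e)
fill-small K g e e≤1 D full = fill-equal K g e D full (holed (full-on (proj₂ (finite-Fin g)) refl full) e≤1)

abstract
  full171 : Full 171
  full171 = fill-small 4 34 1 (s≤s z≤n) td34 full35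

  full231 : Full 231
  full231 = fill-small 10 21 0 z≤n gdd21^11 full21

  full135 : Full 135
  full135 = fill-equal 4 26 5 td26 full31 holed31

  full155 : Full 155
  full155 = fill-small 4 31 0 z≤n td31 full31

  full175 : Full 175
  full175 = fill-small 4 35 0 z≤n td35 full35

  full215 : Full 215
  full215 = fill-equal 6 30 5 gdd30^7 full35 holed35

  full235 : Full 235
  full235 = fill-equal 4 46 5 td46 full51 holed51

  full255 : Full 255
  full255 = fill-small 4 51 0 z≤n td51 full51

  full275 : Full 275
  full275 = fill-small 4 55 0 z≤n td55 full55

  full315 : Full 315
  full315 = fill-small 6 45 0 z≤n gdd45^7 full45

  full335 : Full 335
  full335 = fill-equal 10 30 5 gdd30^11 full35 holed35

  full355 : Full 355
  full355 = fill-small 4 71 0 z≤n td71 full71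

coprime-12 : ∀ {n} → n % 2 ≢ 0 → n % 3 ≢ 0 → Coprime 12 n
coprime-12 {n} a b {d} (p , q) = go (small d (s≤s (∣⇒≤ p)) p)
  where
  table : ∀ (d : Fin 13) → toℕ d ∣ 12 → (toℕ d ≡ 1) ⊎ (2 ∣ toℕ d) ⊎ (3 ∣ toℕ d)
  table = from-yes (FP.all? λ (d : Fin 13) → (toℕ d ∣? 12) →-dec ((toℕ d ℕP.≟ 1) ⊎-dec ((2 ∣? toℕ d) ⊎-dec (3 ∣? toℕ d))))
  small : ∀ d → d < 13 → d ∣ 12 → (d ≡ 1) ⊎ (2 ∣ d) ⊎ (3 ∣ d)
  small d lt p = subst (λ d → d ∣ 12 → (d ≡ 1) ⊎ (2 ∣ d) ⊎ (3 ∣ d)) (FP.toℕ-fromℕ< lt) (table (fromℕ< lt)) p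
  go : (d ≡ 1) ⊎ (2 ∣ d) ⊎ (3 ∣ d) → d ≡ 1
  go (inj₁ e) = e
  go (inj₂ (inj₁ r)) = contradiction (Equivalence.from (m%n≡0⇔n∣m n 2) (∣-trans r q)) a
  go (inj₂ (inj₂ r)) = contradiction (Equivalence.from (m%n≡0⇔n∣m n 3) (∣-trans r q)) b

coprime-60 : ∀ {n} → n % 2 ≢ 0 → n % 3 ≢ 0 → n % 5 ≢ 0 → Coprime 60 n
coprime-60 {n} a b c {d} (p , q) = go (small d (s≤s (∣⇒≤ p)) p)
  where
  Small : ℕ → Set
  Small d = (d ≡ 1) ⊎ (2 ∣ d) ⊎ (3 ∣ d) ⊎ (5 ∣ d)
  table : ∀ (d : Fin 61) → toℕ d ∣ 60 → Small (toℕ d)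
  table = from-yes (FP.all? λ (d : Fin 61) → (toℕ d ∣? 60) →-dec
    ((toℕ d ℕP.≟ 1) ⊎-dec ((2 ∣? toℕ d) ⊎-dec ((3 ∣? toℕ d) ⊎-dec (5 ∣? toℕ d)))))
  small : ∀ d → d < 61 → d ∣ 60 → Small d
  small d lt p = subst (λ d → d ∣ 60 → Small d) (FP.toℕ-fromℕ< lt) (table (fromℕ< lt)) p
  go : Small d → d ≡ 1
  go (inj₁ e) = e
  go (inj₂ (inj₁ r)) = contradiction (Equivalence.from (m%n≡0⇔n∣m n 2) (∣-trans r q)) a
  go (inj₂ (inj₂ (inj₁ r))) = contradiction (Equivalence.from (m%n≡0⇔n∣m n 3) (∣-trans r q)) b
  go (inj₂ (inj₂ (inj₂ r))) = contradiction (Equivalence.from (m%n≡0⇔n∣m n 5) (∣-trans r q)) c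

holed-on : ∀ {A B : Set} {e} → A ↔ B → Design (A ⊎ Fin e) (Holed A e) → Design (B ⊎ Fin e) (Holed B e)
holed-on {A} {B} {e} i = relabel (mk↔ₛ′ t u tu ut)
  (λ { {x} {y} (ne , h) → (λ q → ne (trans (sym (ut x)) (trans (cong u q) (ut y)))) , λ { (p , q) → h (t-hole x p , t-hole y q) } })
  (λ { {x} {y} (ne , h) → (λ q → ne (trans (sym (tu x)) (trans (cong t q) (tu y)))) , λ { (p , q) → h (u-hole x p , u-hole y q) } })
  where
  open Inverse i
  t : A ⊎ Fin e → B ⊎ Fin e
  t (inj₁ a) = inj₁ (to a)
  t (inj₂ a) = inj₂ a
  u : B ⊎ Fin e → A ⊎ Fin e
  u (inj₁ a) = inj₁ (from a)
  u (inj₂ a) = inj₂ a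
  tu : ∀ y → t (u y) ≡ y
  tu (inj₁ a) = cong inj₁ (strictlyInverseˡ a)
  tu (inj₂ a) = refl
  ut : ∀ y → u (t y) ≡ y
  ut (inj₁ a) = cong inj₁ (strictlyInverseʳ a)
  ut (inj₂ a) = refl
  t-hole : ∀ x → (∃ λ a → t x ≡ inj₂ a) → ∃ λ a → x ≡ inj₂ a
  t-hole (inj₁ _) (_ , ())
  t-hole (inj₂ a) _ = a , refl
  u-hole : ∀ x → (∃ λ a → u x ≡ inj₂ a) → ∃ λ a → x ≡ inj₂ a
  u-hole (inj₁ _) (_ , ())
  u-hole (inj₂ a) _ = a , refl

module _ where

  open Plane 4 using (inflate-plane; unit-12)

  weight195 : Fin 8 → ℕ
  weight195 g = if toℕ g <ᵇ 5 then 6 else if toℕ g <ᵇ 7 then 0 else 8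

  -- The order 195 is 5 · 30 + 40 + 5. Weights 6 and 8 over ℤ/5 give five groups of 30 and one of
  -- 40; with five extra points these become 35 with a hole and 45.
  gdd30^5,40 : GDD 8 (λ g → Σ (Fin 5) λ _ → Fin (weight195 g))
  gdd30^5,40 = inflate-plane (λ g _ → Fin (weight195 g)) (λ {g} {h} lt lt' _ v →
      unit-12 (coprime-12 {5} (λ ()) (λ ())) _ (ℕP.m<n⇒0<n∸m lt) (ℕP.≤-<-trans (ℕP.m∸n≤m (toℕ h) (toℕ g)) (small h lt' v)))
    (λ _ → place-groups {s = weight195} (# 0 ∷ # 1 ∷ # 2 ∷ # 3 ∷ # 4 ∷ # 7 ∷ []) (6 ∷ 6 ∷ 6 ∷ 6 ∷ 6 ∷ 0 ∷ 0 ∷ 8 ∷ [])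
       (from-yes (FP.all? λ g → V.lookup (6 ∷ 6 ∷ 6 ∷ 6 ∷ 6 ∷ 0 ∷ 0 ∷ 8 ∷ []) g ℕP.≟ weight195 g)) gdd6^5,8)
    where
    small : ∀ (h : Fin 8) → toℕ h < 7 → Fin (weight195 h) → toℕ h < 5
    small h lt v with toℕ h <ᵇ 5 in e | toℕ h <ᵇ 7 | T-true (ℕP.<⇒<ᵇ lt)
    ... | true  | _ | _ = ℕP.<ᵇ⇒< (toℕ h) 5 (subst T (sym e) tt)
    ... | false | true | _ with v
    ...   | ()

  abstract
    full195 : Full 195
    full195 = ≢-on (⊎-Fin 5 whole) (fill (# 7) gdd30^5,40 (full-on (proj₂ (groups (# 7))) refl full45) hole)
      where
      groups : ∀ g → Finite (Σ (Fin 5) λ _ → Fin (weight195 g))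
      groups g = finite-Σ (finite-Fin 5) (λ _ → finite-Fin (weight195 g))
      whole : (Σ (Fin 8) λ g → Σ (Fin 5) λ _ → Fin (weight195 g)) ↔ Fin 190
      whole = proj₂ (finite-Σ (finite-Fin 8) groups)
      large : ∀ {A : Set} → A ↔ Fin 30 → Design (A ⊎ Fin 5) (Holed A 5)
      large e = holed-on (↔-sym e) holed35
      empty : ∀ {A : Set} → ¬ A → Design (A ⊎ Fin 5) (Holed A 5)
      empty none = no-pairs λ { {inj₁ a} _ → none a ; {inj₂ a} {inj₁ b} _ → none b ; {inj₂ a} {inj₂ b} (_ , h) → h ((a , refl) , (b , refl)) }
      hole : ∀ i → i ≢ # 7 → Design ((Σ (Fin 5) λ _ → Fin (weight195 i)) ⊎ Fin 5) (Holed (Σ (Fin 5) λ _ → Fin (weight195 i)) 5)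
      hole zero _ = large (proj₂ (groups zero))
      hole (suc zero) _ = large (proj₂ (groups zero))
      hole (suc (suc zero)) _ = large (proj₂ (groups zero))
      hole (suc (suc (suc zero))) _ = large (proj₂ (groups zero))
      hole (suc (suc (suc (suc zero)))) _ = large (proj₂ (groups zero))
      hole (suc (suc (suc (suc (suc zero))))) _ = empty λ ()
      hole (suc (suc (suc (suc (suc (suc zero)))))) _ = empty λ ()
      hole (suc (suc (suc (suc (suc (suc (suc zero))))))) ne = contradiction refl ne

-- The orders 10 r + 1

module Master = Step td10 gdd10^6 gdd10^7 gdd10^8 gdd10^5,4 gdd10^7,4
open Master using (ten; four)

_∈?_ : ℕ → List ℕ → Bool
x ∈? []       = false
x ∈? (y ∷ ys) = (x ≡ᵇ y) ∨ (x ∈? ys)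

R : ℕ → Set₁
R r = Full (r * 10 + 1)

direct : List ℕ
direct = 0 ∷ 2 ∷ 3 ∷ 4 ∷ 5 ∷ 7 ∷ 11 ∷ 13 ∷ 17 ∷ 19 ∷ 23 ∷ 31 ∷ []

∈?-sound : ∀ {x} xs → T (x ∈? xs) → x ∈ xs
∈?-sound (y ∷ ys) t with ∨-T t
... | inj₁ e = here (ℕP.≡ᵇ⇒≡ _ _ e)
... | inj₂ u = there (∈?-sound ys u)

R-direct : All R direct
R-direct = single-point ∷ full21 ∷ full31 ∷ full41 ∷ full51 ∷ full71 ∷ full111 ∷ full131 ∷ full171 ∷
           full191 ∷ full231 ∷ full311 ∷ []

-- The r for which a design on 10 r + 1 points is constructed.
good : ℕ → Bool
good r = (r ∈? direct) ∨ ((r ∈? (25 ∷ 27 ∷ 28 ∷ 29 ∷ 30 ∷ 35 ∷ [])) ∨ (37 ≤ᵇ r))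

odd₃₅ : ℕ → Bool
odd₃₅ n = not (n % 2 ≡ᵇ 0) ∧ (not (n % 3 ≡ᵇ 0) ∧ not (n % 5 ≡ᵇ 0))

not-≡ᵇ : ∀ {a b} → T (not (a ≡ᵇ b)) → a ≢ b
not-≡ᵇ t e = not-T t (ℕP.≡⇒≡ᵇ _ _ e)

odd₃₅-coprime : ∀ {n} → T (odd₃₅ n) → Coprime 60 n
odd₃₅-coprime {n} t = let (a , t') = ∧-T {not (n % 2 ≡ᵇ 0)} t ; (b , c) = ∧-T {not (n % 3 ≡ᵇ 0)} t' in
  coprime-60 (not-≡ᵇ a) (not-≡ᵇ b) (not-≡ᵇ c)

-- One step with all weights 10, counted in units of ten points: five groups of n, two of j and one
-- of c.
record Splits (r : ℕ) : Set where
  constructor splits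
  field
    n-1 j c : ℕ
    units   : Master.Units n-1 j c ten
    j≤n     : j ≤ suc n-1
    c≤n     : c ≤ suc n-1
    total   : 5 * suc n-1 + 2 * j + c ≡ r
    goods   : T (good (suc n-1)) × T (good j) × T (good c)

R-step : ∀ {r} → (s : Splits r) → R (suc (Splits.n-1 s)) → R (Splits.j s) → R (Splits.c s) → R r
R-step (splits n-1 j c units j≤n c≤n refl _) Dn Dj Dc = subst-Full (trans (cong (λ z → five (suc n-1 * 10) + (j * 10 + (j * 10 + (z + 0))) + 1) (tail≡ c)) (count n-1 j c))
  (subst-Full (shape n-1 j c) (Master.step n-1 j c ten units j≤n c≤n Dn Dj (subst-Full (cong (_+ 1) (sym (tail≡ c))) Dc)))
  where
  tail≡ : ∀ c → Master.tail n-1 j c ten c ≡ c * 10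
  tail≡ zero    = refl
  tail≡ (suc c) = refl
  five : ℕ → ℕ
  five x = x + (x + (x + (x + x)))
  shape : ∀ n-1 j c → sumF 8 (Master.sizeOf n-1 j c ten) + 1 ≡ five (suc n-1 * 10) + (j * 10 + (j * 10 + (Master.tail n-1 j c ten c + 0))) + 1
  shape n-1 j c = lemma (suc n-1 * 10) _
    where
    lemma : ∀ x y → x + (x + (x + (x + (x + y)))) + 1 ≡ (x + (x + (x + (x + x)))) + y + 1
    lemma = solve-∀
  count : ∀ n j c → (1 + n) * 10 + ((1 + n) * 10 + ((1 + n) * 10 + ((1 + n) * 10 + (1 + n) * 10))) + (j * 10 + (j * 10 + (c * 10 + 0))) + 1
                    ≡ (5 * (1 + n) + 2 * j + c) * 10 + 1
  count = solve-∀

admissible : ℕ → ℕ × ℕ × ℕ → Bool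
admissible r (n , j , c) = (0 <ᵇ n) ∧ ((odd₃₅ n ∨ ((n ≡ᵇ 5) ∧ (j ≡ᵇ 0))) ∧ ((j ≤ᵇ n) ∧ ((c ≤ᵇ n) ∧
  ((5 * n + 2 * j + c ≡ᵇ r) ∧ (good n ∧ (good j ∧ good c))))))

admissible-splits : ∀ r s → T (admissible r s) → Splits r
admissible-splits r (suc n , j , c) t =
  let (t₁ , u₁) = ∧-T {odd₃₅ (suc n) ∨ ((suc n ≡ᵇ 5) ∧ (j ≡ᵇ 0))} t
      (t₂ , u₂) = ∧-T {j ≤ᵇ suc n} u₁
      (t₃ , u₃) = ∧-T {c ≤ᵇ suc n} u₂
      (t₄ , u₄) = ∧-T {5 * suc n + 2 * j + c ≡ᵇ r} u₃
      (t₅ , u₅) = ∧-T {good (suc n)} u₄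
      (t₆ , t₇) = ∧-T {good j} u₅
  in splits n j c (unit t₁) (ℕP.≤ᵇ⇒≤ j (suc n) t₂) (ℕP.≤ᵇ⇒≤ c (suc n) t₃) (ℕP.≡ᵇ⇒≡ _ r t₄) (t₅ , t₆ , t₇)
  where
  unit : T (odd₃₅ (suc n) ∨ ((suc n ≡ᵇ 5) ∧ (j ≡ᵇ 0))) → Master.Units n j c ten
  unit t with ∨-T {odd₃₅ (suc n)} t
  ... | inj₁ u = inj₁ (odd₃₅-coprime u)
  ... | inj₂ u = let (p , q) = ∧-T {suc n ≡ᵇ 5} u in
        inj₂ (ℕP.≡ᵇ⇒≡ j 0 q , subst (Coprime 12) (sym (ℕP.≡ᵇ⇒≡ (suc n) 5 p)) (coprime-12 {5} (λ ()) (λ ())))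

first : {A : Set} → (A → Bool) → A → List A → A
first p d []       = d
first p d (x ∷ xs) = if p x then x else first p d xs

seek : ℕ → ℕ × ℕ × ℕ
seek r = scan (upTo (suc (r / 5)))
  where
  candidates : ℕ → List (ℕ × ℕ × ℕ)
  -- The first eleven values are orders given directly; 37 and 38 add larger ones of both parities.
  -- Where the halving rounds, the sum is wrong and `admissible` rejects the candidate.
  candidates n = map (λ c → n , (r ∸ (5 * n + c)) / 2 , c) (0 ∷ 2 ∷ 3 ∷ 4 ∷ 5 ∷ 7 ∷ 11 ∷ 13 ∷ 17 ∷ 19 ∷ 23 ∷ 37 ∷ 38 ∷ [])
  scan : List ℕ → ℕ × ℕ × ℕ
  scan []       = 0 , 0 , 0
  -- The bounds j ≤ n and c ≤ n give r ≤ 5 n + 2 n + n. A result with n = 0 signals that no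
  -- candidate fits.
  scan (n ∷ ns) = if r ≤ᵇ 8 * n then try (first (admissible r) (0 , 0 , 0) (candidates n)) ns else scan ns
    where
    try : ℕ × ℕ × ℕ → List ℕ → ℕ × ℕ × ℕ
    try (0 , _)     ns = scan ns
    try x@(suc _ , _) _ = x

-- Among the small values, 25, 27, 28, 29 and 30 are 5 · 5 + c with n = 5 and j = 0, and 35 is 5 ·
-- 7.
tabled : ℕ → Bool
tabled r = not (good r) ∨ ((r ∈? direct) ∨ admissible r (seek r))

abstract
  tabled-sound : ∀ {r} → r < 720 → T (tabled r)
  tabled-sound = allN-sound 720 {tabled} (subst T (sym all-tabled) tt)
    where
    all-tabled : allN 720 tabled ≡ true
    all-tabled = refl

good-large : ∀ {r} → 37 ≤ r → T (good r)
good-large {r} le = ∨-right (r ∈? direct) (∨-right (r ∈? (25 ∷ 27 ∷ 28 ∷ 29 ∷ 30 ∷ 35 ∷ [])) (ℕP.≤⇒≤ᵇ le))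
  where
  ∨-right : ∀ x {y} → T y → T (x ∨ y)
  ∨-right true  _ = tt
  ∨-right false t = t

odd₃₅-progression : ∀ k → T (odd₃₅ (1 + k * 30))
odd₃₅-progression k = and (nonzero (residue-1 2 15 refl)) (and (nonzero (residue-1 3 10 refl)) (nonzero (residue-1 5 6 refl)))
  where
  residue-1 : ∀ d e .{{_ : NonZero d}} → 30 ≡ e * d → (1 + k * 30) % d ≡ 1 % d
  residue-1 d e q = trans (cong (λ z → (1 + z) % d) (trans (cong (k *_) q) (sym (ℕP.*-assoc k e d)))) ([m+kn]%n≡m%n 1 (k * e) d)
  nonzero : ∀ {a} → a ≡ 1 → T (not (a ≡ᵇ 0))
  nonzero refl = tt
  and : ∀ {a b} → T a → T b → T (a ∧ b)
  and {true} {true} _ _ = tt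

progression-≥ : ∀ {k} → 4 ≤ k → 121 ≤ 1 + k * 30
progression-≥ le = s≤s (ℕP.*-monoˡ-≤ 30 le)

-- Take n = 30 k + 1, which is prime to 60. As k grows by one, 5 n grows by 150, so j and c must
-- absorb a remainder d < 150: here 2 j + p = 75 + d and c = 40 + p. The offsets 75 and 40 make j
-- and c at least 37, hence good. Since j can reach 112, n ≥ 121 is wanted, that is k ≥ 4, and 720 =
-- 120 + 4 · 150.
large-splits : ∀ r → 720 ≤ r → Splits r
large-splits r le = splits (k * 30) j (40 + p) (inj₁ (odd₃₅-coprime (odd₃₅-progression k)))
  (ℕP.≤-trans (/-monoˡ-≤ 2 (ℕP.+-monoʳ-≤ 75 (ℕP.≤-pred (m%n<n x 150)))) (ℕP.≤-trans (from-yes (112 ℕP.≤? 121)) n≥121))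
  (ℕP.≤-trans (ℕP.+-monoʳ-≤ 40 (ℕP.≤-pred (m%n<n y 2))) (ℕP.≤-trans (from-yes (41 ℕP.≤? 121)) n≥121))
  total
  (good-large (ℕP.≤-trans (from-yes (37 ℕP.≤? 121)) n≥121) , good-large (/-monoˡ-≤ 2 (ℕP.m≤m+n 75 d)) ,
   good-large (ℕP.≤-trans (from-yes (37 ℕP.≤? 40)) (ℕP.m≤m+n 40 p)))
  where
  x k d y j p : ℕ
  x = r ∸ 120
  k = x / 150
  d = x % 150
  y = 75 + d
  j = y / 2
  p = y % 2
  n≥121 : 121 ≤ 1 + k * 30
  n≥121 = progression-≥ (/-monoˡ-≤ 150 (ℕP.∸-monoˡ-≤ 120 le))
  rearrange₁ : ∀ k j p → 5 * (1 + k * 30) + 2 * j + (40 + p) ≡ 45 + k * 150 + (p + j * 2)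
  rearrange₁ = solve-∀
  rearrange₂ : ∀ k d → 45 + k * 150 + (75 + d) ≡ 120 + (d + k * 150)
  rearrange₂ = solve-∀
  total : 5 * (1 + k * 30) + 2 * j + (40 + p) ≡ r
  total = trans (rearrange₁ k j p) (trans (cong (45 + k * 150 +_) (sym (m≡m%n+[m/n]*n y 2)))
    (trans (rearrange₂ k d) (trans (cong (120 +_) (sym (m≡m%n+[m/n]*n x 150))) (ℕP.m+[n∸m]≡n (ℕP.≤-trans (from-yes (120 ℕP.≤? 720)) le)))))

-- The induction descends because j and c are at most n, and 5 n ≤ r with n positive.
R-good : ∀ r → T (good r) → R r
R-good = <-rec (λ r → T (good r) → R r) λ r rec g → by-size r rec g (ℕP.≤-<-connex 720 r)
  where
  Rec : ℕ → Set₁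
  Rec r = ∀ {s} → s < r → T (good s) → R s
  by-splits : ∀ r → Rec r → Splits r → R r
  by-splits r rec s@(splits n-1 j c _ j≤n c≤n total (gn , gj , gc)) =
    R-step s (rec n<r gn) (rec (ℕP.≤-<-trans j≤n n<r) gj) (rec (ℕP.≤-<-trans c≤n n<r) gc)
    where
    n<r : suc n-1 < r
    n<r = ℕP.<-≤-trans (ℕP.m<m+n (suc n-1) {4 * suc n-1} (s≤s z≤n))
      (subst (5 * suc n-1 ≤_) total (ℕP.≤-trans (ℕP.m≤m+n (5 * suc n-1) (2 * j)) (ℕP.m≤m+n _ c)))
  by-table : ∀ r → Rec r → T (good r) → T (not (good r)) ⊎ T ((r ∈? direct) ∨ admissible r (seek r)) → R r
  by-table r rec g (inj₁ t) = contradiction g (not-T t)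
  by-table r rec g (inj₂ t) = go (∨-T {r ∈? direct} t)
    where
    go : T (r ∈? direct) ⊎ T (admissible r (seek r)) → R r
    go (inj₁ u) = All.lookup R-direct (∈?-sound {r} direct u)
    go (inj₂ u) = by-splits r rec (admissible-splits r (seek r) u)
  by-size : ∀ r → Rec r → T (good r) → (720 ≤ r) ⊎ (r < 720) → R r
  by-size r rec g (inj₁ le) = by-splits r rec (large-splits r le)
  by-size r rec g (inj₂ lt) = by-table r rec g (∨-T {not (good r)} (tabled-sound lt))

-- The orders 20 t + 15

Q : ℕ → Set₁
Q t = Full (15 + t * 20)

-- With n = 1 + 2 p and c = 3 + 2 e the order 50 n + 20 j + 4 + 10 (c - 1) + 1 equals 15 + 20 (5 p +
-- 3 + j + e). The last group with ∞ has 25 + 20 e points.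
record Splits₁₅ (t : ℕ) : Set where
  constructor splits₁₅
  field
    p j     : ℕ
    e       : Fin 3
    coprime : Coprime 60 (1 + 2 * p)
    j≤n     : j ≤ 1 + 2 * p
    c≤n     : 3 + 2 * toℕ e ≤ 1 + 2 * p
    total   : 5 * p + 3 + j + toℕ e ≡ t
    goods   : T (good (1 + 2 * p)) × T (good j)

five-groups : ∀ n-1 j c h → sumF 8 (Master.sizeOf n-1 j c h) + 1 ≡ 5 * (suc n-1 * 10) + (2 * (j * 10) + Master.tail n-1 j c h c) + 1
five-groups n-1 j c h = lemma (suc n-1 * 10) (j * 10) (Master.tail n-1 j c h c)
  where
  lemma : ∀ x y z → x + (x + (x + (x + (x + (y + (y + (z + 0))))))) + 1 ≡ 5 * x + (2 * y + z) + 1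
  lemma = solve-∀

Q-step : ∀ {t} → Splits₁₅ t → Q t
Q-step (splits₁₅ p j e coprime j≤n c≤n refl (gn , gj)) = subst-Full
  (trans (five-groups (2 * p) j (3 + 2 * toℕ e) four) (count p j (toℕ e)))
  (Master.step (2 * p) j (3 + 2 * toℕ e) four (inj₁ coprime) j≤n c≤n (R-good (1 + 2 * p) gn) (R-good j gj) (last e))
  where
  last : ∀ e → Full (Master.tail (2 * p) j (3 + 2 * toℕ e) four (3 + 2 * toℕ e) + 1)
  last zero             = full25
  last (suc zero)       = full45
  last (suc (suc zero)) = full65
  count : ∀ p j e → 5 * ((1 + 2 * p) * 10) + (2 * (j * 10) + (4 + (2 + 2 * e) * 10)) + 1 ≡ 15 + (5 * p + 3 + j + e) * 20
  count = solve-∀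

-- The order 250 + 44 + 1 with n = 5, which is not prime to 60 and therefore outside `Splits₁₅`.
full295 : Full 295
full295 = Master.step 4 0 5 four (inj₂ (refl , coprime-12 {5} (λ ()) (λ ()))) z≤n ℕP.≤-refl full51 single-point full45

directQ : List ℕ
directQ = 1 ∷ 2 ∷ 3 ∷ 4 ∷ 5 ∷ 6 ∷ 7 ∷ 8 ∷ 9 ∷ 10 ∷ 11 ∷ 12 ∷ 13 ∷ 14 ∷ 15 ∷ 16 ∷ 17 ∷ []

Q-direct : All Q directQ
Q-direct = full35 ∷ full55 ∷ full75 ∷ full95 ∷ full115 ∷ full135 ∷ full155 ∷ full175 ∷ full195 ∷ full215 ∷
           full235 ∷ full255 ∷ full275 ∷ full295 ∷ full315 ∷ full335 ∷ full355 ∷ []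

admissible₁₅ : ℕ → ℕ × ℕ × Fin 3 → Bool
admissible₁₅ t (p , j , e) = odd₃₅ (1 + 2 * p) ∧ ((j ≤ᵇ 1 + 2 * p) ∧ ((3 + 2 * toℕ e ≤ᵇ 1 + 2 * p) ∧
  ((5 * p + 3 + j + toℕ e ≡ᵇ t) ∧ (good (1 + 2 * p) ∧ good j))))

admissible-splits₁₅ : ∀ t s → T (admissible₁₅ t s) → Splits₁₅ t
admissible-splits₁₅ t (p , j , e) a =
  let (t₁ , u₁) = ∧-T {odd₃₅ (1 + 2 * p)} a
      (t₂ , u₂) = ∧-T {j ≤ᵇ 1 + 2 * p} u₁
      (t₃ , u₃) = ∧-T {3 + 2 * toℕ e ≤ᵇ 1 + 2 * p} u₂
      (t₄ , u₄) = ∧-T {5 * p + 3 + j + toℕ e ≡ᵇ t} u₃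
      (t₅ , t₆) = ∧-T {good (1 + 2 * p)} u₄
  in splits₁₅ p j e (odd₃₅-coprime t₁) (ℕP.≤ᵇ⇒≤ j _ t₂) (ℕP.≤ᵇ⇒≤ (3 + 2 * toℕ e) _ t₃) (ℕP.≡ᵇ⇒≡ _ t t₄) (t₅ , t₆)

seek₁₅ : ℕ → ℕ × ℕ × Fin 3
seek₁₅ t = scan (upTo (suc (t / 5)))
  where
  candidates : ℕ → List (ℕ × ℕ × Fin 3)
  candidates p = map (λ e → p , (t ∸ (5 * p + 3 + toℕ e)) , e) (zero ∷ suc zero ∷ suc (suc zero) ∷ [])
  scan : List ℕ → ℕ × ℕ × Fin 3
  scan []       = 0 , 0 , zero
  -- The largest reachable value, with j = 2 p + 1 and e = 2.
  scan (p ∷ ps) = if t ≤ᵇ 7 * p + 6 then try (first (admissible₁₅ t) (0 , 0 , zero) (candidates p)) ps else scan ps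
    where
    try : ℕ × ℕ × Fin 3 → List ℕ → ℕ × ℕ × Fin 3
    try (0 , _)       ps = scan ps
    try x@(suc _ , _) _  = x

tabled₁₅ : ℕ → Bool
-- The entry 0 stands for the excluded order 15; it lets the check run over all t below 340.
tabled₁₅ t = (t ∈? (0 ∷ directQ)) ∨ admissible₁₅ t (seek₁₅ t)

abstract
  tabled₁₅-sound : ∀ {t} → t < 340 → T (tabled₁₅ t)
  tabled₁₅-sound = allN-sound 340 {tabled₁₅} (subst T (sym all-tabled) tt)
    where
    all-tabled : allN 340 tabled₁₅ ≡ true
    all-tabled = refl

-- Again n = 30 k + 1, now with e = 0, so that 5 p + 3 = 75 k + 3. The group parameter j = 37 + d
-- with d < 75 takes the remainder; it is good, and at most 111. The bound 340 = 40 + 4 · 75 gives k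
-- ≥ 4 and n ≥ 121.
large-splits₁₅ : ∀ t → 340 ≤ t → Splits₁₅ t
large-splits₁₅ t le = splits₁₅ (k * 15) (37 + d) zero (subst (Coprime 60) n≡ (odd₃₅-coprime (odd₃₅-progression k)))
  (ℕP.≤-trans (ℕP.+-monoʳ-≤ 37 (ℕP.≤-pred (m%n<n x 75))) (ℕP.≤-trans (from-yes (111 ℕP.≤? 121)) n≥121))
  (ℕP.≤-trans (from-yes (3 ℕP.≤? 121)) n≥121)
  (trans (rearrange k d) (trans (cong (40 +_) (sym (m≡m%n+[m/n]*n x 75))) (ℕP.m+[n∸m]≡n (ℕP.≤-trans (from-yes (40 ℕP.≤? 340)) le))))
  (good-large (ℕP.≤-trans (from-yes (37 ℕP.≤? 121)) n≥121) , good-large (ℕP.m≤m+n 37 d))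
  where
  x k d : ℕ
  x = t ∸ 40
  k = x / 75
  d = x % 75
  n≡ : 1 + k * 30 ≡ 1 + 2 * (k * 15)
  n≡ = double k
    where
    double : ∀ k → 1 + k * 30 ≡ 1 + 2 * (k * 15)
    double = solve-∀
  n≥121 : 121 ≤ 1 + 2 * (k * 15)
  n≥121 = subst (121 ≤_) n≡ (progression-≥ (/-monoˡ-≤ 75 (ℕP.∸-monoˡ-≤ 40 le)))
  rearrange : ∀ k d → 5 * (k * 15) + 3 + (37 + d) + 0 ≡ 40 + (d + k * 75)
  rearrange = solve-∀

Q-all : ∀ t → 0 < t → Q t
Q-all t 0<t = by-size (ℕP.≤-<-connex 340 t)
  where
  by-table : T (t ∈? (0 ∷ directQ)) ⊎ T (admissible₁₅ t (seek₁₅ t)) → Q t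
  by-table (inj₂ u) = Q-step (admissible-splits₁₅ t (seek₁₅ t) u)
  by-table (inj₁ u) with ∈?-sound {t} (0 ∷ directQ) u
  ... | here refl = contradiction 0<t λ ()
  ... | there q   = All.lookup Q-direct q
  by-size : (340 ≤ t) ⊎ (t < 340) → Q t
  by-size (inj₁ le) = Q-step (large-splits₁₅ t le)
  by-size (inj₂ lt) = by-table (∨-T {t ∈? (0 ∷ directQ)} (tabled₁₅-sound lt))

theorem3p3 : ∀ (v : ℕ) → v % 20 ≡ 15 → 15 < v →
    Σ (List (Block v)) λ B → IsDD v B × SuperSimple B × fAtLeastHalf v B
theorem3p3 v e lt = result (subst-Full (sym v≡) (Q-all (v / 20) (positive (v / 20) v≡)))
  where
  v≡ : v ≡ 15 + (v / 20) * 20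
  v≡ = trans (m≡m%n+[m/n]*n v 20) (cong (_+ (v / 20) * 20) e)
  positive : ∀ t → v ≡ 15 + t * 20 → 0 < t
  positive zero    q = contradiction lt (λ l → ℕP.<-irrefl (sym q) l)
  positive (suc t) q = s≤s z≤n
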